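{- (1) For each $k\geq 2$, $\mathrm{S}(k)\subsetneq\mathcal{R}^p_m(\mathrm{S}(k))$. (2) There exists a set $A\in\mathrm{S}(2)$ such that $A\leq^p_m\overline{A}$ and $A\notin\mathrm{P}$.
   Context: Sets are languages over $\Sigma=\{0,1\}$; FP is the class of polynomial-time computable functions; $\overline{A}=\Sigma^*-A$. For a positive integer $k$, $\mathrm{S}(k)$ is the class of sets $L$ for which there is an FP function $f$ such that for every $n\geq 1$ and all distinct strings $y_1,\dots,y_n$ (given as a tuple in lexicographic order): $f(y_1,\dots,y_n)\subseteq\{y_1,\dots,y_n\}$, and if $\|L\cap\{y_1,\dots,y_n\}\|\geq k$ then $f(y_1,\dots,y_n)\subseteq L$ and $\|f(y_1,\dots,y_n)\|\geq 1$. $\leq^p_m$ is polynomial-time many-one reducibility, and for a class $\mathcal{C}$, $\mathcal{R}^p_m(\mathcal{C})=\{L:(\exists C\in\mathcal{C})[L\leq^p_m C]\}$. $\subsetneq$ denotes strict inclusion. -}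

module Defs where

open import Data.Bool using (Bool; true; false)
open import Data.Nat using (ℕ; zero; suc; _+_; _*_; _^_; _≤_; _<_)
open import Data.Fin using (Fin)
open import Data.List using (List; []; _∷_; length; _++_)
open import Data.Sum using (_⊎_)
open import Data.List.Membership.Propositional using (_∈_)
open import Data.List.Relation.Unary.All using (All)
open import Data.List.Relation.Unary.Linked using (Linked)
open import Data.List.Relation.Binary.Sublist.Propositional using (_⊆_)
open import Data.Maybe using (Maybe; just; nothing)
open import Data.Product using (Σ; _×_; _,_; ∃)
open import Relation.Binary.PropositionalEquality using (_≡_)
open import Relation.Nullary using (¬_)
open import Level using (0ℓ; Lift) renaming (suc to lsuc)

Str : Set
Str = List Bool

Language : Set₁
Language = Str → Set

co : Language → Language
co A x = ¬ A x

data Sym : Set where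
  b0 b1 blank : Sym

data Move : Set where
  mL mR mS : Move

record TM : Set where
  field
    nstates : ℕ
    -- state 'Data.Fin.zero' is the start state;
    -- δ q a ≡ nothing means the machine halts in state q reading a
    δ : Fin (suc nstates) → Sym → Maybe (Fin (suc nstates) × Sym × Move)

-- tape zipper: cells left of the head (nearest first), head cell, cells right
record Tape : Set where
  constructor tape
  field
    left  : List Sym
    cur   : Sym
    right : List Sym

bitSym : Bool → Sym
bitSym false = b0
bitSym true  = b1

symsOf : Str → List Sym
symsOf [] = []
symsOf (b ∷ x) = bitSym b ∷ symsOf x

initTape : Str → Tape
initTape [] = tape [] blank []
initTape (b ∷ x) = tape [] (bitSym b) (symsOf x)

moveTape : Move → Tape → Tape
moveTape mL (tape [] c r) = tape [] blank (c ∷ r)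
moveTape mL (tape (l ∷ ls) c r) = tape ls l (c ∷ r)
moveTape mR (tape ls c []) = tape (c ∷ ls) blank []
moveTape mR (tape ls c (r ∷ rs)) = tape (c ∷ ls) r rs
moveTape mS t = t

readBits : List Sym → Str
readBits (b0 ∷ s) = false ∷ readBits s
readBits (b1 ∷ s) = true ∷ readBits s
readBits _ = []

output : Tape → Str
output (tape _ c r) = readBits (c ∷ r)

exec : (M : TM) → ℕ → Fin (suc (TM.nstates M)) → Tape → Maybe Tape
exec M t q T with TM.δ M q (Tape.cur T)
exec M t q T | nothing = just T
exec M zero q T | just _ = nothing
exec M (suc t) q (tape l c r) | just (q' , a , m) = exec M t q' (moveTape m (tape l a r))

HaltsWith : TM → Str → ℕ → Str → Set
HaltsWith M x t y = Σ Tape λ T → exec M t Data.Fin.zero (initTape x) ≡ just T × output T ≡ y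

FP : (Str → Str) → Set
FP f = Σ TM λ M → Σ ℕ λ c → ∀ x →
  Σ ℕ λ t → t ≤ c * length x ^ c + c × HaltsWith M x t (f x)

InP : Language → Set
InP A = Σ (Str → Str) λ f → FP f × (∀ x → (A x → f x ≡ true ∷ []) × (f x ≡ true ∷ [] → A x))

_≤pm_ : Language → Language → Set
A ≤pm B = Σ (Str → Str) λ f → FP f × (∀ x → (A x → B (f x)) × (B (f x) → A x))

Class : Set₂
Class = Language → Set₁

Rpm : Class → Class
Rpm C L = Σ Language λ D → C D × L ≤pm D

-- Encoding of tuples of strings: each bit b written as bb, each string
-- terminated by the separator 01.

dbl : Str → Str
dbl [] = []
dbl (b ∷ x) = b ∷ b ∷ dbl x

enc : List Str → Str
enc [] = []
enc (y ∷ ys) = dbl y ++ (false ∷ true ∷ enc ys)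

dec : Str → Maybe (List Str)
dec [] = just []
dec (false ∷ true ∷ r) with dec r
... | just ws = just ([] ∷ ws)
... | nothing = nothing
dec (false ∷ false ∷ r) with dec r
... | just (w ∷ ws) = just ((false ∷ w) ∷ ws)
... | _ = nothing
dec (true ∷ true ∷ r) with dec r
... | just (w ∷ ws) = just ((true ∷ w) ∷ ws)
... | _ = nothing
dec _ = nothing

data _<lex_ : Str → Str → Set where
  []<∷ : ∀ {b x} → [] <lex (b ∷ x)
  here : ∀ {x y} → (false ∷ x) <lex (true ∷ y)
  there : ∀ {b x y} → x <lex y → (b ∷ x) <lex (b ∷ y)

_<std_ : Str → Str → Set
x <std y = length x < length y ⊎ (length x ≡ length y × x <lex y)

-- ||L ∩ {y1,…,yn}|| ≥ k, for distinct y1,…,yn: some k of the yi lie in L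
AtLeastIn : ℕ → Language → List Str → Set
AtLeastIn k L ys = Σ (List Str) λ zs → zs ⊆ ys × length zs ≡ k × All L zs

-- the output of f on the tuple ys, viewed as a set of strings
SelOut : (Str → Str) → List Str → List Str → Set
SelOut f ys zs = dec (f (enc ys)) ≡ just zs

SClass : ℕ → Class
SClass k L = Σ (Str → Str) λ f → FP f × Lift (lsuc 0ℓ)
  (∀ (ys : List Str) → 1 ≤ length ys → Linked _<std_ ys →
     Σ (List Str) λ zs → SelOut f ys zs × All (_∈ ys) zs ×
       (AtLeastIn k L ys → All L zs × 1 ≤ length zs))

{-# OPTIONS --safe #-}

-- Let T(0) = 0 and T(j+1) = 2^T(j).  The sets A built here contain, for every j, exactly one of the
-- strings 1 b 1^T(j) and nothing else, and the bit b at stage j diagonalises against the j-th machine,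
-- simulated for 2^T(j) = T(j+1) steps on a question of length O(T(j)).  As every program returns with
-- arbitrary padding, each polynomial-time machine is met at a stage where 2^T(j) exceeds its time bound.
--
-- * A is in S(2): two members of a tuple lie at different stages, and the tuple is long enough to
--   redo the simulation that decides the smaller one.  Flipping b reduces A to its complement.
-- * Asking about 1 1 1^T(j) gives A ∉ P.
-- * Asking the machine to select from the 2k strings 0^i 1 b 1^T(j), i < k, of which exactly k reduce
--   into A by dropping leading zeros, gives a set outside S(k) that is many-one reducible to A.
--
-- Machines are produced from programs over several stacks of bits.  One stack occupies the right half
-- of the tape, where input and output live; the others are interleaved on the left half.
module Submission where

open import Defs
open import Data.Bool using (Bool; true; false; if_then_else_; not; T; _∧_)
import Data.Bool.Properties as Bool
open import Data.Nat hiding (compare)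
open import Data.Nat.Properties
open import Data.Nat.DivMod using ([m+kn]%n≡m%n; m<n⇒m%n≡m)
open import Data.Nat.Tactic.RingSolver using (solve-∀)
open import Data.Fin as Fin using (Fin; toℕ)
import Data.Fin.Properties as Fin
open import Data.Fin.Patterns
open import Data.Vec as Vec using (Vec; []; _∷_; lookup; _[_]≔_)
open import Data.Vec.Properties using (lookup∘update; lookup∘update′; lookup-replicate; []≔-idempotent; []≔-commutes; []≔-lookup)
open import Data.List using (List; []; _∷_; length; _++_; _ʳ++_; reverse; replicate; drop; filterᵇ)
open import Data.List.Properties using (length-++; ʳ++-defn; ++-ʳ++; ∷-injective; ∷-injectiveʳ; ++-assoc; unfold-reverse; reverse-involutive; length-reverse; length-replicate)
open import Data.Maybe using (Maybe; just; nothing; maybe)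
open import Data.Product using (Σ; _×_; _,_; proj₁; proj₂)
open import Data.Sum using (_⊎_; inj₁; inj₂)
open import Data.Unit using (⊤; tt)
open import Data.Empty using (⊥; ⊥-elim)
open import Data.Integer as ℤ using (ℤ; -[1+_]) renaming (+_ to ℕ⁺)
import Data.Integer.Properties as ℤ
open import Relation.Binary.Definitions using (tri<; tri≈; tri>)
open import Relation.Nullary using (¬_; yes; no; does)
open import Relation.Nullary.Decidable using (dec-true; dec-false)
open import Relation.Binary.PropositionalEquality using (_≡_; _≢_; refl; sym; trans; cong; cong₂; subst; subst₂; ≢-sym)
open import Function using (_∘_; id; _∋_; case_of_)
open import Level using (lift)
open import Data.List.Membership.Propositional using (_∈_)
open import Data.List.Relation.Unary.Any using (here; there)
open import Data.List.Relation.Unary.All as All using (All; []; _∷_)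
open import Data.List.Relation.Unary.AllPairs using (AllPairs; []; _∷_)
open import Data.List.Relation.Unary.Linked using (Linked; []; [-]; _∷_)
open import Data.List.Relation.Unary.Linked.Properties using (Linked⇒AllPairs)
open import Data.List.Relation.Binary.Sublist.Propositional using (_⊆_; []; _∷ʳ_; _∷_)
open import Data.List.Relation.Binary.Sublist.Propositional.Properties using (Any-resp-⊆)

-- Structured tape programs

-- The bit of a stage must be a total Boolean although machines need not halt. It is therefore the
-- negation of a finite inspection of whatever configuration the j-th program has reached after
-- exactly 2^T(j) steps. Every bit string counts as a program, and a halted machine loops in place,
-- so that its output is still on the tape when the clock stops. The selector cannot afford that
-- clock for the longest candidates. It runs every simulation with the input length as fuel and
-- treats a timeout like a rejection: what it returns always lies in A, and only missed members are
-- possible. Against S(k) the difficulty is to keep the promise of k members before the bit is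
-- known. Each of the k pairs has one member for either value of the bit; the first string that the
-- machine selects commits it to a value, and the stage takes the other one. Since `FP` speaks of
-- concrete one-tape machines, every function has to come with a program and an explicit time bound.

data Prog : Set where
  mv  : Move → Prog
  wr  : Sym → Prog
  _⨟_ : Prog → Prog → Prog
  ifs : (onBlank on0 on1 : Prog) → Prog
  whl : Prog → Prog

infixr 5 _⨟_

data Ink : Sym → Set where
  ink0 : Ink b0
  ink1 : Ink b1

data Exec : Prog → Tape → ℕ → Tape → Set where
  e-mv    : ∀ {m T} → Exec (mv m) T 1 (moveTape m T)
  e-wr    : ∀ {a l c r} → Exec (wr a) (tape l c r) 1 (tape l a r)
  e-seq   : ∀ {p q T U V t u} → Exec p T t U → Exec q U u V → Exec (p ⨟ q) T (t + u) V
  e-blank : ∀ {p q r xs ys U t} → Exec p (tape xs blank ys) t U → Exec (ifs p q r) (tape xs blank ys) (suc t) U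
  e-zero  : ∀ {p q r xs ys U t} → Exec q (tape xs b0 ys) t U → Exec (ifs p q r) (tape xs b0 ys) (suc t) U
  e-one   : ∀ {p q r xs ys U t} → Exec r (tape xs b1 ys) t U → Exec (ifs p q r) (tape xs b1 ys) (suc t) U
  e-stop  : ∀ {p xs ys} → Exec (whl p) (tape xs blank ys) 1 (tape xs blank ys)
  e-loop  : ∀ {p xs a ys U V t u} → Ink a → Exec p (tape xs a ys) t U → Exec (whl p) U u V →
            Exec (whl p) (tape xs a ys) (suc (t + u)) V

St : Prog → Set
St (mv _) = ⊤
St (wr _) = ⊤
St (p ⨟ q) = St p ⊎ St q
St (ifs p q r) = ⊤ ⊎ (St p ⊎ (St q ⊎ St r))
St (whl p) = ⊤ ⊎ St p

entry : ∀ p → St p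
entry (mv _) = tt
entry (wr _) = tt
entry (p ⨟ q) = inj₁ (entry p)
entry (ifs _ _ _) = inj₁ tt
entry (whl _) = inj₁ tt

redirect : {A B : Set} → (A → B) → A × Sym × Move → B × Sym × Move
redirect f x = f (proj₁ x) , proj₂ x

-- The target 'nothing' is the exit of the program.
Δ : ∀ p → St p → Sym → Maybe (St p) × Sym × Move
Δ (mv m) _ a = nothing , a , m
Δ (wr b) _ _ = nothing , b , mS
Δ (p ⨟ q) (inj₁ s) a = redirect (maybe (just ∘ inj₁) (just (inj₂ (entry q)))) (Δ p s a)
Δ (p ⨟ q) (inj₂ s) a = redirect (maybe (just ∘ inj₂) nothing) (Δ q s a)
Δ (ifs p q r) (inj₁ tt) blank = just (inj₂ (inj₁ (entry p))) , blank , mS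
Δ (ifs p q r) (inj₁ tt) b0 = just (inj₂ (inj₂ (inj₁ (entry q)))) , b0 , mS
Δ (ifs p q r) (inj₁ tt) b1 = just (inj₂ (inj₂ (inj₂ (entry r)))) , b1 , mS
Δ (ifs p q r) (inj₂ (inj₁ s)) a = redirect (maybe (just ∘ inj₂ ∘ inj₁) nothing) (Δ p s a)
Δ (ifs p q r) (inj₂ (inj₂ (inj₁ s))) a = redirect (maybe (just ∘ inj₂ ∘ inj₂ ∘ inj₁) nothing) (Δ q s a)
Δ (ifs p q r) (inj₂ (inj₂ (inj₂ s))) a = redirect (maybe (just ∘ inj₂ ∘ inj₂ ∘ inj₂) nothing) (Δ r s a)
Δ (whl p) (inj₁ tt) blank = nothing , blank , mS
Δ (whl p) (inj₁ tt) b0 = just (inj₂ (entry p)) , b0 , mS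
Δ (whl p) (inj₁ tt) b1 = just (inj₂ (entry p)) , b1 , mS
Δ (whl p) (inj₂ s) a = redirect (maybe (just ∘ inj₂) (just (inj₁ tt))) (Δ p s a)

module _ (M : TM) where

  State : Set
  State = Fin (suc (TM.nstates M))

  exec-step : ∀ {t q q' l c r a m} → TM.δ M q c ≡ just (q' , a , m) →
              exec M (suc t) q (tape l c r) ≡ exec M t q' (moveTape m (tape l a r))
  exec-step {q = q} {c = c} eq with TM.δ M q c | eq
  ... | _ | refl = refl

  exec-halt : ∀ {t q T} → TM.δ M q (Tape.cur T) ≡ nothing → exec M t q T ≡ just T
  exec-halt {q = q} {T = T} eq with TM.δ M q (Tape.cur T) | eq
  ... | _ | refl = refl

  -- The image of `nothing` is left free. A sequence or a loop then embeds its parts by choosing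
  -- where their exits lead, and no state has to be renumbered.
  Embeds : ∀ p → (Maybe (St p) → State) → Set
  Embeds p e = ∀ s a → TM.δ M (e (just s)) a ≡ just (redirect e (Δ p s a))

  -- In continuation form: the n steps left over are those of whatever follows the exit, so the
  -- times of consecutive parts simply add up.
  exec-Prog : ∀ {p T t U} (e : Maybe (St p) → State) → Embeds p e → Exec p T t U →
              ∀ n → exec M (t + n) (e (just (entry p))) T ≡ exec M n (e nothing) U
  exec-Prog e h e-mv n = exec-step (h tt _)
  exec-Prog e h e-wr n = exec-step (h tt _)
  exec-Prog e h (e-seq {t = t} {u} x y) n rewrite +-assoc t u n =
    trans (exec-Prog (e ∘ maybe (just ∘ inj₁) (just (inj₂ (entry _)))) (λ s → h (inj₁ s)) x (u + n))
          (exec-Prog (e ∘ maybe (just ∘ inj₂) nothing) (λ s → h (inj₂ s)) y n)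
  exec-Prog e h (e-blank x) n = trans (exec-step (h (inj₁ tt) blank))
    (exec-Prog (e ∘ maybe (just ∘ inj₂ ∘ inj₁) nothing) (λ s → h (inj₂ (inj₁ s))) x n)
  exec-Prog e h (e-zero x) n = trans (exec-step (h (inj₁ tt) b0))
    (exec-Prog (e ∘ maybe (just ∘ inj₂ ∘ inj₂ ∘ inj₁) nothing) (λ s → h (inj₂ (inj₂ (inj₁ s)))) x n)
  exec-Prog e h (e-one x) n = trans (exec-step (h (inj₁ tt) b1))
    (exec-Prog (e ∘ maybe (just ∘ inj₂ ∘ inj₂ ∘ inj₂) nothing) (λ s → h (inj₂ (inj₂ (inj₂ s)))) x n)
  exec-Prog e h e-stop n = exec-step (h (inj₁ tt) blank)
  exec-Prog {p = whl p} e h (e-loop {xs = xs} {ys = ys} {U = U} {t = t} {u} k x y) n rewrite +-assoc t u n =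
    trans (check k) (trans (exec-Prog (e ∘ maybe (just ∘ inj₂) (just (inj₁ tt))) (λ s → h (inj₂ s)) x (u + n))
                           (exec-Prog e h y n))
    where
    check : ∀ {a} → Ink a → exec M (suc (t + (u + n))) (e (just (inj₁ tt))) (tape xs a ys)
                          ≡ exec M (t + (u + n)) (e (just (inj₂ (entry p)))) (tape xs a ys)
    check ink0 = exec-step (h (inj₁ tt) b0)
    check ink1 = exec-step (h (inj₁ tt) b1)

-- From structured programs to Turing machines

size : Prog → ℕ
size (mv _) = 1
size (wr _) = 1
size (p ⨟ q) = size p + size q
size (ifs p q r) = 1 + (size p + (size q + size r))
size (whl p) = 1 + size p

enum : ∀ p → St p → Fin (size p)
enum (mv _) tt = Fin.zero
enum (wr _) tt = Fin.zero
enum (p ⨟ q) s = Fin.join (size p) (size q) (Data.Sum.map (enum p) (enum q) s)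
enum (ifs p q r) (inj₁ tt) = Fin.zero
enum (ifs p q r) (inj₂ s) = Fin.suc (Fin.join (size p) (size q + size r)
  (Data.Sum.map (enum p) (Fin.join (size q) (size r) ∘ Data.Sum.map (enum q) (enum r)) s))
enum (whl p) (inj₁ tt) = Fin.zero
enum (whl p) (inj₂ s) = Fin.suc (enum p s)

state : ∀ p → Fin (size p) → St p
state (mv _) i = tt
state (wr _) i = tt
state (p ⨟ q) i = Data.Sum.map (state p) (state q) (Fin.splitAt (size p) i)
state (ifs p q r) Fin.zero = inj₁ tt
state (ifs p q r) (Fin.suc i) = inj₂ (Data.Sum.map (state p)
  (Data.Sum.map (state q) (state r) ∘ Fin.splitAt (size q)) (Fin.splitAt (size p) i))
state (whl p) Fin.zero = inj₁ tt
state (whl p) (Fin.suc i) = inj₂ (state p i)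

state-enum : ∀ p s → state p (enum p s) ≡ s
state-enum (mv _) tt = refl
state-enum (wr _) tt = refl
state-enum (p ⨟ q) (inj₁ s) rewrite Fin.splitAt-join (size p) (size q) (inj₁ (enum p s)) = cong inj₁ (state-enum p s)
state-enum (p ⨟ q) (inj₂ s) rewrite Fin.splitAt-join (size p) (size q) (inj₂ (enum q s)) = cong inj₂ (state-enum q s)
state-enum (ifs p q r) (inj₁ tt) = refl
state-enum (ifs p q r) (inj₂ (inj₁ s))
  rewrite Fin.splitAt-join (size p) (size q + size r) (inj₁ (enum p s)) = cong (inj₂ ∘ inj₁) (state-enum p s)
state-enum (ifs p q r) (inj₂ (inj₂ (inj₁ s)))
  rewrite Fin.splitAt-join (size p) (size q + size r) (inj₂ (Fin.join (size q) (size r) (inj₁ (enum q s))))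
        | Fin.splitAt-join (size q) (size r) (inj₁ (enum q s)) = cong (inj₂ ∘ inj₂ ∘ inj₁) (state-enum q s)
state-enum (ifs p q r) (inj₂ (inj₂ (inj₂ s)))
  rewrite Fin.splitAt-join (size p) (size q + size r) (inj₂ (Fin.join (size q) (size r) (inj₂ (enum r s))))
        | Fin.splitAt-join (size q) (size r) (inj₂ (enum r s)) = cong (inj₂ ∘ inj₂ ∘ inj₂) (state-enum r s)
state-enum (whl p) (inj₁ tt) = refl
state-enum (whl p) (inj₂ s) = cong inj₂ (state-enum p s)

-- State 0 only jumps to the entry, state 1 is the halting exit.
embed : ∀ p → Maybe (St p) → Fin (suc (suc (size p)))
embed p = maybe (Fin.suc ∘ Fin.suc ∘ enum p) (Fin.suc Fin.zero)

machine : Prog → TM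
machine p = record { nstates = suc (size p) ; δ = δ }
  where
  δ : Fin (suc (suc (size p))) → Sym → Maybe (Fin (suc (suc (size p))) × Sym × Move)
  δ Fin.zero a = just (embed p (just (entry p)) , a , mS)
  δ (Fin.suc Fin.zero) a = nothing
  δ (Fin.suc (Fin.suc i)) a = just (redirect (embed p) (Δ p (state p i) a))

embeds-machine : ∀ p → Embeds (machine p) p (embed p)
embeds-machine p s a = cong (λ s' → just (redirect (embed p) (Δ p s' a))) (state-enum p s)

machine-halts : ∀ {p x t U} → Exec p (initTape x) t U → HaltsWith (machine p) x (suc t) (output U)
machine-halts {p} {x} {t} {U} r =
  U , subst (λ n → exec (machine p) (suc n) Fin.zero (initTape x) ≡ just U) (+-identityʳ t)
        (trans (exec-Prog (machine p) (embed p) (embeds-machine p) r 0) refl) , refl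

-- Tapes as functions on the integers

lft rgt : ℤ → ℤ
lft (ℕ⁺ zero) = -[1+ 0 ]
lft (ℕ⁺ (suc n)) = ℕ⁺ n
lft -[1+ n ] = -[1+ suc n ]
rgt (ℕ⁺ n) = ℕ⁺ (suc n)
rgt -[1+ zero ] = ℕ⁺ 0
rgt -[1+ suc n ] = -[1+ n ]

rgt-lft : ∀ h → rgt (lft h) ≡ h
rgt-lft (ℕ⁺ zero) = refl
rgt-lft (ℕ⁺ (suc n)) = refl
rgt-lft -[1+ n ] = refl

lft-rgt : ∀ h → lft (rgt h) ≡ h
lft-rgt (ℕ⁺ n) = refl
lft-rgt -[1+ zero ] = refl
lft-rgt -[1+ suc n ] = refl

iter : ∀ {a} {A : Set a} → (A → A) → ℕ → A → A
iter f zero x = x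
iter f (suc n) x = iter f n (f x)

lft< : ∀ h → lft h ℤ.< h
lft< (ℕ⁺ zero) = ℤ.-<+
lft< (ℕ⁺ (suc n)) = ℤ.+<+ (n<1+n n)
lft< -[1+ n ] = ℤ.-<- (n<1+n n)

<rgt : ∀ h → h ℤ.< rgt h
<rgt h = subst (ℤ._< rgt h) (lft-rgt h) (lft< (rgt h))

iter-lft< : ∀ n h → iter lft (suc n) h ℤ.< h
iter-lft< zero h = lft< h
iter-lft< (suc n) h = ℤ.<-trans (iter-lft< n (lft h)) (lft< h)

<iter-rgt : ∀ n h → h ℤ.< iter rgt (suc n) h
<iter-rgt zero h = <rgt h
<iter-rgt (suc n) h = ℤ.<-trans (<rgt h) (<iter-rgt n (rgt h))

nth : List Sym → ℕ → Sym
nth [] _ = blank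
nth (a ∷ s) zero = a
nth (a ∷ s) (suc n) = nth s n

Cells : Set
Cells = ℤ → Sym

upd : Cells → ℤ → Sym → Cells
upd g h a z = if does (z ℤ.≟ h) then a else g z

upd-same : ∀ g h {a} → upd g h a h ≡ a
upd-same g h rewrite dec-true (h ℤ.≟ h) refl = refl

upd-other : ∀ g {h a z} → z ≢ h → upd g h a z ≡ g z
upd-other g {h} {z = z} ne rewrite dec-false (z ℤ.≟ h) ne = refl

-- Since `nth` returns blank beyond the end of a list, a tape and the same tape with extra blanks
-- represent the same cells, and moving past an end changes nothing.
record Rep (T : Tape) (g : Cells) (h : ℤ) : Set where
  field
    cur≡   : Tape.cur T ≡ g h
    left≡  : ∀ n → nth (Tape.left T) n ≡ g (iter lft (suc n) h)
    right≡ : ∀ n → nth (Tape.right T) n ≡ g (iter rgt (suc n) h)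
open Rep

rep-left : ∀ {T g h} → Rep T g h → Rep (moveTape mL T) g (lft h)
rep-left {tape [] c r} R .cur≡ = left≡ R 0
rep-left {tape (x ∷ l) c r} R .cur≡ = left≡ R 0
rep-left {tape [] c r} R .left≡ n = left≡ R (suc n)
rep-left {tape (x ∷ l) c r} R .left≡ n = left≡ R (suc n)
rep-left {tape [] c r} {g} {h} R .right≡ zero = trans (cur≡ R) (cong g (sym (rgt-lft h)))
rep-left {tape (x ∷ l) c r} {g} {h} R .right≡ zero = trans (cur≡ R) (cong g (sym (rgt-lft h)))
rep-left {tape [] c r} {g} {h} R .right≡ (suc n) = trans (right≡ R n) (cong (g ∘ iter rgt (suc n)) (sym (rgt-lft h)))
rep-left {tape (x ∷ l) c r} {g} {h} R .right≡ (suc n) = trans (right≡ R n) (cong (g ∘ iter rgt (suc n)) (sym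
      (rgt-lft h)))

rep-right : ∀ {T g h} → Rep T g h → Rep (moveTape mR T) g (rgt h)
rep-right {tape l c []} R .cur≡ = right≡ R 0
rep-right {tape l c (x ∷ r)} R .cur≡ = right≡ R 0
rep-right {tape l c []} R .right≡ n = right≡ R (suc n)
rep-right {tape l c (x ∷ r)} R .right≡ n = right≡ R (suc n)
rep-right {tape l c []} {g} {h} R .left≡ zero = trans (cur≡ R) (cong g (sym (lft-rgt h)))
rep-right {tape l c (x ∷ r)} {g} {h} R .left≡ zero = trans (cur≡ R) (cong g (sym (lft-rgt h)))
rep-right {tape l c []} {g} {h} R .left≡ (suc n) = trans (left≡ R n) (cong (g ∘ iter lft (suc n)) (sym (lft-rgt h)))
rep-right {tape l c (x ∷ r)} {g} {h} R .left≡ (suc n) = trans (left≡ R n) (cong (g ∘ iter lft (suc n)) (sym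
      (lft-rgt h)))

rep-write : ∀ {l c r g h} a → Rep (tape l c r) g h → Rep (tape l a r) (upd g h a) h
rep-write {g = g} {h} a R .cur≡ = sym (upd-same g h)
rep-write {g = g} {h} a R .left≡ n = trans (left≡ R n) (sym (upd-other g (ℤ.<⇒≢ (iter-lft< n h))))
rep-write {g = g} {h} a R .right≡ n = trans (right≡ R n) (sym (upd-other g (≢-sym (ℤ.<⇒≢ (<iter-rgt n h)))))

-- The time is an upper bound only, which allows branches of different cost to be rounded up to a
-- common expression.
Abs : Prog → Cells → ℤ → ℕ → Cells → ℤ → Set
Abs p g h t g' h' = ∀ T → Rep T g h → Σ Tape λ U → Σ ℕ λ u → u ≤ t × Exec p T u U × Rep U g' h'

a-weak : ∀ {p g h t t' g' h'} → t ≤ t' → Abs p g h t g' h' → Abs p g h t' g' h'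
a-weak le a T R with a T R
... | U , u , le' , x , R' = U , u , ≤-trans le' le , x , R'

infixr 5 _►_
_►_ : ∀ {p q g h t g' h' u g'' h''} → Abs p g h t g' h' → Abs q g' h' u g'' h'' → Abs (p ⨟ q) g h (t + u) g'' h''
(a ► b) T R with a T R
... | U , u , le , x , R' with b U R'
... | V , v , le' , y , R'' = V , u + v , +-mono-≤ le le' , e-seq x y , R''

a-left : ∀ {g h} → Abs (mv mL) g h 1 g (lft h)
a-left T R = moveTape mL T , 1 , ≤-refl , e-mv , rep-left R

a-right : ∀ {g h} → Abs (mv mR) g h 1 g (rgt h)
a-right T R = moveTape mR T , 1 , ≤-refl , e-mv , rep-right R

a-stay : ∀ {g h} → Abs (mv mS) g h 1 g h
a-stay T R = T , 1 , ≤-refl , e-mv , R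

a-write : ∀ {g h} a → Abs (wr a) g h 1 (upd g h a) h
a-write a (tape l c r) R = tape l a r , 1 , ≤-refl , e-wr , rep-write a R

module _ {p q r : Prog} {g : Cells} {h : ℤ} {t : ℕ} {g' : Cells} {h' : ℤ} where

  a-blank : g h ≡ blank → Abs p g h t g' h' → Abs (ifs p q r) g h (suc t) g' h'
  a-blank eq a (tape xs c ys) R with trans (cur≡ R) eq
  ... | refl with a _ R
  ... | U , u , le , x , R' = U , suc u , s≤s le , e-blank x , R'

  a-zero : g h ≡ b0 → Abs q g h t g' h' → Abs (ifs p q r) g h (suc t) g' h'
  a-zero eq a (tape xs c ys) R with trans (cur≡ R) eq
  ... | refl with a _ R
  ... | U , u , le , x , R' = U , suc u , s≤s le , e-zero x , R'

  a-one : g h ≡ b1 → Abs r g h t g' h' → Abs (ifs p q r) g h (suc t) g' h'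
  a-one eq a (tape xs c ys) R with trans (cur≡ R) eq
  ... | refl with a _ R
  ... | U , u , le , x , R' = U , suc u , s≤s le , e-one x , R'

a-stop : ∀ {p g h} → g h ≡ blank → Abs (whl p) g h 1 g h
a-stop eq (tape xs c ys) R with trans (cur≡ R) eq
... | refl = _ , 1 , ≤-refl , e-stop , R

a-loop : ∀ {p g h t g' h' u g'' h''} → Ink (g h) → Abs p g h t g' h' → Abs (whl p) g' h' u g'' h'' →
         Abs (whl p) g h (suc (t + u)) g'' h''
a-loop k a b (tape xs c ys) R with a _ R
... | U , u , le , x , R' with b U R'
... | V , v , le' , y , R'' = V , suc (u + v) , s≤s (+-mono-≤ le le') , e-loop (subst Ink (sym (cur≡ R)) k) x y , R''

-- 'go m n' makes n + 1 moves.
go : Move → ℕ → Prog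
go m zero = mv m
go m (suc n) = mv m ⨟ go m n

a-go-left : ∀ {g} n h → Abs (go mL n) g h (suc n) g (iter lft (suc n) h)
a-go-left zero h = a-left
a-go-left (suc n) h = a-left ► a-go-left n (lft h)

a-go-right : ∀ {g} n h → Abs (go mR n) g h (suc n) g (iter rgt (suc n) h)
a-go-right zero h = a-right
a-go-right (suc n) h = a-right ► a-go-right n (rgt h)

iter-lft-neg : ∀ n m → iter lft n -[1+ m ] ≡ -[1+ n + m ]
iter-lft-neg zero m = refl
iter-lft-neg (suc n) m = trans (iter-lft-neg n (suc m)) (cong -[1+_] (+-suc n m))

iter-rgt-neg : ∀ n m → iter rgt n -[1+ n + m ] ≡ -[1+ m ]
iter-rgt-neg zero m = refl
iter-rgt-neg (suc n) m = iter-rgt-neg n m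

iter-rgt-home : ∀ n → iter rgt (suc n) -[1+ n ] ≡ ℕ⁺ 0
iter-rgt-home zero = refl
iter-rgt-home (suc n) = iter-rgt-home n

-- A stack is given with its top first; its bottom occupies cell 0.
cell : List Bool → ℕ → Sym
cell [] j = blank
cell (x ∷ xs) j = if does (j ≟ length xs) then bitSym x else cell xs j

ink-bit : ∀ b → Ink (bitSym b)
ink-bit false = ink0
ink-bit true = ink1

cell-ink : ∀ xs {j} → j < length xs → Ink (cell xs j)
cell-ink (x ∷ xs) {j} lt with j ≟ length xs
... | yes eq rewrite dec-true (j ≟ length xs) eq = ink-bit x
... | no ne rewrite dec-false (j ≟ length xs) ne = cell-ink xs (≤∧≢⇒< (≤-pred lt) ne)

cell-blank : ∀ xs {j} → length xs ≤ j → cell xs j ≡ blank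
cell-blank [] le = refl
cell-blank (x ∷ xs) {j} le rewrite dec-false (j ≟ length xs) (≢-sym (<⇒≢ le)) = cell-blank xs (<⇒≤ le)

cell-top : ∀ x xs → cell (x ∷ xs) (length xs) ≡ bitSym x
cell-top x xs rewrite dec-true (length xs ≟ length xs) refl = refl

-- Position J ≥ 1 holds cell J - 1 of the stack; position 0 is a guard that stays blank.
record Track (d : ℕ) : Set where
  field
    pos : ℕ → ℤ
    enter leave out inn : Prog
    enter-abs : ∀ {g} → Abs enter g (ℕ⁺ 0) d g (pos 0)
    leave-abs : ∀ {g} → Abs leave g (pos 0) d g (ℕ⁺ 0)
    out-abs   : ∀ {g} J → Abs out g (pos J) d g (pos (suc J))
    inn-abs   : ∀ {g} J → Abs inn g (pos (suc J)) d g (pos J)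

module Walk {d} (tr : Track d) (g : Cells) (guard : g (Track.pos tr 0) ≡ blank) where
  open Track tr

  walk-in : ∀ J → (∀ {i} → i < J → Ink (g (pos (suc i)))) → Abs (whl inn) g (pos J) (suc (J * suc d)) g (pos 0)
  walk-in zero k = a-stop guard
  walk-in (suc J) k = a-weak (≤-reflexive (cong suc (+-suc d (J * suc d))))
    (a-loop (k ≤-refl) (inn-abs J) (walk-in J (λ lt → k (m<n⇒m<1+n lt))))

  module _ (xs : List Bool) (holds : ∀ j → g (pos (suc j)) ≡ cell xs j) where

    walk-out : ∀ m {j} → j + m ≡ length xs → Abs (whl out) g (pos (suc j)) (suc (m * suc d)) g (pos (suc (length xs)))
    walk-out zero {j} eq rewrite trans (sym (+-identityʳ j)) eq = a-stop (trans (holds _) (cell-blank xs ≤-refl))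
    walk-out (suc m) {j} eq = a-weak (≤-reflexive (cong suc (+-suc d (m * suc d))))
      (a-loop (subst Ink (sym (holds j)) (cell-ink xs (subst (j <_) eq (m<m+n j z<s)))) (out-abs (suc j))
              (walk-out m (trans (sym (+-suc j m)) eq)))

module Tracks (k : ℕ) where

  d : ℕ
  d = suc k

  ioTrack : Track d
  ioTrack = record
    { pos = λ { zero → -[1+ 0 ] ; (suc j) → ℕ⁺ j }
    ; enter = mv mL ; leave = mv mR ; out = mv mR ; inn = mv mL
    ; enter-abs = a-weak (s≤s z≤n) a-left
    ; leave-abs = a-weak (s≤s z≤n) a-right
    ; out-abs = λ { zero → a-weak (s≤s z≤n) a-right ; (suc J) → a-weak (s≤s z≤n) a-right }
    ; inn-abs = λ { zero → a-weak (s≤s z≤n) a-left ; (suc J) → a-weak (s≤s z≤n) a-left } }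

  -- The left half of the tape interleaves k + 1 stacks.
  leftTrack : Fin (suc k) → Track d
  leftTrack i = record
    { pos = λ J → -[1+ J * suc k + toℕ i ]
    ; enter = go mL (toℕ i) ; leave = go mR (toℕ i) ; out = go mL k ; inn = go mR k
    ; enter-abs = λ {g} → subst (Abs _ g _ d g) (trans (iter-lft-neg (toℕ i) 0) (cong -[1+_] (+-identityʳ (toℕ i))))
                    (a-weak (Fin.toℕ<n i) (a-go-left (toℕ i) (ℕ⁺ 0)))
    ; leave-abs = λ {g} → subst (Abs _ g _ d g) (iter-rgt-home (toℕ i)) (a-weak (Fin.toℕ<n i) (a-go-right (toℕ i) _))
    ; out-abs = λ {g} J → subst (Abs _ g _ d g)
                    (trans (iter-lft-neg (suc k) (J * suc k + toℕ i)) (cong -[1+_] (sym (+-assoc (suc k)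
                          (J * suc k) (toℕ i)))))
                    (a-go-left k _)
    ; inn-abs = λ {g} J → subst (Abs _ g _ d g)
                    (trans (cong (iter rgt (suc k) ∘ -[1+_]) (+-assoc (suc k) (J * suc k) (toℕ i)))
                           (iter-rgt-neg (suc k) (J * suc k + toℕ i)))
                    (a-go-right k _) }

  track : Fin (2 + k) → Track d
  track Fin.zero = ioTrack
  track (Fin.suc i) = leftTrack i

  pos : Fin (2 + k) → ℕ → ℤ
  pos s = Track.pos (track s)

  interleave-injective : ∀ {J J'} (i i' : Fin (suc k)) → J * suc k + toℕ i ≡ J' * suc k + toℕ i' → i ≡ i' × J ≡ J'
  interleave-injective {J} {J'} i i' eq = i≡i' , *-cancelʳ-≡ J J' (suc k) (+-cancelʳ-≡ (toℕ i) _ _ (trans eq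
        (cong (λ z → J' * suc k + toℕ z) (sym i≡i'))))
    where
    mod : ∀ J (i : Fin (suc k)) → (J * suc k + toℕ i) % suc k ≡ toℕ i
    mod J i = trans (cong (_% suc k) (+-comm (J * suc k) (toℕ i)))
                (trans ([m+kn]%n≡m%n (toℕ i) J (suc k)) (m<n⇒m%n≡m (Fin.toℕ<n i)))
    i≡i' : i ≡ i'
    i≡i' = Fin.toℕ-injective (trans (sym (mod J i)) (trans (cong (_% suc k) eq) (mod J' i')))

  -- Position 0 is allowed on one side only: the guards of the input stack and of the first left
  -- stack are the same cell -1. What matters is that a proper cell meets neither another cell nor a
  -- guard.
  pos-injective : ∀ s s' {j J} → pos s (suc j) ≡ pos s' J → s ≡ s' × suc j ≡ J
  pos-injective Fin.zero Fin.zero {J = suc J} eq = refl , cong suc (ℤ.+-injective eq)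
  pos-injective Fin.zero (Fin.suc _) ()
  pos-injective (Fin.suc i) Fin.zero {J = zero} eq with ℤ.-[1+-injective eq
  ... | ()
  pos-injective (Fin.suc i) Fin.zero {J = suc J} ()
  pos-injective (Fin.suc i) (Fin.suc i') eq with interleave-injective i i' (ℤ.-[1+-injective eq)
  ... | refl , e = refl , e

-- Stack programs

Store : ℕ → Set
Store n = Vec (List Bool) n

data Cmd (n : ℕ) : Set where
  push  : Fin n → Bool → Cmd n
  pop   : Fin n → (onEmpty on0 on1 : Cmd n) → Cmd n
  _⨾_   : Cmd n → Cmd n → Cmd n
  skip  : Cmd n
  while : Fin n → Cmd n → Cmd n

infixr 5 _⨾_

-- `r-weak` turns the time into an upper bound, so that every round of a loop can be charged the
-- same amount.
data Run {n} : Cmd n → Store n → ℕ → Store n → Set where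
  r-push  : ∀ {s b σ xs} → lookup σ s ≡ xs → Run (push s b) σ 1 (σ [ s ]≔ (b ∷ xs))
  r-pop∅  : ∀ {s c c0 c1 σ t σ'} → lookup σ s ≡ [] → Run c σ t σ' → Run (pop s c c0 c1) σ (suc t) σ'
  r-pop0  : ∀ {s c c0 c1 σ xs t σ'} → lookup σ s ≡ false ∷ xs → Run c0 (σ [ s ]≔ xs) t σ' →
        Run (pop s c c0 c1) σ (suc t) σ'
  r-pop1  : ∀ {s c c0 c1 σ xs t σ'} → lookup σ s ≡ true ∷ xs → Run c1 (σ [ s ]≔ xs) t σ' →
        Run (pop s c c0 c1) σ (suc t) σ'
  _r⨾_    : ∀ {c c' σ t σ' u σ''} → Run c σ t σ' → Run c' σ' u σ'' → Run (c ⨾ c') σ (t + u) σ''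
  r-skip  : ∀ {σ} → Run skip σ 1 σ
  r-stop  : ∀ {s c σ} → lookup σ s ≡ [] → Run (while s c) σ 1 σ
  r-loop  : ∀ {s c σ x xs t σ' u σ''} → lookup σ s ≡ x ∷ xs → Run c σ t σ' → Run (while s c) σ' u σ'' →
            Run (while s c) σ (suc (t + u)) σ''
  r-weak  : ∀ {c σ t t' σ'} → t ≤ t' → Run c σ t σ' → Run c σ t' σ'

infixr 5 _r⨾_

total : ∀ {n} → Store n → ℕ
total [] = 0
total (xs ∷ σ) = length xs + total σ

length-lookup≤ : ∀ {n} (σ : Store n) s → length (lookup σ s) ≤ total σ
length-lookup≤ (xs ∷ σ) Fin.zero = m≤m+n _ _
length-lookup≤ (xs ∷ σ) (Fin.suc s) = m≤n⇒m≤o+n (length xs) (length-lookup≤ σ s)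

total-update : ∀ {n} (σ : Store n) s ys {m} → length ys ≤ length (lookup σ s) + m → total (σ [ s ]≔ ys) ≤ total σ + m
total-update (xs ∷ σ) Fin.zero ys {m} le = ≤-trans (+-monoˡ-≤ (total σ) le)
  (≤-reflexive (trans (+-assoc (length xs) m (total σ)) (trans (cong (length xs +_) (+-comm m (total σ))) (sym
        (+-assoc (length xs) (total σ) m)))))
total-update (xs ∷ σ) (Fin.suc s) ys {m} le = ≤-trans (+-monoʳ-≤ (length xs) (total-update σ s ys le))
  (≤-reflexive (sym (+-assoc (length xs) (total σ) m)))

total-pop : ∀ {n} (σ : Store n) {s b xs} → lookup σ s ≡ b ∷ xs → total (σ [ s ]≔ xs) ≤ total σ
total-pop σ {s} {b} {xs} eq = ≤-trans (total-update σ s xs {0} (≤-trans (n≤1+n _) (≤-reflexive (trans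
      (cong length (sym eq)) (sym (+-identityʳ _))))))
  (≤-reflexive (+-identityʳ _))

-- A push costs one step and adds one bit, and nothing else enlarges a stack. Space bounds are read
-- off from time bounds throughout by means of this.
total-run : ∀ {n} {c : Cmd n} {σ t σ'} → Run c σ t σ' → total σ' ≤ total σ + t
total-run {σ = σ} (r-push {s} {b} {xs = xs} eq) = total-update σ s (b ∷ xs) (≤-reflexive (trans (cong
      (suc ∘ length) (sym eq)) (+-comm 1 _)))
total-run {σ = σ} (r-pop∅ eq r) = ≤-trans (total-run r) (+-monoʳ-≤ (total σ) (n≤1+n _))
total-run {σ = σ} (r-pop0 eq r) = ≤-trans (total-run r) (+-mono-≤ (total-pop σ eq) (n≤1+n _))
total-run {σ = σ} (r-pop1 eq r) = ≤-trans (total-run r) (+-mono-≤ (total-pop σ eq) (n≤1+n _))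
total-run {σ = σ} (_r⨾_ {t = t} {u = u} r r') = ≤-trans (total-run r') (≤-trans (+-monoˡ-≤ u (total-run r))
      (≤-reflexive (+-assoc (total σ) t u)))
total-run {σ = σ} r-skip = m≤m+n _ _
total-run {σ = σ} (r-stop _) = m≤m+n _ _
total-run {σ = σ} (r-loop {t = t} {u = u} eq r r') = ≤-trans (total-run r') (≤-trans (+-monoˡ-≤ u (total-run r))
  (≤-trans (≤-reflexive (+-assoc (total σ) t u)) (+-monoʳ-≤ (total σ) (n≤1+n _))))
total-run {σ = σ} (r-weak le r) = ≤-trans (total-run r) (+-monoʳ-≤ (total σ) le)

-- Naming the slack turns an inequality into an identity that the ring solver can prove.
≤-by : ∀ {x y} s → x + s ≡ y → x ≤ y
≤-by {x} s eq = subst (x ≤_) eq (m≤m+n x s)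

-- Compilation of stack programs and polynomial bounds

cell-snoc-zero : ∀ xs b → cell (xs ++ b ∷ []) 0 ≡ bitSym b
cell-snoc-zero [] b = refl
cell-snoc-zero (x ∷ xs) b rewrite length-++ xs {b ∷ []} | +-comm (length xs) 1 = cell-snoc-zero xs b

cell-snoc-suc : ∀ xs b j → cell (xs ++ b ∷ []) (suc j) ≡ cell xs j
cell-snoc-suc [] b j = refl
cell-snoc-suc (x ∷ xs) b j rewrite length-++ xs {b ∷ []} | +-comm (length xs) 1 | cell-snoc-suc xs b j = refl

-- The bottom of the input stack lies where the word begins, so a word on the tape is the stack of
-- its reversal.
cell-reverse : ∀ x j → cell (reverse x) j ≡ nth (symsOf x) j
cell-reverse [] j = refl
cell-reverse (b ∷ x) zero rewrite unfold-reverse b x = cell-snoc-zero (reverse x) b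
cell-reverse (b ∷ x) (suc j) rewrite unfold-reverse b x = trans (cell-snoc-suc (reverse x) b j) (cell-reverse x j)

readBits-nth : ∀ w s → (∀ j → nth s j ≡ nth (symsOf w) j) → readBits s ≡ w
readBits-nth [] [] h = refl
readBits-nth [] (a ∷ s) h with h 0
... | refl = refl
readBits-nth (false ∷ w) [] h with h 0
... | ()
readBits-nth (true ∷ w) [] h with h 0
... | ()
readBits-nth (false ∷ w) (a ∷ s) h with h 0
... | refl = cong (false ∷_) (readBits-nth w s (h ∘ suc))
readBits-nth (true ∷ w) (a ∷ s) h with h 0
... | refl = cong (true ∷_) (readBits-nth w s (h ∘ suc))

-- With base n + 1 instead of n, powers grow with the exponent even at n = 0, so two bounds can be
-- brought to a common exponent without case distinctions.
Poly : (ℕ → ℕ) → Set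
Poly f = Σ ℕ λ c → ∀ n → f n ≤ c * suc n ^ c

power-mono : ∀ n {a b} → a ≤ b → suc n ^ a ≤ suc n ^ b
power-mono n = ^-monoʳ-≤ (suc n)

interchange : ∀ a b c d → (a * b) * (c * d) ≡ (a * c) * (b * d)
interchange = solve-∀

power-product : ∀ c a b → (a * b) ^ c ≡ a ^ c * b ^ c
power-product zero a b = refl
power-product (suc c) a b = trans (cong (a * b *_) (power-product c a b)) (interchange a b (a ^ c) (b ^ c))

poly-const : ∀ m → Poly (λ _ → m)
poly-const m = m , λ n → ≤-trans (≤-reflexive (sym (*-identityʳ m))) (*-monoʳ-≤ m (power-mono n (z≤n {m})))

poly-id : Poly (λ n → n)
poly-id = 1 , λ n → ≤-trans (n≤1+n n) (≤-reflexive (sym (trans (*-identityˡ _) (^-identityʳ (suc n)))))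

infixr 6 _⊕_
infixr 7 _⊗_

_⊕_ : ∀ {f g} → Poly f → Poly g → Poly (λ n → f n + g n)
(c , p) ⊕ (d , q) = c + d , λ n → ≤-trans
  (+-mono-≤ (≤-trans (p n) (*-monoʳ-≤ c (power-mono n (m≤m+n c d)))) (≤-trans (q n) (*-monoʳ-≤ d (power-mono n
        (m≤n+m d c)))))
  (≤-reflexive (sym (*-distribʳ-+ (suc n ^ (c + d)) c d)))

_⊗_ : ∀ {f g} → Poly f → Poly g → Poly (λ n → f n * g n)
(c , p) ⊗ (d , q) = c * d + (c + d) , λ n → ≤-trans (*-mono-≤ (p n) (q n))
  (≤-trans (≤-reflexive (trans (interchange c (suc n ^ c) d (suc n ^ d)) (cong (c * d *_) (sym (^-distribˡ-+-*
        (suc n) c d)))))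
           (*-mono-≤ (m≤m+n (c * d) (c + d)) (power-mono n (m≤n+m (c + d) (c * d)))))

-- For n ≥ 1 the base n + 1 is at most 2n, which costs the factor 2^c in `D`; for n = 0 the additive
-- constant takes over.
poly-FP : ∀ {f} → Poly f → Σ ℕ λ c → ∀ n → f n ≤ c * n ^ c + c
poly-FP {f} (c , p) = D , bound
  where
  D : ℕ
  D = c * 2 ^ c
  c≤D : c ≤ D
  c≤D = ≤-trans (≤-reflexive (sym (*-identityʳ c))) (*-monoʳ-≤ c (^-monoʳ-≤ 2 (z≤n {c})))
  bound : ∀ n → f n ≤ D * n ^ D + D
  bound zero = ≤-trans (p 0) (≤-trans (≤-reflexive (trans (cong (c *_) (^-zeroˡ c)) (*-identityʳ c)))
        (≤-trans c≤D (m≤n+m D _)))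
  bound (suc n) = ≤-trans (p (suc n)) (≤-trans (*-monoʳ-≤ c (≤-trans (^-monoˡ-≤ c double)
      (≤-reflexive (power-product c 2 (suc n)))))
      (≤-trans (≤-reflexive (sym (*-assoc c (2 ^ c) (suc n ^ c)))) (≤-trans (*-monoʳ-≤ D (power-mono n c≤D))
            (m≤m+n _ D))))
    where
    double : suc (suc n) ≤ 2 * suc n
    double = ≤-trans (s≤s (m≤n+m (suc n) n)) (≤-reflexive (cong (suc ∘ (n +_)) (sym (+-identityʳ (suc n)))))

-- Compiling stack programs to Turing machines

module Compile (k : ℕ) where
  open Tracks k
  open module Tr s = Track (track s) using (enter; leave; out; inn; enter-abs; leave-abs; out-abs; inn-abs)

  e : ℕ
  e = suc d

  record Lay (σ : Store (2 + k)) (g : Cells) : Set where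
    constructor lay
    field
      guard : ∀ s → g (pos s 0) ≡ blank
      holds : ∀ s j → g (pos s (suc j)) ≡ cell (lookup σ s) j
  open Lay

  -- Cells are counted from the bottom of a stack, so a push or a pop alters the single cell ℓ and
  -- leaves the rest in place.
  lay-upd : ∀ {σ g} s ℓ ys {a} → Lay σ g → (∀ j → cell ys j ≡ (if does (j ≟ ℓ) then a else cell (lookup σ s) j)) →
            Lay (σ [ s ]≔ ys) (upd g (pos s (suc ℓ)) a)
  lay-upd {σ} {g} s ℓ ys {a} L h =
    lay (λ s' → trans (upd-other g (λ eq → 1+n≢0 (proj₂ (pos-injective s s' (sym eq))))) (guard L s')) holds'
    where
    holds' : ∀ s' j → upd g (pos s (suc ℓ)) a (pos s' (suc j)) ≡ cell (lookup (σ [ s ]≔ ys) s') j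
    holds' s' j with s' Fin.≟ s
    ... | no ne = trans (upd-other g (λ eq → ne (sym (proj₁ (pos-injective s s' (sym eq))))))
                    (trans (holds L s' j) (cong (λ xs → cell xs j) (sym (lookup∘update′ ne σ ys))))
    ... | yes refl rewrite lookup∘update s σ ys with j ≟ ℓ | h j
    ...   | yes refl | hj rewrite dec-true (j ≟ j) refl = trans (upd-same g _) (sym hj)
    ...   | no ne | hj rewrite dec-false (j ≟ ℓ) ne =
            trans (upd-other g (λ eq → ne (suc-injective (proj₂ (pos-injective s s eq))))) (trans (holds L s j)
                  (sym hj))

  -- `find` stops on the blank just above the top. `home` walks inwards until it meets the guard, so
  -- it must start on ink, or on the guard itself if the stack is empty.
  find home : Fin (2 + k) → Prog
  find s = enter s ⨟ out s ⨟ whl (out s)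
  home s = whl (inn s) ⨟ leave s

  find-abs : ∀ {σ g} s {xs} → Lay σ g → lookup σ s ≡ xs →
             Abs (find s) g (ℕ⁺ 0) (d + (d + suc (length xs * e))) g (pos s (suc (length xs)))
  find-abs {g = g} s {xs} L eq = enter-abs s ► out-abs s 0 ►
    Walk.walk-out (track s) g (guard L s) xs (λ j → trans (holds L s j) (cong (λ z → cell z j) eq)) (length xs) refl

  home-abs : ∀ {σ g} s {xs} → Lay σ g → lookup σ s ≡ xs →
             Abs (home s) g (pos s (length xs)) (suc (length xs * e) + d) g (ℕ⁺ 0)
  home-abs {g = g} s {xs} L eq =
    Walk.walk-in (track s) g (guard L s) (length xs)
      (λ {i} lt → subst Ink (sym (trans (holds L s i) (cong (λ z → cell z i) eq))) (cell-ink xs lt))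
    ► leave-abs s

  comp : Cmd (2 + k) → Prog
  comp (push s b) = find s ⨟ wr (bitSym b) ⨟ home s
  comp (pop s c c0 c1) = find s ⨟ inn s ⨟
    ifs (leave s ⨟ comp c) (wr blank ⨟ inn s ⨟ home s ⨟ comp c0) (wr blank ⨟ inn s ⨟ home s ⨟ comp c1)
  comp (c ⨾ c') = comp c ⨟ comp c'
  comp skip = mv mS
  -- A stack is nonempty exactly when position 1, its bottom cell, carries ink. The test is made
  -- there, and the head returns to cell 0 around each run of the body.
  comp (while s c) = (enter s ⨟ out s) ⨟ whl ((inn s ⨟ leave s) ⨟ comp c ⨟ (enter s ⨟ out s)) ⨟ (inn s ⨟ leave s)

  -- Cost of one stack operation when no stack is longer than B.
  unit : ℕ → ℕ
  unit B = (2 * B + 10) * e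

  unit≤ : ∀ {m B} → m ≤ B → (2 * m + 10) * e ≤ unit B
  unit≤ le = *-monoˡ-≤ e (+-monoˡ-≤ 10 (*-monoʳ-≤ 2 le))

  push-cost : ∀ ℓ d → (d + (d + suc (ℓ * suc d))) + (1 + (suc (suc ℓ * suc d) + d)) + 6 * suc d ≡ (2 * ℓ + 10) * suc d
  push-cost = solve-∀

  pop∅-cost : ∀ d u → (d + (d + suc 0)) + (d + suc (d + u)) + (6 * d + 8) ≡ 10 * suc d + u
  pop∅-cost = solve-∀

  pop-cost : ∀ m d u → (d + (d + suc (suc m * suc d))) + (d + suc (1 + (d + ((suc (m * suc d) + d) + u)))) +
        (4 * d + 5)
                     ≡ (2 * m + 10) * suc d + u
  pop-cost = solve-∀

  stop-cost : ∀ d → 1 + ((d + d) + (d + d)) + (6 * d + 9) ≡ 10 * suc d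
  stop-cost = solve-∀

  loop-cost : ∀ d t u → suc (((d + d) + (t + (d + d))) + u) + ((d + d) + (d + d)) ≡ (1 + ((d + d) + (d + d))) +
        (t + (u + ((d + d) + (d + d))))
  loop-cost = solve-∀

  wrap-cost : ∀ d u → (d + d) + (u + (d + d)) ≡ u + ((d + d) + (d + d))
  wrap-cost = solve-∀

  stop≤unit : ∀ B → 1 + ((d + d) + (d + d)) ≤ unit B
  stop≤unit B = ≤-trans (≤-by (6 * d + 9) (stop-cost d)) (unit≤ (z≤n {B}))

  module _ (B : ℕ) where

    first≤ : ∀ m {t u} → m + (t + u) ≤ B → m + t ≤ B
    first≤ m {t} {u} le = ≤-trans (+-monoʳ-≤ m (m≤m+n t u)) le

    second≤ : ∀ {m n t u} → n ≤ m + t → m + (t + u) ≤ B → n + u ≤ B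
    second≤ {m} {n} {t} {u} le le' = ≤-trans (+-monoˡ-≤ u le) (≤-trans (≤-reflexive (+-assoc m t u)) le')

    tail≤ : ∀ m {t} → m + suc t ≤ B → m + t ≤ B
    tail≤ m {t} le = ≤-trans (+-monoʳ-≤ m (n≤1+n t)) le

    pop-lay : ∀ {σ g s xs} b → Lay σ g → lookup σ s ≡ b ∷ xs → Lay (σ [ s ]≔ xs) (upd g (pos s (suc
          (length xs))) blank)
    pop-lay {σ} {g} {s} {xs} b L eq = lay-upd s (length xs) xs L cells
      where
      cells : ∀ j → cell xs j ≡ (if does (j ≟ length xs) then blank else cell (lookup σ s) j)
      cells j rewrite eq with j ≟ length xs
      ... | yes refl rewrite dec-true (length xs ≟ length xs) refl = cell-blank xs ≤-refl
      ... | no ne rewrite dec-false (j ≟ length xs) ne = refl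

    pop-abs : ∀ {σ g s xs t g' p} b → Lay σ g → lookup σ s ≡ b ∷ xs →
              Abs p (upd g (pos s (suc (length xs))) blank) (ℕ⁺ 0) t g' (ℕ⁺ 0) →
              Abs (wr blank ⨟ inn s ⨟ home s ⨟ p) g (pos s (suc (length xs))) (1 + (d + ((suc
                    (length xs * e) + d) + t))) g' (ℕ⁺ 0)
    pop-abs {σ} {g} {s} {xs} b L eq a =
      a-write blank ► inn-abs s (length xs) ► home-abs s (pop-lay b L eq) (lookup∘update s σ xs) ► a

    pop-length : ∀ {σ : Store (2 + k)} {s b xs t} → lookup σ s ≡ b ∷ xs → total σ + t ≤ B → length xs ≤ B
    pop-length {σ} {s} {t = t} eq le = ≤-trans (n≤1+n _) (≤-trans (≤-reflexive (cong length (sym eq)))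
      (≤-trans (length-lookup≤ σ s) (≤-trans (m≤m+n _ t) le)))

    body : Fin (2 + k) → Cmd (2 + k) → Prog
    body s c = (inn s ⨟ leave s) ⨟ comp c ⨟ (enter s ⨟ out s)

    -- `B` bounds the initial contents plus the time, hence by `total-run` every stack at every
    -- moment; each stack step then costs at most `unit B` machine steps.
    run-abs : ∀ {c σ t σ' g} → Run c σ t σ' → Lay σ g → total σ + t ≤ B →
              Σ Cells λ g' → Lay σ' g' × Abs (comp c) g (ℕ⁺ 0) (t * unit B) g' (ℕ⁺ 0)
    -- The inner loop starts and ends on position 1 rather than on cell 0. The 4d steps kept in
    -- reserve pay for getting there and back.
    while-abs : ∀ {s c σ t σ' g} → Run (while s c) σ t σ' → Lay σ g → total σ + t ≤ B →
              Σ Cells λ g' → Σ ℕ λ u → u + ((d + d) + (d + d)) ≤ t * unit B × Lay σ' g' ×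
                Abs (whl (body s c)) g (pos s 1) u g' (pos s 1)

    run-abs {σ = σ} {g = g} (r-push {s} {b} {xs = xs} eq) L le = _ , L' ,
      a-weak (≤-trans (≤-trans (≤-by (6 * e) (push-cost (length xs) d)) (unit≤ ℓ≤)) (≤-reflexive (sym
            (*-identityˡ _))))
        (find-abs s L eq ► a-write (bitSym b) ► home-abs s L' (lookup∘update s σ (b ∷ xs)))
      where
      ℓ≤ : length xs ≤ B
      ℓ≤ = ≤-trans (≤-reflexive (cong length (sym eq))) (≤-trans (length-lookup≤ σ s) (≤-trans (m≤m+n _ 1) le))
      L' : Lay (σ [ s ]≔ (b ∷ xs)) (upd g (pos s (suc (length xs))) (bitSym b))
      L' = lay-upd s (length xs) (b ∷ xs) L (λ j → cong (λ z → if does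
            (j ≟ length xs) then bitSym b else cell z j) (sym eq))
    run-abs {σ = σ} {g = g} (r-pop∅ {s} {t = t} eq r) L le with run-abs r L (tail≤ (total σ) le)
    ... | g' , L' , a = g' , L' , a-weak (≤-trans (≤-by (6 * d + 8) (pop∅-cost d (t * unit B))) (+-monoˡ-≤
          (t * unit B) (unit≤ (z≤n {B}))))
            (find-abs s L eq ► inn-abs s 0 ► a-blank (guard L s) (leave-abs s ► a))
    run-abs {σ = σ} {g = g} (r-pop0 {s} {xs = xs} {t = t} eq r) L le
      with run-abs r (pop-lay false L eq) (≤-trans (+-monoˡ-≤ t (total-pop σ eq)) (tail≤ (total σ) le))
    ... | g' , L' , a = g' , L' , a-weak (≤-trans (≤-by (4 * d + 5) (pop-cost (length xs) d (t * unit B)))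
                                            (+-monoˡ-≤ (t * unit B) (unit≤ (pop-length {σ} {t = suc t} eq le))))
            (find-abs s L eq ► inn-abs s (suc (length xs))
              ► a-zero (trans (holds L s (length xs)) (trans (cong (λ z →
                    cell z (length xs)) eq) (cell-top false xs))) (pop-abs false L eq a))
    run-abs {σ = σ} {g = g} (r-pop1 {s} {xs = xs} {t = t} eq r) L le
      with run-abs r (pop-lay true L eq) (≤-trans (+-monoˡ-≤ t (total-pop σ eq)) (tail≤ (total σ) le))
    ... | g' , L' , a = g' , L' , a-weak (≤-trans (≤-by (4 * d + 5) (pop-cost (length xs) d (t * unit B)))
                                            (+-monoˡ-≤ (t * unit B) (unit≤ (pop-length {σ} {t = suc t} eq le))))
            (find-abs s L eq ► inn-abs s (suc (length xs))
              ► a-one (trans (holds L s (length xs)) (trans (cong (λ z →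
                    cell z (length xs)) eq) (cell-top true xs))) (pop-abs true L eq a))
    run-abs {σ = σ} (_r⨾_ {t = t} {u = u} r r') L le with run-abs r L (first≤ (total σ) le)
    ... | g' , L' , a with run-abs r' L' (second≤ {total σ} (total-run r) le)
    ... | g'' , L'' , a' = g'' , L'' , a-weak (≤-reflexive (sym (*-distribʳ-+ (unit B) t u))) (a ► a')
    run-abs r-skip L le = _ , L , a-weak (≤-trans (s≤s z≤n) (≤-trans (stop≤unit B) (≤-reflexive (sym
          (*-identityˡ _))))) a-stay
    run-abs {while s c} r@(r-stop _) L le with while-abs r L le
    ... | g' , u , u≤ , L' , a = g' , L' , a-weak (≤-trans (≤-reflexive (wrap-cost d u)) u≤)
            ((enter-abs s ► out-abs s 0) ► a ► (inn-abs s 0 ► leave-abs s))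
    run-abs {while s c} r@(r-loop _ _ _) L le with while-abs r L le
    ... | g' , u , u≤ , L' , a = g' , L' , a-weak (≤-trans (≤-reflexive (wrap-cost d u)) u≤)
            ((enter-abs s ► out-abs s 0) ► a ► (inn-abs s 0 ► leave-abs s))
    run-abs {σ = σ} (r-weak lt r) L le with run-abs r L (≤-trans (+-monoʳ-≤ (total σ) lt) le)
    ... | g' , L' , a = g' , L' , a-weak (*-monoˡ-≤ (unit B) lt) a

    while-abs {s} (r-stop eq) L le = _ , 1 , ≤-trans (stop≤unit B) (≤-reflexive (sym (*-identityˡ _))) , L ,
      a-stop (trans (holds L s 0) (cong (λ z → cell z 0) eq))
    while-abs {s} {σ = σ} (r-loop {x = x} {xs} {t} {u = u} eq r r') L le
      with run-abs r L (first≤ (total σ) (tail≤ (total σ) le))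
    ... | g' , L' , a with while-abs r' L' (second≤ {total σ} (total-run r) (tail≤ (total σ) le))
    ... | g'' , v , v≤ , L'' , a' = g'' , _ ,
            ≤-trans (≤-reflexive (loop-cost d (t * unit B) v))
              (+-mono-≤ (stop≤unit B) (≤-trans (+-monoʳ-≤ (t * unit B) v≤) (≤-reflexive (sym (*-distribʳ-+
                    (unit B) t u))))) , L'' ,
            a-loop (subst Ink (sym (trans (holds L s 0) (cong (λ z → cell z 0) eq))) (cell-ink (x ∷ xs) z<s))
              ((inn-abs s 0 ► leave-abs s) ► a ► (enter-abs s ► out-abs s 0)) a'
    while-abs {s} {σ = σ} (r-weak lt r) L le with while-abs r L (≤-trans (+-monoʳ-≤ (total σ) lt) le)
    ... | g' , u , u≤ , L' , a = g' , u , ≤-trans u≤ (*-monoˡ-≤ (unit B) lt) , L' , a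

  initCells : Str → Cells
  initCells x (ℕ⁺ n) = nth (symsOf x) n
  initCells x -[1+ n ] = blank

  iter-rgt-pos : ∀ n m → iter rgt n (ℕ⁺ m) ≡ ℕ⁺ (n + m)
  iter-rgt-pos zero m = refl
  iter-rgt-pos (suc n) m = trans (iter-rgt-pos n (suc m)) (cong ℕ⁺ (+-suc n m))

  initRep : ∀ x → Rep (initTape x) (initCells x) (ℕ⁺ 0)
  initRep [] .Rep.cur≡ = refl
  initRep (b ∷ x) .Rep.cur≡ = refl
  initRep [] .Rep.left≡ n rewrite iter-lft-neg n 0 = refl
  initRep (b ∷ x) .Rep.left≡ n rewrite iter-lft-neg n 0 = refl
  initRep [] .Rep.right≡ n rewrite iter-rgt-pos n 1 = refl
  initRep (b ∷ x) .Rep.right≡ n rewrite iter-rgt-pos n 1 | +-comm n 1 = refl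

  initStore : Str → Store (2 + k)
  initStore x = reverse x ∷ Vec.replicate (suc k) []

  initLay : ∀ x → Lay (initStore x) (initCells x)
  initLay x .guard Fin.zero = refl
  initLay x .guard (Fin.suc s) = refl
  initLay x .holds Fin.zero j = sym (cell-reverse x j)
  initLay x .holds (Fin.suc s) j rewrite lookup-replicate s (List Bool ∋ []) = refl

  output-Lay : ∀ {σ g U} → Lay σ g → Rep U g (ℕ⁺ 0) → output U ≡ reverse (Vec.head σ)
  output-Lay {ys ∷ σ} {g} {tape l c r} L R = readBits-nth (reverse ys) (c ∷ r) agree
    where
    agree : ∀ j → nth (c ∷ r) j ≡ nth (symsOf (reverse ys)) j
    agree j = trans (first j) (trans (holds L Fin.zero j)
      (trans (cong (λ z → cell z j) (sym (reverse-involutive ys))) (cell-reverse (reverse ys) j)))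
      where
      first : ∀ j → nth (c ∷ r) j ≡ g (ℕ⁺ j)
      first zero = Rep.cur≡ R
      first (suc j) = trans (Rep.right≡ R j) (cong g (trans (iter-rgt-pos j 1) (cong ℕ⁺ (+-comm j 1))))

  total-initStore : ∀ x → total (initStore x) ≡ length x
  total-initStore x = trans (cong₂ _+_ (length-reverse x) (empties (suc k))) (+-identityʳ _)
    where
    empties : ∀ n → total (Vec.replicate n []) ≡ 0
    empties zero = refl
    empties (suc n) = empties n

  module _ (c : Cmd (2 + k)) (f : Str → Str) (P : ℕ → ℕ)
           (runs : ∀ x → Σ (Store (2 + k)) λ σ → Run c (initStore x) (P (length x)) σ ×
                 reverse (Vec.head σ) ≡ f x) where

    steps : ℕ → ℕ
    steps n = 1 + P n * unit (n + P n)

    FP-halts : ∀ x → Σ ℕ λ t → t ≤ steps (length x) × HaltsWith (machine (comp c)) x t (f x)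
    FP-halts x with runs x
    ... | σ , r , eq with run-abs (length x + P (length x)) r (initLay x) (≤-reflexive (cong (_+ P (length x))
          (total-initStore x)))
    ... | g , L , a with a (initTape x) (initRep x)
    ... | U , u , u≤ , ex , R = suc u , s≤s u≤ ,
          subst (HaltsWith (machine (comp c)) x (suc u)) (trans (output-Lay L R) eq) (machine-halts ex)

    -- Simulating P(n) stack steps on stacks of at most n + P(n) bits costs about P(n) times n +
    -- P(n), up to a constant factor, so the bound stays polynomial.
    FP-intro : Poly P → FP f
    FP-intro poly = conclude (poly-FP poly-steps)
      where
      poly-steps : Poly steps
      poly-steps = poly-const 1 ⊕ poly ⊗ ((poly-const 2 ⊗ (poly-id ⊕ poly) ⊕ poly-const 10) ⊗ poly-const e)
      conclude : (Σ ℕ λ D → ∀ n → steps n ≤ D * n ^ D + D) → FP f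
      conclude (D , bound) = machine (comp c) , D , λ x → let (t , t≤ , h) = FP-halts x in t , ≤-trans t≤ (bound
            (length x)) , h

-- Renaming of stacks and basic programs

rename : ∀ {m n} → Vec (Fin n) m → Cmd m → Cmd n
rename is (push s b) = push (lookup is s) b
rename is (pop s c c0 c1) = pop (lookup is s) (rename is c) (rename is c0) (rename is c1)
rename is (c ⨾ c') = rename is c ⨾ rename is c'
rename is skip = skip
rename is (while s c) = while (lookup is s) (rename is c)

writeAll : ∀ {m n} → Vec (Fin n) m → Store m → Store n → Store n
writeAll [] [] σ = σ
writeAll (i ∷ is) (xs ∷ v) σ = writeAll is v σ [ i ]≔ xs

fresh : ∀ {m n} → Fin n → Vec (Fin n) m → Bool
fresh i [] = true
fresh i (j ∷ js) = not (does (i Fin.≟ j)) ∧ fresh i js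

distinct : ∀ {m n} → Vec (Fin n) m → Bool
distinct [] = true
distinct (i ∷ is) = fresh i is ∧ distinct is

fresh-≢ : ∀ {m n} {i : Fin n} (js : Vec (Fin n) m) s → T (fresh i js) → i ≢ lookup js s
fresh-≢ {i = i} (j ∷ js) s fr with i Fin.≟ j
fresh-≢ (j ∷ js) Fin.zero fr | no ne = ne
fresh-≢ (j ∷ js) (Fin.suc s) fr | no ne = fresh-≢ js s fr

distinct-∷ : ∀ {m n} (i : Fin n) (is : Vec (Fin n) m) → T (distinct (i ∷ is)) → T (fresh i is) × T (distinct is)
distinct-∷ i is ds with fresh i is
... | true = tt , ds

lookup-writeAll : ∀ {m n} (is : Vec (Fin n) m) → T (distinct is) → ∀ v (σ : Store n) s →
                  lookup (writeAll is v σ) (lookup is s) ≡ lookup v s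
lookup-writeAll (i ∷ is) ds (xs ∷ v) σ Fin.zero = lookup∘update i (writeAll is v σ) xs
lookup-writeAll (i ∷ is) ds (xs ∷ v) σ (Fin.suc s) with distinct-∷ i is ds
... | fr , ds' = trans (lookup∘update′ (≢-sym (fresh-≢ is s fr)) (writeAll is v σ) xs) (lookup-writeAll is ds' v σ s)

update-writeAll : ∀ {m n} (is : Vec (Fin n) m) → T (distinct is) → ∀ v (σ : Store n) s ys →
                  writeAll is v σ [ lookup is s ]≔ ys ≡ writeAll is (v [ s ]≔ ys) σ
update-writeAll (i ∷ is) ds (xs ∷ v) σ Fin.zero ys = []≔-idempotent (writeAll is v σ) i
update-writeAll (i ∷ is) ds (xs ∷ v) σ (Fin.suc s) ys with distinct-∷ i is ds
... | fr , ds' = trans ([]≔-commutes (writeAll is v σ) i (lookup is s) (fresh-≢ is s fr))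
                       (cong (_[ i ]≔ xs) (update-writeAll is ds' v σ s ys))

writeAll-self : ∀ {m n} (is : Vec (Fin n) m) (σ : Store n) → writeAll is (Vec.map (lookup σ) is) σ ≡ σ
writeAll-self [] σ = refl
writeAll-self (i ∷ is) σ = trans (cong (_[ i ]≔ lookup σ i) (writeAll-self is σ)) ([]≔-lookup σ i)

run-writeAll : ∀ {m n} (is : Vec (Fin n) m) → T (distinct is) → ∀ {c v t v'} (σ : Store n) → Run c v t v' →
               Run (rename is c) (writeAll is v σ) t (writeAll is v' σ)
run-writeAll is ds {v = v} σ (r-push {s} {b} {xs = xs} eq) =
  subst (Run _ _ 1) (update-writeAll is ds v σ s (b ∷ xs)) (r-push (trans (lookup-writeAll is ds v σ s) eq))
run-writeAll is ds {v = v} σ (r-pop∅ {s} eq r) = r-pop∅ (trans (lookup-writeAll is ds v σ s) eq)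
      (run-writeAll is ds σ r)
run-writeAll is ds {v = v} σ (r-pop0 {s} {xs = xs} eq r) = r-pop0 (trans (lookup-writeAll is ds v σ s) eq)
  (subst (λ z → Run _ z _ _) (sym (update-writeAll is ds v σ s xs)) (run-writeAll is ds σ r))
run-writeAll is ds {v = v} σ (r-pop1 {s} {xs = xs} eq r) = r-pop1 (trans (lookup-writeAll is ds v σ s) eq)
  (subst (λ z → Run _ z _ _) (sym (update-writeAll is ds v σ s xs)) (run-writeAll is ds σ r))
run-writeAll is ds σ (r r⨾ r') = run-writeAll is ds σ r r⨾ run-writeAll is ds σ r'
run-writeAll is ds σ r-skip = r-skip
run-writeAll is ds {v = v} σ (r-stop {s} eq) = r-stop (trans (lookup-writeAll is ds v σ s) eq)
run-writeAll is ds {v = v} σ (r-loop {s} eq r r') =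
  r-loop (trans (lookup-writeAll is ds v σ s) eq) (run-writeAll is ds σ r) (run-writeAll is ds σ r')
run-writeAll is ds σ (r-weak le r) = r-weak le (run-writeAll is ds σ r)

-- A frame rule: a run on the listed stacks is a run in any larger store that agrees with them
-- there. For concrete indices `T (distinct is)` evaluates to `⊤`, so this argument is found by
-- unification.
frame : ∀ {m n} (is : Vec (Fin n) m) {ds : T (distinct is)} {c t v'} {σ : Store n} →
        Run c (Vec.map (lookup σ) is) t v' → Run (rename is c) σ t (writeAll is v' σ)
frame is {ds} {v' = v'} {σ} r = subst (λ z → Run _ z _ (writeAll is v' σ)) (writeAll-self is σ)
      (run-writeAll is ds σ r)

pour : Cmd 2
pour = while 0F (pop 0F skip (push 1F false) (push 1F true))

pour-run : ∀ xs {ys} → Run pour (xs ∷ ys ∷ []) (length xs * 3 + 1) ([] ∷ (xs ʳ++ ys) ∷ [])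
pour-run [] = r-stop refl
pour-run (false ∷ xs) = r-loop refl (r-pop0 refl (r-push refl)) (pour-run xs)
pour-run (true ∷ xs) = r-loop refl (r-pop1 refl (r-push refl)) (pour-run xs)

clear : Cmd 1
clear = while 0F (pop 0F skip skip skip)

clear-run : ∀ xs → Run clear (xs ∷ []) (length xs * 3 + 1) ([] ∷ [])
clear-run [] = r-stop refl
clear-run (false ∷ xs) = r-loop refl (r-pop0 refl r-skip) (clear-run xs)
clear-run (true ∷ xs) = r-loop refl (r-pop1 refl r-skip) (clear-run xs)

-- Source, scratch, target.
copy : Cmd 3
copy = rename (0F ∷ 1F ∷ []) pour ⨾
       while 1F (pop 1F skip (push 0F false ⨾ push 2F false) (push 0F true ⨾ push 2F true))

copy-run : ∀ xs → Run copy (xs ∷ [] ∷ [] ∷ []) (length xs * 7 + 2) (xs ∷ [] ∷ xs ∷ [])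
copy-run xs = subst (λ z → Run copy (xs ∷ [] ∷ [] ∷ []) (length xs * 7 + 2) (z ∷ [] ∷ z ∷ [])) (reverse-involutive xs)
  (r-weak (≤-reflexive (trans (cong (λ l → length xs * 3 + 1 + (l * 4 + 1)) (length-reverse xs)) (cost (length xs))))
    (frame (0F ∷ 1F ∷ []) (pour-run xs) r⨾ spread (reverse xs)))
  where
  cost : ∀ l → l * 3 + 1 + (l * 4 + 1) ≡ l * 7 + 2
  cost = solve-∀
  spread : ∀ xs {ys zs} → Run (while 1F (pop 1F skip (push 0F false ⨾ push 2F false) (push 0F true ⨾ push 2F true)))
             (ys ∷ xs ∷ zs ∷ []) (length xs * 4 + 1) ((xs ʳ++ ys) ∷ [] ∷ (xs ʳ++ zs) ∷ [])
  spread [] = r-stop refl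
  spread (false ∷ xs) = r-loop refl (r-pop0 refl (r-push refl r⨾ r-push refl)) (spread xs)
  spread (true ∷ xs) = r-loop refl (r-pop1 refl (r-push refl r⨾ r-push refl)) (spread xs)

-- Counters have their least significant bit first.

finc : List Bool → List Bool
finc [] = []
finc (false ∷ c) = true ∷ c
finc (true ∷ c) = false ∷ finc c

overflows : List Bool → Bool
overflows [] = true
overflows (false ∷ c) = false
overflows (true ∷ c) = overflows c

flag : Bool → List Bool
flag false = []
flag true = true ∷ []

length-finc : ∀ c → length (finc c) ≡ length c
length-finc [] = refl
length-finc (false ∷ c) = refl
length-finc (true ∷ c) = cong suc (length-finc c)

-- Successor in bijective base 2 (digits 1 and 2, written false and true), which enumerates all strings.
binc : List Bool → List Bool
binc [] = false ∷ []
binc (false ∷ c) = true ∷ c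
binc (true ∷ c) = false ∷ binc c

bval : List Bool → ℕ
bval [] = 0
bval (false ∷ c) = 1 + 2 * bval c
bval (true ∷ c) = 2 + 2 * bval c

bval-binc : ∀ c → bval (binc c) ≡ suc (bval c)
bval-binc [] = refl
bval-binc (false ∷ c) = refl
bval-binc (true ∷ c) rewrite bval-binc c = cong (suc ∘ suc) (+-suc (bval c) (bval c + 0))

bval-injective : ∀ c c' → bval c ≡ bval c' → c ≡ c'
bval-injective [] [] eq = refl
bval-injective [] (false ∷ c') ()
bval-injective [] (true ∷ c') ()
bval-injective (false ∷ c) [] ()
bval-injective (true ∷ c) [] ()
bval-injective (false ∷ c) (false ∷ c') eq = cong (false ∷_) (bval-injective c c' (*-cancelˡ-≡ _ _ 2
      (suc-injective eq)))
bval-injective (true ∷ c) (true ∷ c') eq = cong (true ∷_) (bval-injective c c' (*-cancelˡ-≡ _ _ 2 (suc-injective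
      (suc-injective eq))))
bval-injective (false ∷ c) (true ∷ c') eq = ⊥-elim (even≢odd (bval c) (bval c') (suc-injective eq))
bval-injective (true ∷ c) (false ∷ c') eq = ⊥-elim (even≢odd (bval c') (bval c) (sym (suc-injective eq)))

bval-iter : ∀ n c → bval (iter binc n c) ≡ n + bval c
bval-iter zero c = refl
bval-iter (suc n) c = trans (bval-iter n (binc c)) (trans (cong (n +_) (bval-binc c)) (+-suc n (bval c)))

length≤bval : ∀ c → length c ≤ bval c
length≤bval [] = z≤n
length≤bval (false ∷ c) = s≤s (≤-trans (length≤bval c) (m≤m+n _ _))
length≤bval (true ∷ c) = s≤s (≤-trans (length≤bval c) (≤-trans (m≤m+n _ _) (n≤1+n _)))

length-binc : ∀ c → length (binc c) ≤ suc (length c)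
length-binc [] = ≤-refl
length-binc (false ∷ c) = n≤1+n _
length-binc (true ∷ c) = s≤s (length-binc c)

-- This is what makes bijective base 2 convenient for inverting powers of two: l + 1 is a power of
-- two exactly when the numeral of l has only digits 1, and the exponent is then its number of
-- digits.
bval-zeros : ∀ m → suc (bval (replicate m false)) ≡ 2 ^ m
bval-zeros zero = refl
bval-zeros (suc m) rewrite sym (bval-zeros m) = cong suc (sym (+-suc _ _))

-- Digits 1 and 2 carry just as binary digits 0 and 1 do; only on overflow is a new digit appended.
-- One carry loop therefore serves both kinds of counter.
binc-finc : ∀ c → binc c ≡ (if overflows c then finc c ++ false ∷ [] else finc c)
binc-finc [] = refl
binc-finc (false ∷ c) = refl
binc-finc (true ∷ c) with overflows c | binc-finc c
... | true | eq = cong (false ∷_) eq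
... | false | eq = cong (false ∷_) eq

-- Counter, scratch, carry.  On exit the scratch holds the reversed new counter.
carryLoop incCore : Cmd 3
carryLoop = while 0F (pop 0F skip (pop 2F (push 1F false) (push 1F true) (push 1F true))
                     (pop 2F (push 1F true) (push 1F false ⨾ push 2F true) (push 1F false ⨾ push 2F true)))
incCore = push 2F true ⨾ carryLoop

carry-none : ∀ c {ts} → Run carryLoop (c ∷ ts ∷ [] ∷ []) (length c * 5 + 1) ([] ∷ (c ʳ++ ts) ∷ [] ∷ [])
carry-none [] = r-stop refl
carry-none (false ∷ c) = r-weak (n≤1+n _) (r-loop refl (r-pop0 refl (r-pop∅ refl (r-push refl))) (carry-none c))
carry-none (true ∷ c) = r-weak (n≤1+n _) (r-loop refl (r-pop1 refl (r-pop∅ refl (r-push refl))) (carry-none c))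

carry-one : ∀ c {ts} → Run carryLoop (c ∷ ts ∷ (true ∷ []) ∷ []) (length c * 5 + 1) ([] ∷ (finc c ʳ++ ts) ∷ flag
      (overflows c) ∷ [])
carry-one [] = r-stop refl
carry-one (false ∷ c) = r-weak (n≤1+n _) (r-loop refl (r-pop0 refl (r-pop1 refl (r-push refl))) (carry-none c))
carry-one (true ∷ c) = r-loop refl (r-pop1 refl (r-pop1 refl (r-push refl r⨾ r-push refl))) (carry-one c)

incF incB : Cmd 3
incF = incCore ⨾ rename (1F ∷ 0F ∷ []) pour
incB = incCore ⨾ pop 2F skip (push 1F false) (push 1F false) ⨾ rename (1F ∷ 0F ∷ []) pour

incF-run : ∀ c → Run incF (c ∷ [] ∷ [] ∷ []) (length c * 8 + 3) (finc c ∷ [] ∷ flag (overflows c) ∷ [])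
incF-run c = subst (λ z → Run incF (c ∷ [] ∷ [] ∷ []) (length c * 8 + 3) (z ∷ [] ∷ flag (overflows c) ∷ []))
      (reverse-involutive (finc c))
  (r-weak (≤-reflexive (trans (cong (λ l → 1 + (length c * 5 + 1) + (l * 3 + 1)) (trans (length-reverse
        (finc c)) (length-finc c)))
                              (cost (length c))))
    ((r-push refl r⨾ carry-one c) r⨾ frame (1F ∷ 0F ∷ []) (pour-run (reverse (finc c)))))
  where
  cost : ∀ l → 1 + (l * 5 + 1) + (l * 3 + 1) ≡ l * 8 + 3
  cost = solve-∀

incB-run : ∀ c → Run incB (c ∷ [] ∷ [] ∷ []) (length c * 8 + 8) (binc c ∷ [] ∷ [] ∷ [])
incB-run c with overflows c | binc-finc c | carry-one c {[]}
... | false | eq | r rewrite eq =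
  subst (λ z → Run incB (c ∷ [] ∷ [] ∷ []) (length c * 8 + 8) (z ∷ [] ∷ [] ∷ [])) (reverse-involutive (finc c))
  (r-weak (≤-by 3 (trans (cong (λ l → 1 + (length c * 5 + 1) + (2 + (l * 3 + 1)) + 3) (trans (length-reverse
        (finc c)) (length-finc c)))
                              (cost (length c))))
    ((r-push refl r⨾ r) r⨾ r-pop∅ refl r-skip r⨾ frame (1F ∷ 0F ∷ []) (pour-run (reverse (finc c)))))
  where
  cost : ∀ l → 1 + (l * 5 + 1) + (2 + (l * 3 + 1)) + 3 ≡ l * 8 + 8
  cost = solve-∀
... | true | eq | r rewrite eq =
  subst (λ z → Run incB (c ∷ [] ∷ [] ∷ []) (length c * 8 + 8) (z ∷ [] ∷ [] ∷ []))
        (trans (ʳ++-defn (reverse (finc c))) (cong (_++ false ∷ []) (reverse-involutive (finc c))))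
  (r-weak (≤-reflexive (trans (cong (λ l → 1 + (length c * 5 + 1) + (2 + (suc l * 3 + 1))) (trans
        (length-reverse (finc c)) (length-finc c)))
                              (cost (length c))))
    ((r-push refl r⨾ r) r⨾ r-pop1 refl (r-push refl) r⨾ frame (1F ∷ 0F ∷ []) (pour-run (false ∷ reverse (finc c)))))
  where
  cost : ∀ l → 1 + (l * 5 + 1) + (2 + (suc l * 3 + 1)) ≡ l * 8 + 8
  cost = solve-∀

-- Recognising stages

tower : ℕ → ℕ
tower zero = 0
tower (suc j) = 2 ^ tower j

ones : ℕ → Str
ones n = replicate n true

candidate : Bool → ℕ → Str
candidate b n = true ∷ b ∷ ones n

-- The stacks are: unary input, counter, scratch, carry, index, errors.
countLoop settle valid : Cmd 6
countLoop = while 0F (pop 0F skip (rename (1F ∷ 2F ∷ 3F ∷ []) incB) (rename (1F ∷ 2F ∷ 3F ∷ []) incB))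
settle = while 1F (pop 1F skip (push 0F false) (push 5F true ⨾ push 0F false))
valid = while 0F (pop 0F skip skip skip ⨾ countLoop ⨾ settle ⨾ rename (4F ∷ 2F ∷ 3F ∷ []) incB)

countLoop-run : ∀ m xs {c ix bad} → length xs + bval c ≤ m →
  Run countLoop (xs ∷ c ∷ [] ∷ [] ∷ ix ∷ bad ∷ []) (length xs * (m * 8 + 10) + 1) ([] ∷ iter binc
        (length xs) c ∷ [] ∷ [] ∷ ix ∷ bad ∷ [])
countLoop-run m [] le = r-stop refl
countLoop-run m (x ∷ xs) {c} {ix} {bad} le =
  r-weak (≤-trans (s≤s (+-monoˡ-≤ (length xs * (m * 8 + 10) + 1) (s≤s (+-monoˡ-≤ 8 (*-monoˡ-≤ 8 c≤m)))))
        (≤-reflexive (cost m (length xs))))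
    (r-loop refl (first x) (countLoop-run m xs next))
  where
  c≤m : length c ≤ m
  c≤m = ≤-trans (length≤bval c) (≤-trans (m≤n+m _ _) le)
  next : length xs + bval (binc c) ≤ m
  next = ≤-trans (≤-reflexive (trans (cong (length xs +_) (bval-binc c)) (+-suc (length xs) (bval c)))) le
  cost : ∀ m l → suc (suc (m * 8 + 8) + (l * (m * 8 + 10) + 1)) ≡ suc l * (m * 8 + 10) + 1
  cost = solve-∀
  first : ∀ x → Run (pop 0F skip (rename (1F ∷ 2F ∷ 3F ∷ []) incB) (rename (1F ∷ 2F ∷ 3F ∷ []) incB))
            ((x ∷ xs) ∷ c ∷ [] ∷ [] ∷ ix ∷ bad ∷ []) (suc (length c * 8 + 8)) (xs ∷ binc c ∷ [] ∷ [] ∷ ix ∷ bad ∷ [])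
  first false = r-pop0 refl (frame (1F ∷ 2F ∷ 3F ∷ []) (incB-run c))
  first true = r-pop1 refl (frame (1F ∷ 2F ∷ 3F ∷ []) (incB-run c))

settle-run : ∀ c xs {ix bad} → Σ (List Bool) λ ys → Σ (List Bool) λ bad' →
  Run settle (xs ∷ c ∷ [] ∷ [] ∷ ix ∷ bad ∷ []) (length c * 4 + 1) (ys ∷ [] ∷ [] ∷ [] ∷ ix ∷ bad' ∷ [])
  × length ys ≡ length c + length xs
  × (bad' ≡ [] → bad ≡ [] × c ≡ replicate (length c) false) × (bad ≡ [] → c ≡ replicate (length c) false → bad' ≡ [])
settle-run [] xs = xs , _ , r-stop refl , refl , (λ eq → eq , refl) , (λ eq _ → eq)
settle-run (false ∷ c) xs with settle-run c (false ∷ xs)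
... | ys , bad' , r , ℓ , sound , complete =
  ys , bad' , r-weak (n≤1+n _) (r-loop refl (r-pop0 refl (r-push refl)) r) , trans ℓ (+-suc _ _) ,
  (λ eq → proj₁ (sound eq) , cong (false ∷_) (proj₂ (sound eq))) ,
  (λ eq eq' → complete eq (cong (drop 1) eq'))
settle-run (true ∷ c) xs {bad = bad} with settle-run c (false ∷ xs) {bad = true ∷ bad}
... | ys , bad' , r , ℓ , sound , complete =
  ys , bad' , r-loop refl (r-pop1 refl (r-push refl r⨾ r-push refl)) r , trans ℓ (+-suc _ _) ,
  (λ eq → case proj₁ (sound eq) of λ ()) , (λ eq ())

roundCost : ℕ → ℕ
roundCost m = 1 + (2 + ((m * (m * 8 + 10) + 1) + ((m * 4 + 1) + (m * 8 + 8))))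

-- Each round takes a discrete logarithm: it writes the length minus one in bijective base 2,
-- records an error if a digit 2 occurs, and continues with the number of digits as new length.
-- Reaching 0 without error means that the length is a tower, whose height is what has been added to
-- the index. `k` bounds the recursion, because the new length is smaller without being a subterm.
valid-run : ∀ k m xs {ix bad} → length xs ≤ k → length xs + length ix ≤ m → Σ (List Bool) λ ix' →
      Σ (List Bool) λ bad' →
  Run valid (xs ∷ [] ∷ [] ∷ [] ∷ ix ∷ bad ∷ []) (length xs * roundCost m + 1) ([] ∷ [] ∷ [] ∷ [] ∷ ix' ∷ bad' ∷ [])
  × length ix' ≤ m
  × (bad' ≡ [] → bad ≡ [] × Σ ℕ λ j → length xs ≡ tower j × ix' ≡ iter binc j ix)
  × (∀ j → length xs ≡ tower j → bad ≡ [] → bad' ≡ [])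
valid-run k m [] le le' = _ , _ , r-stop refl , le' , (λ eq → eq , 0 , refl , refl) , (λ _ _ eq → eq)
valid-run (suc k) m (x ∷ xs) {ix} {bad} (s≤s le) le' with settle-run (iter binc (length xs) []) [] {ix} {bad}
... | ys , bad₁ , settled , ℓ , sound , complete with valid-run k m ys {binc ix} {bad₁} (≤-trans ys≤xs le)
                       (≤-trans (+-mono-≤ ys≤xs (length-binc ix)) (≤-trans (≤-reflexive (+-suc (length xs)
                             (length ix))) le'))
  where
  c = iter binc (length xs) []
  c≡ : bval c ≡ length xs
  c≡ = trans (bval-iter (length xs) []) (+-identityʳ _)
  ys≤xs : length ys ≤ length xs
  ys≤xs = ≤-trans (≤-reflexive (trans ℓ (+-identityʳ _))) (≤-trans (length≤bval c) (≤-reflexive c≡))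
... | ix' , bad' , r , ix'≤ , sound' , complete' = ix' , bad' , run , ix'≤ , sound″ , complete″
  where
  c = iter binc (length xs) []
  c≡ : bval c ≡ length xs
  c≡ = trans (bval-iter (length xs) []) (+-identityʳ _)
  c≤xs : length c ≤ length xs
  c≤xs = ≤-trans (length≤bval c) (≤-reflexive c≡)
  ys≡c : length ys ≡ length c
  ys≡c = trans ℓ (+-identityʳ _)
  xs≤m : length xs ≤ m
  xs≤m = ≤-trans (≤-trans (n≤1+n _) (m≤m+n _ (length ix))) le'
  c≤m : length c ≤ m
  c≤m = ≤-trans c≤xs xs≤m
  ix≤m : length ix ≤ m
  ix≤m = ≤-trans (m≤n+m _ _) le'
  first : ∀ x → Run (pop 0F skip skip skip) ((x ∷ xs) ∷ [] ∷ [] ∷ [] ∷ ix ∷ bad ∷ []) 2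
        (xs ∷ [] ∷ [] ∷ [] ∷ ix ∷ bad ∷ [])
  first false = r-pop0 refl r-skip
  first true = r-pop1 refl r-skip
  run : Run valid ((x ∷ xs) ∷ [] ∷ [] ∷ [] ∷ ix ∷ bad ∷ []) (suc (length xs) * roundCost m + 1)
        ([] ∷ [] ∷ [] ∷ [] ∷ ix' ∷ bad' ∷ [])
  run = r-weak (≤-trans
      (s≤s (+-mono-≤ (+-monoʳ-≤ 2 (+-mono-≤ (+-monoˡ-≤ 1 (*-monoˡ-≤ (m * 8 + 10) xs≤m))
             (+-mono-≤ (+-monoˡ-≤ 1 (*-monoˡ-≤ 4 c≤m)) (+-monoˡ-≤ 8 (*-monoˡ-≤ 8 ix≤m)))))
             (+-monoˡ-≤ 1 (*-monoˡ-≤ (roundCost m) (≤-trans (≤-reflexive ys≡c) c≤xs)))))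
      (≤-reflexive (sym (+-assoc (roundCost m) (length xs * roundCost m) 1))))
    (r-loop refl (first x r⨾ countLoop-run m xs (≤-trans (≤-reflexive (+-identityʳ _)) xs≤m) r⨾ settled
                  r⨾ frame (4F ∷ 2F ∷ 3F ∷ []) (incB-run ix)) r)
  sound″ : bad' ≡ [] → bad ≡ [] × Σ ℕ λ j → suc (length xs) ≡ tower j × ix' ≡ iter binc j ix
  sound″ eq with sound' eq
  ... | eq₁ , j , ysj , ixj with sound eq₁
  ... | eq₂ , c0 = eq₂ , suc j ,
        trans (cong suc (sym c≡)) (trans (cong (suc ∘ bval) c0) (trans (bval-zeros (length c)) (cong (2 ^_)
              (trans (sym ys≡c) ysj)))) , ixj
  complete″ : ∀ j → suc (length xs) ≡ tower j → bad ≡ [] → bad' ≡ []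
  complete″ (suc j) eq eq' = complete' j (trans ys≡c (trans (cong length c0) (length-replicate (tower j))))
      (complete eq' (trans c0 (cong (λ z → replicate z false) (sym (trans (cong length c0) (length-replicate
            (tower j)))))))
    where
    c0 : c ≡ replicate (tower j) false
    c0 = bval-injective c (replicate (tower j) false) (suc-injective (trans (cong suc c≡) (trans eq (sym
          (bval-zeros (tower j))))))

-- The stacks are: candidate, errors, bit, and two copies of the unary tail.
formLoop form : Cmd 5
formLoop = while 0F (pop 0F skip (push 1F true ⨾ push 3F true ⨾ push 4F true) (push 3F true ⨾ push 4F true))
form = pop 0F (push 1F true) (push 1F true) (pop 0F (push 1F true) (push 2F false) (push 2F true)) ⨾ formLoop

ones-+suc : ∀ l m → ones (l + suc m) ≡ ones (suc l + m)
ones-+suc l m = cong ones (+-suc l m)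

formLoop-run : ∀ y m {bad B} → Σ (List Bool) λ bad' →
  Run formLoop (y ∷ bad ∷ B ∷ ones m ∷ ones m ∷ []) (length y * 5 + 1) ([] ∷ bad' ∷ B ∷ ones
        (length y + m) ∷ ones (length y + m) ∷ [])
  × (bad' ≡ [] → bad ≡ [] × y ≡ ones (length y)) × (bad ≡ [] → y ≡ ones (length y) → bad' ≡ [])
formLoop-run [] m = _ , r-stop refl , (λ eq → eq , refl) , (λ eq _ → eq)
formLoop-run (false ∷ y) m {bad} {B} with formLoop-run y (suc m) {true ∷ bad} {B}
... | bad' , r , sound , complete rewrite ones-+suc (length y) m =
  bad' , r-loop refl (r-pop0 refl (r-push refl r⨾ r-push refl r⨾ r-push refl)) r ,
  (λ eq → case proj₁ (sound eq) of λ ()) , (λ eq ())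
formLoop-run (true ∷ y) m {bad} {B} with formLoop-run y (suc m) {bad} {B}
... | bad' , r , sound , complete rewrite ones-+suc (length y) m =
  bad' , r-weak (n≤1+n _) (r-loop refl (r-pop1 refl (r-push refl r⨾ r-push refl)) r) ,
  (λ eq → proj₁ (sound eq) , cong (true ∷_) (proj₂ (sound eq))) , (λ eq eq' → complete eq (cong (drop 1) eq'))

form-run : ∀ y → Σ (List Bool) λ bad → Σ (List Bool) λ B → Σ ℕ λ m →
  Run form (y ∷ [] ∷ [] ∷ [] ∷ [] ∷ []) (length y * 5 + 4) ([] ∷ bad ∷ B ∷ ones m ∷ ones m ∷ []) × m ≤ length y
  × (bad ≡ [] → Σ Bool λ b → y ≡ candidate b m × B ≡ b ∷ []) × (∀ b n → y ≡ candidate b n → bad ≡ [])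
form-run [] = _ , _ , 0 , r-weak (n≤1+n _) (r-pop∅ refl (r-push refl) r⨾ r-stop refl) , z≤n , (λ ()) , (λ b n ())
form-run (false ∷ y) with formLoop-run y 0 {true ∷ []} {[]}
... | bad , r , sound , _ = bad , [] , length y + 0 ,
  r-weak (≤-by 6 (cost (length y))) (r-pop0 refl (r-push refl)
        r⨾ r) , ≤-trans (≤-reflexive (+-identityʳ _)) (n≤1+n _) ,
  (λ eq → case proj₁ (sound eq) of λ ()) , (λ b n ())
  where
  cost : ∀ l → 2 + (l * 5 + 1) + 6 ≡ suc l * 5 + 4
  cost = solve-∀
form-run (true ∷ []) = _ , _ , 0 , r-weak (≤-by 5 refl) (r-pop1 refl (r-pop∅ refl (r-push refl))
      r⨾ r-stop refl) , z≤n , (λ ()) , (λ b n ())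
form-run (true ∷ b ∷ y) with formLoop-run y 0 {[]} {b ∷ []}
... | bad , r , sound , complete = bad , b ∷ [] , length y + 0 ,
  r-weak (≤-by 10 (cost (length y))) (first b r⨾ r) ,
  ≤-trans (≤-reflexive (+-identityʳ _)) (≤-trans (n≤1+n _) (n≤1+n _)) ,
  (λ eq → b , cong (λ z → true ∷ b ∷ z) (trans (proj₂ (sound eq)) (cong ones (sym (+-identityʳ
        (length y))))) , refl) ,
  (λ { b n refl → complete refl (cong ones (sym (length-replicate n))) })
  where
  cost : ∀ l → 3 + (l * 5 + 1) + 10 ≡ suc (suc l) * 5 + 4
  cost = solve-∀
  first : ∀ b → Run (pop 0F (push 1F true) (push 1F true) (pop 0F (push 1F true) (push 2F false) (push 2F true)))
            ((true ∷ b ∷ y) ∷ [] ∷ [] ∷ [] ∷ [] ∷ []) 3 (y ∷ [] ∷ (b ∷ []) ∷ [] ∷ [] ∷ [])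
  first false = r-pop1 refl (r-pop0 refl (r-push refl))
  first true = r-pop1 refl (r-pop1 refl (r-push refl))

-- The stacks are: candidate and scratch, errors, bit, unary tail, its saved copy, counter, carry, index.
recognise : Cmd 8
recognise = rename (0F ∷ 1F ∷ 2F ∷ 3F ∷ 4F ∷ []) form ⨾ rename (3F ∷ 5F ∷ 0F ∷ 6F ∷ 7F ∷ 1F ∷ []) valid

index : ℕ → List Bool
index j = iter binc j []

-- The error stack carries the answer. When it is nonempty the other stacks hold leftovers about
-- which nothing is recorded.
data Recognised (y : Str) : (bad B : List Bool) (m : ℕ) (ix : List Bool) → Set where
  stage   : ∀ j b → y ≡ candidate b (tower j) → Recognised y [] (b ∷ []) (tower j) (index j)
  nostage : ∀ {x bad B m ix} → (∀ j b → y ≢ candidate b (tower j)) → Recognised y (x ∷ bad) B m ix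

recogniseCost : ℕ → ℕ
recogniseCost ℓ = ℓ * 5 + 4 + (ℓ * roundCost ℓ + 1)

recognise-run : ∀ N y → length y ≤ N → Σ (List Bool) λ bad → Σ (List Bool) λ B → Σ ℕ λ m → Σ (List Bool) λ ix →
  Run recognise (y ∷ [] ∷ [] ∷ [] ∷ [] ∷ [] ∷ [] ∷ [] ∷ []) (recogniseCost N)
        ([] ∷ bad ∷ B ∷ [] ∷ ones m ∷ [] ∷ [] ∷ ix ∷ [])
  × m ≤ N × length ix ≤ N × Recognised y bad B m ix
recognise-run N y y≤ with form-run y
... | bad , B , m , r , m≤y , sound , complete
    with valid-run m N (ones m) {[]} {bad} (≤-reflexive (length-replicate m))
           (≤-trans (≤-reflexive (trans (+-identityʳ _) (length-replicate m))) (≤-trans m≤y y≤))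
... | ix , bad' , r' , ix≤ , sound' , complete' = bad' , B , m , ix ,
  (frame (0F ∷ 1F ∷ 2F ∷ 3F ∷ 4F ∷ []) (r-weak (+-monoˡ-≤ 4 (*-monoˡ-≤ 5 y≤)) r) r⨾
   frame (3F ∷ 5F ∷ 0F ∷ 6F ∷ 7F ∷ 1F ∷ [])
     (r-weak (+-monoˡ-≤ 1 (*-monoˡ-≤ (roundCost N) (≤-trans (≤-reflexive (length-replicate m))
           (≤-trans m≤y y≤)))) r')) ,
  m≤ , ix≤ , outcome bad' refl
  where
  m≤ = ≤-trans m≤y y≤
  outcome : ∀ bad″ → bad″ ≡ bad' → Recognised y bad″ B m ix
  outcome [] eq with sound' (sym eq)
  ... | eq₁ , j , eqm , refl with sound eq₁
  ... | b , refl , refl with trans (sym (length-replicate m)) eqm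
  ... | refl = stage j b refl
  outcome (x ∷ _) eq = nostage λ { j b refl → case trans eq (complete' j (candidate-length {j} b (sound
        (complete b (tower j) refl)) ) (complete b (tower j) refl)) of λ () }
    where
    candidate-length : ∀ {j} b → (Σ Bool λ b' → candidate b (tower j) ≡ candidate b' m × B ≡ b' ∷ []) →
          length (ones m) ≡ tower j
    candidate-length {j} b (b' , eq , _) = suc-injective (suc-injective
      (trans (cong length (sym eq)) (cong (suc ∘ suc) (length-replicate (tower j)))))

-- Universal simulation

-- Tape symbols on a stack of bits: the prefix code blank ↦ 0, b0 ↦ 10, b1 ↦ 11; an empty stack reads as blank.
popC : List Bool → Sym × List Bool
popC [] = blank , []
popC (false ∷ xs) = blank , xs
popC (true ∷ []) = blank , []
popC (true ∷ b ∷ xs) = bitSym b , xs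

topC : List Bool → Sym
topC = proj₁ ∘ popC

restC : List Bool → List Bool
restC = proj₂ ∘ popC

putC : Sym → List Bool
putC blank = false ∷ []
putC b0 = true ∷ false ∷ []
putC b1 = true ∷ true ∷ []

length-restC : ∀ xs → length (restC xs) ≤ length xs
length-restC [] = z≤n
length-restC (false ∷ xs) = n≤1+n _
length-restC (true ∷ []) = z≤n
length-restC (true ∷ b ∷ xs) = m≤n+m _ 2

readC : ∀ {n} → Fin n → (Sym → Cmd n) → Cmd n
readC s k = pop s (k blank) (k blank) (pop s (k blank) (k b0) (k b1))

readC-run : ∀ {n s} {k : Sym → Cmd n} {σ t σ'} xs → lookup σ s ≡ xs → Run (k (topC xs)) (σ [ s ]≔ restC xs) t σ' →
            Run (readC s k) σ (2 + t) σ'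
readC-run {s = s} {σ = σ} [] eq r = r-weak (n≤1+n _) (r-pop∅ eq (subst (λ z →
      Run _ z _ _) (trans (cong (σ [ s ]≔_) (sym eq)) ([]≔-lookup σ s)) r))
readC-run (false ∷ xs) eq r = r-weak (n≤1+n _) (r-pop0 eq r)
readC-run {s = s} {σ = σ} (true ∷ []) eq r = r-pop1 eq (r-pop∅ (lookup∘update s σ []) r)
readC-run {s = s} {σ = σ} (true ∷ false ∷ xs) eq r =
  r-pop1 eq (r-pop0 (lookup∘update s σ _) (subst (λ z → Run _ z _ _) (sym ([]≔-idempotent σ s)) r))
readC-run {s = s} {σ = σ} (true ∷ true ∷ xs) eq r =
  r-pop1 eq (r-pop1 (lookup∘update s σ _) (subst (λ z → Run _ z _ _) (sym ([]≔-idempotent σ s)) r))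

pushC : ∀ {n} → Fin n → Sym → Cmd n
pushC s blank = push s false
pushC s b0 = push s false ⨾ push s true
pushC s b1 = push s true ⨾ push s true

pushC-run : ∀ {n} {s : Fin n} {σ} a xs → lookup σ s ≡ xs → Run (pushC s a) σ 2 (σ [ s ]≔ (putC a ++ xs))
pushC-run blank xs eq = r-weak (s≤s z≤n) (r-push eq)
pushC-run {s = s} {σ} b0 xs eq = subst (Run _ _ 2) ([]≔-idempotent σ s) (r-push eq r⨾ r-push (lookup∘update s σ _))
pushC-run {s = s} {σ} b1 xs eq = subst (Run _ _ 2) ([]≔-idempotent σ s) (r-push eq r⨾ r-push (lookup∘update s σ _))

leading : List Bool → ℕ
leading [] = 0
leading (false ∷ xs) = 0
leading (true ∷ xs) = suc (leading xs)

dropOnes : List Bool → List Bool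
dropOnes [] = []
dropOnes (false ∷ xs) = xs
dropOnes (true ∷ xs) = dropOnes xs

leading≤length : ∀ xs → leading xs ≤ length xs
leading≤length [] = z≤n
leading≤length (false ∷ xs) = z≤n
leading≤length (true ∷ xs) = s≤s (leading≤length xs)

length-dropOnes : ∀ xs → length (dropOnes xs) ≤ length xs
length-dropOnes [] = z≤n
length-dropOnes (false ∷ xs) = n≤1+n _
length-dropOnes (true ∷ xs) = m≤n⇒m≤1+n (length-dropOnes xs)

-- The stacks are: source, loop flag, target of the body.
untilZero : Cmd 3 → Cmd 3
untilZero body = push 1F true ⨾ while 1F (pop 1F skip step step)
  where
  step : Cmd 3
  step = pop 0F skip skip (body ⨾ push 1F true)

-- A `while` can only test for emptiness, not for the bit on top. The flag stack translates: it is
-- refilled exactly when the popped bit was `true`.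
untilZero-run : ∀ {body} (g : List Bool → List Bool) → (∀ {W f q} → Run body (W ∷ f ∷ q ∷ []) 1 (W ∷ f ∷ g q ∷ [])) →
  ∀ W q → Run (untilZero body) (W ∷ [] ∷ q ∷ []) (length W * 5 + 6) (dropOnes W ∷ [] ∷ iter g (leading W) q ∷ [])
untilZero-run {body} g r W q = r-weak (≤-reflexive (sym (+-suc (length W * 5) 5))) (r-push refl r⨾ loop W q)
  where
  step : Cmd 3
  step = pop 0F skip skip (body ⨾ push 1F true)
  loop : ∀ W q → Run (while 1F (pop 1F skip step step)) (W ∷ (true ∷ []) ∷ q ∷ []) (length W * 5 + 5)
        (dropOnes W ∷ [] ∷ iter g (leading W) q ∷ [])
  loop [] q = r-loop refl (r-pop1 refl (r-pop∅ refl r-skip)) (r-stop refl)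
  loop (false ∷ W) q = r-weak (≤-trans (m≤n+m 5 (length W * 5)) (m≤n+m _ 5)) (r-loop refl (r-pop1 refl
        (r-pop0 refl r-skip)) (r-stop refl))
  loop (true ∷ W) q = r-loop refl (r-pop1 refl (r-pop1 refl (r r⨾ r-push refl))) (loop W (g q))

unary-run : ∀ W → Run (untilZero (push 2F true)) (W ∷ [] ∷ [] ∷ []) (length W * 5 + 6) (dropOnes W ∷ [] ∷ ones
      (leading W) ∷ [])
unary-run W = subst (λ z → Run (untilZero (push 2F true)) (W ∷ [] ∷ [] ∷ []) (length W * 5 + 6)
      (dropOnes W ∷ [] ∷ z ∷ []))
  (trans (iter-push (leading W) 0) (cong ones (+-identityʳ _))) (untilZero-run (true ∷_) (r-push {s = 2F} refl) W [])
  where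
  iter-push : ∀ n m → iter (true ∷_) n (ones m) ≡ ones (n + m)
  iter-push zero m = refl
  iter-push (suc n) m = trans (iter-push n (suc m)) (ones-+suc n m)

skipE : List Bool → List Bool
skipE W = dropOnes (restC (restC W))

length-skipE : ∀ W → length (skipE W) ≤ length W
length-skipE W = ≤-trans (length-dropOnes (restC (restC W))) (≤-trans (length-restC (restC W)) (length-restC W))

length-iter-skipE : ∀ n W → length (iter skipE n W) ≤ length W
length-iter-skipE zero W = ≤-refl
length-iter-skipE (suc n) W = ≤-trans (length-iter-skipE n (skipE W)) (length-skipE W)

skipEntry : Cmd 3
skipEntry = readC 0F (λ _ → skip) ⨾ readC 0F (λ _ → skip) ⨾ untilZero skip

skipEntry-run : ∀ W q → Run skipEntry (W ∷ [] ∷ q ∷ []) (length W * 5 + 12) (skipE W ∷ [] ∷ q ∷ [])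
skipEntry-run W q = r-weak (≤-trans (+-monoʳ-≤ 6 (+-monoˡ-≤ 6 (*-monoˡ-≤ 5 (≤-trans (length-restC (restC W))
      (length-restC W))))) (≤-reflexive (cost (length W))))
  (readC-run W refl r-skip r⨾ readC-run (restC W) refl r-skip r⨾ subst (λ z →
        Run _ (restC (restC W) ∷ [] ∷ q ∷ []) _ (skipE W ∷ [] ∷ z ∷ [])) (iter-id (leading (restC (restC W))) q)
    (untilZero-run id r-skip (restC (restC W)) q))
  where
  cost : ∀ l → 6 + (l * 5 + 6) ≡ l * 5 + 12
  cost = solve-∀
  iter-id : ∀ n q → iter id n q ≡ q
  iter-id zero q = refl
  iter-id (suc n) q = iter-id n q

-- A configuration of the simulated machine: three times its state, the left stack, and the right stack with
-- the head on top.
Conf : Set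
Conf = ℕ × List Bool × List Bool

offset : Sym → ℕ
offset b0 = 0
offset b1 = 1
offset blank = 2

moveC : Sym → List Bool → List Bool → List Bool × List Bool
moveC blank L R = L , R
moveC b0 L R = restC L , putC (topC L) ++ R
moveC b1 L R = putC (topC R) ++ L , restC R

-- A program is a sequence of entries: written symbol, move (blank, b0, b1 for stay, left, right), new state in unary.
transition : List Bool → Conf → Conf
transition W (q , L , R) = leading (restC (restC W)) , moveC (topC (restC W)) L (putC (topC W) ++ R)

-- States are stored multiplied by three because each owns one entry per symbol, so state plus
-- offset is the number of entries to skip. Exhausted or malformed text reads as blanks and zeros,
-- which makes the step total for every bit string as program.
ustep : List Bool → Conf → Conf
ustep p (q , L , R) = transition (iter skipE (offset (topC R) + q) p) (q , L , restC R)

-- The stacks are: program, scratch, work copy, right, left, state, flag.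
countOffset : Sym → Cmd 7
countOffset b0 = skip
countOffset b1 = push 5F true
countOffset blank = push 5F true ⨾ push 5F true

moveHead : Sym → Cmd 7
moveHead blank = skip
moveHead b0 = readC 4F (pushC 3F)
moveHead b1 = readC 3F (pushC 4F)

seekEntry enact simulate : Cmd 7
seekEntry = while 5F (pop 5F skip (rename (2F ∷ 6F ∷ 1F ∷ []) skipEntry) (rename (2F ∷ 6F ∷ 1F ∷ []) skipEntry))
enact = readC 2F (pushC 3F) ⨾ readC 2F moveHead ⨾ rename (2F ∷ 6F ∷ 5F ∷ []) (untilZero (push 2F true)) ⨾ rename
      (2F ∷ []) clear
simulate = rename (0F ∷ 1F ∷ 2F ∷ []) copy ⨾ readC 3F countOffset ⨾ seekEntry ⨾ enact

store : List Bool → List Bool → Conf → Store 7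
store p W (q , L , R) = p ∷ [] ∷ W ∷ R ∷ L ∷ ones q ∷ [] ∷ []

countOffset-run : ∀ a {p W q L R} → Run (countOffset a) (store p W (q , L , R)) 2 (store p W (offset a + q , L , R))
countOffset-run b0 = r-weak (s≤s z≤n) r-skip
countOffset-run b1 = r-weak (s≤s z≤n) (r-push refl)
countOffset-run blank = r-push refl r⨾ r-push refl

moveHead-run : ∀ a {p W q L R} → Run (moveHead a) (store p W (q , L , R)) 4 (store p W (q , moveC a L R))
moveHead-run blank = r-weak (s≤s z≤n) r-skip
moveHead-run b0 {L = L} {R} = readC-run {k = pushC 3F} L refl (pushC-run (topC L) R refl)
moveHead-run b1 {L = L} {R} = readC-run {k = pushC 4F} R refl (pushC-run (topC R) L refl)

seekEntry-run : ∀ E W q {p L R} → length W ≤ E →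
  Run seekEntry (store p W (q , L , R)) (q * (E * 5 + 14) + 1) (store p (iter skipE q W) (0 , L , R))
seekEntry-run E W zero le = r-stop refl
seekEntry-run E W (suc q) le = r-weak (≤-trans (s≤s (s≤s (+-monoˡ-≤ (q * (E * 5 + 14) + 1) (+-monoˡ-≤ 12
      (*-monoˡ-≤ 5 le))))) (≤-reflexive (cost E q)))
  (r-loop refl (r-pop1 refl (frame (2F ∷ 6F ∷ 1F ∷ []) (skipEntry-run W []))) (seekEntry-run E (skipE W) q
        (≤-trans (length-skipE W) le)))
  where
  cost : ∀ E q → suc (suc (E * 5 + 12 + (q * (E * 5 + 14) + 1))) ≡ suc q * (E * 5 + 14) + 1
  cost = solve-∀

enact-run : ∀ E W {p L R} → length W ≤ E →
  Run enact (store p W (0 , L , R)) (4 + (6 + ((E * 5 + 6) + (E * 3 + 1)))) (store p [] (transition W (0 , L , R)))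
enact-run E W {p} {L} {R} le =
  readC-run {k = pushC 3F} W refl (pushC-run (topC W) R refl)
  r⨾ readC-run {k = moveHead} (restC W) refl (moveHead-run (topC (restC W)) {p} {restC (restC W)} {0} {L} {putC
        (topC W) ++ R})
  r⨾ r-weak (+-monoˡ-≤ 6 (*-monoˡ-≤ 5 W2≤)) (frame (2F ∷ 6F ∷ 5F ∷ [])
       (unary-run W2))
  r⨾ r-weak (+-monoˡ-≤ 1 (*-monoˡ-≤ 3 (≤-trans (length-dropOnes W2) W2≤))) (frame (2F ∷ []) (clear-run (dropOnes W2)))
  where
  W2 = restC (restC W)
  W2≤ : length W2 ≤ E
  W2≤ = ≤-trans (≤-trans (length-restC (restC W)) (length-restC W)) le

simCost : ℕ → ℕ
simCost E = (E * 7 + 2) + (4 + (((2 + E) * (E * 5 + 14) + 1) + (4 + (6 + ((E * 5 + 6) + (E * 3 + 1))))))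

offset≤2 : ∀ a → offset a ≤ 2
offset≤2 b0 = z≤n
offset≤2 b1 = s≤s z≤n
offset≤2 blank = s≤s (s≤s z≤n)

simulate-run : ∀ E p s → length p ≤ E → proj₁ s ≤ E → Run simulate (store p [] s) (simCost E) (store p [] (ustep p s))
simulate-run E p (q , L , R) le q≤ =
  r-weak (+-monoˡ-≤ 2 (*-monoˡ-≤ 7 le)) (frame (0F ∷ 1F ∷ 2F ∷ []) (copy-run p))
  r⨾ readC-run {k = countOffset} R refl (countOffset-run (topC R))
  r⨾ r-weak (+-monoˡ-≤ 1 (*-monoˡ-≤ (E * 5 + 14) (+-mono-≤ (offset≤2 (topC R)) q≤))) (seekEntry-run E p (offset
        (topC R) + q) le)
  r⨾ enact-run E (iter skipE (offset (topC R) + q) p) (≤-trans (length-iter-skipE (offset (topC R) + q) p) le)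

-- The next state is a unary number read off the program, so the program length bounds it forever.
-- The cost of a simulated step thus does not grow as the simulation proceeds.
ustep-state≤ : ∀ p s → proj₁ (ustep p s) ≤ length p
ustep-state≤ p (q , L , R) = ≤-trans (leading≤length (restC (restC W))) (≤-trans (≤-trans (length-restC
      (restC W)) (length-restC W))
    (length-iter-skipE (offset (topC R) + q) p))
  where W = iter skipE (offset (topC R) + q) p

-- The number of increments before the counter is all ones.
remaining : List Bool → ℕ
remaining [] = 0
remaining (false ∷ c) = 1 + 2 * remaining c
remaining (true ∷ c) = 2 * remaining c

remaining-overflow : ∀ c → overflows c ≡ true → remaining c ≡ 0
remaining-overflow [] eq = refl
remaining-overflow (true ∷ c) eq rewrite remaining-overflow c eq = refl

remaining-finc : ∀ c → overflows c ≡ false → remaining c ≡ suc (remaining (finc c))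
remaining-finc (false ∷ c) eq = refl
remaining-finc (true ∷ c) eq rewrite remaining-finc c eq = cong suc (+-suc _ _)

-- A counter of n zero bits overflows at increment number 2^n, so n bits clock a run of 2^n steps.
remaining-zeros : ∀ n → suc (remaining (replicate n false)) ≡ 2 ^ n
remaining-zeros zero = refl
remaining-zeros (suc n) rewrite sym (remaining-zeros n) = cong suc (sym (+-suc _ _))

-- Simulation with a clock and limited fuel

pattern 10F = Fin.suc 9F

-- The stacks are those of 'simulate', then: fuel, used fuel, counter, done.
tick runLoop : Cmd 11
tick = push 8F true ⨾ pop 10F (rename (0F ∷ 1F ∷ 2F ∷ 3F ∷ 4F ∷ 5F ∷ 6F ∷ []) simulate ⨾ rename
      (9F ∷ 1F ∷ 10F ∷ []) incF)
                              (push 10F true) (push 10F true)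
runLoop = while 7F (pop 7F skip tick tick)

runStore : List Bool → Conf → (fuel used : ℕ) → (c done : List Bool) → Store 11
runStore p (q , L , R) n m c done = p ∷ [] ∷ [] ∷ R ∷ L ∷ ones q ∷ [] ∷ ones n ∷ ones m ∷ c ∷ done ∷ []

tickCost : ℕ → ℕ
tickCost E = 4 + (simCost E + (E * 8 + 3))

-- Once the clock has overflowed, the loop merely moves the remaining fuel across. It can then be
-- restored in full for the next candidate.
runLoop-done : ∀ E n m {p s c} → Run runLoop (runStore p s n m c (true ∷ [])) (n * tickCost E + 1)
      (runStore p s 0 (n + m) c (true ∷ []))
runLoop-done E zero m = r-stop refl
runLoop-done E (suc n) m {p} {s} {c} = r-weak (≤-trans (+-monoˡ-≤ (n * tickCost E + 1) (≤-trans (s≤s (s≤s (s≤s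
      (s≤s (s≤s (z≤n {0})))))) (+-monoʳ-≤ 4 (≤-trans (s≤s z≤n) (≤-trans (m≤n+m 3 (E * 8)) (m≤n+m _ (simCost E)))))))
      (≤-reflexive (sym (+-assoc (tickCost E) (n * tickCost E) 1))))
  (r-loop refl (r-pop1 refl (r-push refl r⨾ r-pop1 refl (r-push refl)))
    (subst (λ z → Run runLoop (runStore p s n (suc m) c (true ∷ [])) (n * tickCost E + 1) (runStore p s 0 z c
          (true ∷ []))) (+-suc n m)
      (runLoop-done E n (suc m))))

-- A tick simulates a step before it increments the counter, and so does the overflowing tick; hence
-- the successor in `finished`.
data RunResult (p : List Bool) (s : Conf) (c : List Bool) (n : ℕ) : Conf → List Bool → Set where
  timeout  : ∀ {s'} → n ≤ remaining c → RunResult p s c n s' []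
  finished : RunResult p s c n (iter (ustep p) (suc (remaining c)) s) (true ∷ [])

runLoop-run : ∀ E p n m s c → length p ≤ E → proj₁ s ≤ E → length c ≤ E → Σ Conf λ s' → Σ (List Bool) λ c' →
      Σ (List Bool) λ done →
  Run runLoop (runStore p s n m c []) (n * tickCost E + 1) (runStore p s' 0 (n + m) c' done) ×
        RunResult p s c n s' done
runLoop-run E p zero m s c p≤ s≤ c≤ = s , c , [] , r-stop refl , timeout z≤n
runLoop-run E p (suc n) m s c p≤ s≤ c≤ with overflows c in eq | incF-run c
... | true | r = iter (ustep p) 1 s , finc c , true ∷ [] , run , subst (λ z →
      RunResult p s c (suc n) (iter (ustep p) (suc z) s) (true ∷ [])) (remaining-overflow c eq) finished
  where
  run : Run runLoop (runStore p s (suc n) m c []) (suc n * tickCost E + 1) (runStore p (ustep p s) 0 (suc n + m)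
        (finc c) (true ∷ []))
  run = r-weak (≤-trans (+-monoˡ-≤ (n * tickCost E + 1) (+-monoʳ-≤ 4 (+-monoʳ-≤ (simCost E) (+-monoˡ-≤ 3
        (*-monoˡ-≤ 8 c≤)))))
                 (≤-reflexive (sym (+-assoc (tickCost E) (n * tickCost E) 1))))
    (r-loop refl (r-pop1 refl (r-push refl r⨾ r-pop∅ refl
        (frame (0F ∷ 1F ∷ 2F ∷ 3F ∷ 4F ∷ 5F ∷ 6F ∷ []) (simulate-run E p s p≤ s≤) r⨾ frame (9F ∷ 1F ∷ 10F ∷ []) r)))
      (subst (λ z → Run runLoop (runStore p (ustep p s) n (suc m) (finc c) (true ∷ [])) (n * tickCost E + 1)
            (runStore p (ustep p s) 0 z (finc c) (true ∷ [])))
        (+-suc n m) (runLoop-done E n (suc m))))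
... | false | r with runLoop-run E p n (suc m) (ustep p s) (finc c) p≤ (≤-trans (ustep-state≤ p s) p≤) (≤-trans
      (≤-reflexive (length-finc c)) c≤)
... | s' , c' , done , r' , res = s' , c' , done , run , result res
  where
  run : Run runLoop (runStore p s (suc n) m c []) (suc n * tickCost E + 1) (runStore p s' 0 (suc n + m) c' done)
  run = r-weak (≤-trans (+-monoˡ-≤ (n * tickCost E + 1) (+-monoʳ-≤ 4 (+-monoʳ-≤ (simCost E) (+-monoˡ-≤ 3
        (*-monoˡ-≤ 8 c≤)))))
                 (≤-reflexive (sym (+-assoc (tickCost E) (n * tickCost E) 1))))
    (r-loop refl (r-pop1 refl (r-push refl r⨾ r-pop∅ refl
        (frame (0F ∷ 1F ∷ 2F ∷ 3F ∷ 4F ∷ 5F ∷ 6F ∷ []) (simulate-run E p s p≤ s≤) r⨾ frame (9F ∷ 1F ∷ 10F ∷ []) r)))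
      (subst (λ z → Run runLoop (runStore p (ustep p s) n (suc m) (finc c) []) (n * tickCost E + 1)
            (runStore p s' 0 z c' done)) (+-suc n m) r'))
  result : ∀ {s' done} → RunResult p (ustep p s) (finc c) n s' done → RunResult p s c (suc n) s' done
  result (timeout le) = timeout (≤-trans (s≤s le) (≤-reflexive (sym (remaining-finc c eq))))
  result finished = subst (λ z → RunResult p s c (suc n) (iter (ustep p) (suc z) s) (true ∷ []))
        (remaining-finc c eq) finished

-- The diagonal sets

-- A decision tree looks at a bounded number of cells, so judging an output takes constant time
-- however long the tape is.
data Tree : Set where
  leaf : Bool → Tree
  node : (Sym → Tree) → Tree

verdict : Tree → List Bool → Bool
verdict (leaf b) R = b
verdict (node k) R = verdict (k (topC R)) (restC R)

-- The stacks are: cells to be inspected, verdict.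
inspect : Tree → Cmd 2
inspect (leaf b) = push 1F b
inspect (node k) = readC 0F (λ a → inspect (k a))

inspectCost : Tree → ℕ
inspectCost (leaf b) = 1
inspectCost (node k) = 2 + (inspectCost (k blank) + (inspectCost (k b0) + inspectCost (k b1)))

inspect-run : ∀ t R → Σ (List Bool) λ R' → Run (inspect t) (R ∷ [] ∷ []) (inspectCost t) (R' ∷
      (verdict t R ∷ []) ∷ [])
inspect-run (leaf b) R = R , r-push refl
inspect-run (node k) R with inspect-run (k (topC R)) (restC R)
... | R' , r = R' , r-weak (s≤s (s≤s (branch≤ (topC R)))) (readC-run {k = λ a → inspect (k a)} R refl r)
  where
  branch≤ : ∀ a → inspectCost (k a) ≤ inspectCost (k blank) + (inspectCost (k b0) + inspectCost (k b1))
  branch≤ blank = m≤m+n _ _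
  branch≤ b0 = ≤-trans (m≤m+n _ _) (m≤n+m _ (inspectCost (k blank)))
  branch≤ b1 = ≤-trans (m≤n+m _ (inspectCost (k b0))) (m≤n+m _ (inspectCost (k blank)))

encC : List Sym → List Bool
encC [] = []
encC (a ∷ s) = putC a ++ encC s

-- The question put to the simulated machine at stage length n, and how its output is judged.
-- The generator uses the stacks: unary n, scratch, right half of the simulated tape.
record Query : Set where
  field
    input    : ℕ → Str
    tree     : Tree
    generate : Cmd 3
    slope intercept : ℕ
    generate-run : ∀ n → Run generate (ones n ∷ [] ∷ [] ∷ []) (n * slope + intercept) (ones n ∷ [] ∷ encC
          (symsOf (input n)) ∷ [])

-- Loops over a unary stack (0) through a scratch stack (1), restoring it.
eachOne : Cmd 3 → Cmd 3
eachOne body = while 0F (pop 0F skip (push 1F true ⨾ body) (push 1F true ⨾ body)) ⨾ rename (1F ∷ 0F ∷ []) pour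

ones-ʳ++ : ∀ n m → ones n ʳ++ ones m ≡ ones (n + m)
ones-ʳ++ zero m = refl
ones-ʳ++ (suc n) m = trans (ones-ʳ++ n (suc m)) (ones-+suc n m)

eachOne-run : ∀ {body t} (g : List Bool → List Bool) → (∀ {u v R} → Run body (u ∷ v ∷ R ∷ []) t (u ∷ v ∷ g R ∷ [])) →
  ∀ n R → Run (eachOne body) (ones n ∷ [] ∷ R ∷ []) (n * (t + 6) + 2) (ones n ∷ [] ∷ iter g n R ∷ [])
eachOne-run {body} {t} g r n R = subst (λ z → Run (eachOne body) (ones n ∷ [] ∷ R ∷ []) (n * (t + 6) + 2)
      (z ∷ [] ∷ iter g n R ∷ []))
    (trans (ones-ʳ++ (n + 0) 0) (cong ones (trans (+-identityʳ _) (+-identityʳ n))))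
  (r-weak (≤-reflexive (trans (cong (λ l → n * (t + 3) + 1 + (l * 3 + 1)) (trans (length-replicate (n + 0))
        (+-identityʳ n))) (cost n t)))
    (loop n 0 R r⨾ frame (1F ∷ 0F ∷ []) (pour-run (ones (n + 0)))))
  where
  cost : ∀ n t → n * (t + 3) + 1 + (n * 3 + 1) ≡ n * (t + 6) + 2
  cost = solve-∀
  loopCost : ∀ n t → suc (suc (suc t) + (n * (t + 3) + 1)) ≡ suc n * (t + 3) + 1
  loopCost = solve-∀
  loop : ∀ n m R → Run (while 0F (pop 0F skip (push 1F true ⨾ body) (push 1F true ⨾ body)))
        (ones n ∷ ones m ∷ R ∷ []) (n * (t + 3) + 1)
           ([] ∷ ones (n + m) ∷ iter g n R ∷ [])
  loop zero m R = r-stop refl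
  loop (suc n) m R = r-weak (≤-reflexive (loopCost n t)) (r-loop refl (r-pop1 refl (r-push refl r⨾ r))
    (subst (λ z → Run _ (ones n ∷ ones (suc m) ∷ g R ∷ []) _ ([] ∷ z ∷ iter g n (g R) ∷ [])) (ones-+suc n m)
          (loop n (suc m) (g R))))

iter-false : ∀ n m → iter (false ∷_) n (replicate m false) ≡ replicate (n + m) false
iter-false zero m = refl
iter-false (suc n) m = trans (iter-false n (suc m)) (cong (λ z → replicate z false) (+-suc n m))

m<2^m : ∀ m → m < 2 ^ m
m<2^m zero = s≤s z≤n
m<2^m (suc m) = ≤-trans (s≤s (m<2^m m)) (≤-trans (+-monoˡ-≤ (2 ^ m) (m^n>0 2 m)) (≤-reflexive (cong (2 ^ m +_)
      (sym (+-identityʳ (2 ^ m))))))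

-- The gap that pays for the selector: the length of a candidate at a later stage covers the full
-- clock of every earlier one.
tower-step : ∀ {i j} → i < j → 2 ^ tower i ≤ tower j
tower-step {i} {suc j} (s≤s i≤j) with m≤n⇒m<n∨m≡n i≤j
... | inj₁ i<j = ≤-trans (tower-step i<j) (<⇒≤ (m<2^m (tower j)))
... | inj₂ refl = ≤-refl

tower-< : ∀ {i j} → i < j → tower i < tower j
tower-< {i} i<j = <-≤-trans (m<2^m (tower i)) (tower-step i<j)

tower-injective : ∀ i j → tower i ≡ tower j → i ≡ j
tower-injective i j eq with <-cmp i j
... | tri< lt _ _ = ⊥-elim (<⇒≢ (tower-< lt) eq)
... | tri≈ _ e _ = e
... | tri> _ _ gt = ⊥-elim (<⇒≢ (tower-< gt) (sym eq))

candidate-injective : ∀ {b b' n n'} → candidate b n ≡ candidate b' n' → b ≡ b' × n ≡ n'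
candidate-injective {n = n} {n'} eq with ∷-injective (∷-injectiveʳ eq)
... | e , es = e , trans (sym (length-replicate n)) (trans (cong length es) (length-replicate n'))

pattern 11F = Fin.suc 10F
pattern 12F = Fin.suc 11F
pattern 13F = Fin.suc 12F
pattern 14F = Fin.suc 13F
pattern 15F = Fin.suc 14F
pattern 16F = Fin.suc 15F
pattern 17F = Fin.suc 16F

module Diagonal (Q : Query) where
  open Query Q

  start : ℕ → Conf
  start n = 0 , [] , encC (symsOf (input n))

  judge : Conf → Bool
  judge (_ , _ , R) = not (verdict tree R)

  -- The configuration is judged after a fixed number of steps whether or not the machine has
  -- halted, and `judge` negates. The stage thus contradicts the verdict on the program `index j`.
  decision : ℕ → Bool
  decision j = judge (iter (ustep (index j)) (2 ^ tower j) (start (tower j)))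

  A : Language
  A y = Σ ℕ λ j → y ≡ candidate (decision j) (tower j)

  A-decision : ∀ j {b} → A (candidate b (tower j)) → b ≡ decision j
  A-decision j (i , eq) = trans (proj₁ (candidate-injective eq)) (cong decision (sym (tower-injective j i (proj₂
        (candidate-injective eq)))))

  -- The stacks are: 0 scratch (candidate), 1 errors, 2 bit, 3 unary, 4 saved unary, 5 counter, 6 flag, 7 program,
  -- 8 work, 9 right, 10 left, 11 state, 12 fuel, 13 used fuel, 14 done.
  matchBit accept core : Cmd 15
  matchBit = rename (9F ∷ 6F ∷ []) (inspect tree) ⨾
    pop 6F skip (pop 2F skip skip (push 2F true ⨾ push 14F true)) (pop 2F skip (push 2F false ⨾ push 14F true) skip)
  accept = rename (4F ∷ 0F ∷ 5F ∷ []) (eachOne (push 2F false)) ⨾ rename (4F ∷ 0F ∷ 9F ∷ []) generate ⨾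
    rename (7F ∷ 0F ∷ 8F ∷ 9F ∷ 10F ∷ 11F ∷ 6F ∷ 12F ∷ 13F ∷ 5F ∷ 14F ∷ []) runLoop ⨾
    rename (13F ∷ 12F ∷ []) pour ⨾ pop 14F skip matchBit matchBit
  core = rename (0F ∷ 1F ∷ 2F ∷ 3F ∷ 4F ∷ 5F ∷ 6F ∷ 7F ∷ []) recognise ⨾ pop 1F accept skip skip

  matchCost : ℕ
  matchCost = inspectCost tree + 4

  acceptCost coreCost : ℕ → ℕ
  acceptCost N = (N * 7 + 2) + ((N * slope + intercept) + ((N * tickCost N + 1) + ((N * 3 + 1) + (1 + matchCost))))
  coreCost N = recogniseCost N + (1 + acceptCost N)

  coreStore : (bad B : List Bool) (m : ℕ) (c p : List Bool) → Conf → ℕ → List Bool → Store 15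
  coreStore bad B m c p (q , L , R) N done =
    [] ∷ bad ∷ B ∷ [] ∷ ones m ∷ c ∷ [] ∷ p ∷ [] ∷ R ∷ L ∷ ones q ∷ ones N ∷ [] ∷ done ∷ []

  -- Acceptance is definite, rejection is not: it leaves open a member whose clock exceeds the fuel
  -- N.
  data Verdict (N : ℕ) (y : Str) : (B : List Bool) (m : ℕ) → List Bool → Set where
    accepted : ∀ j → y ≡ candidate (decision j) (tower j) → Verdict N y (decision j ∷ []) (tower j) (true ∷ [])
    rejected : ∀ {B m} → (∀ j → y ≡ candidate (decision j) (tower j) → N < 2 ^ tower j) → Verdict N y B m []

  matchBit-run : ∀ b {bad m c p q L R N} → Σ (List Bool) λ R' →
    (b ≡ not (verdict tree R) → Run matchBit (coreStore bad (b ∷ []) m c p (q , L , R) N []) matchCost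
                                             (coreStore bad (b ∷ []) m c p (q , L , R') N (true ∷ [])))
    × (b ≢ not (verdict tree R) → Run matchBit (coreStore bad (b ∷ []) m c p (q , L , R) N []) matchCost
                                               (coreStore bad [] m c p (q , L , R') N []))
  matchBit-run b {R = R} with inspect-run tree R
  ... | R' , r with verdict tree R | b
  ... | false | true  = R' , (λ _ → frame (9F ∷ 6F ∷ []) r r⨾ r-pop0 refl (r-pop1 refl (r-push refl
        r⨾ r-push refl))) , (λ ne → ⊥-elim (ne refl))
  ... | true  | false = R' , (λ _ → frame (9F ∷ 6F ∷ []) r r⨾ r-pop1 refl (r-pop0 refl (r-push refl
        r⨾ r-push refl))) , (λ ne → ⊥-elim (ne refl))
  ... | false | false = R' , (λ ()) , (λ _ → r-weak (+-monoʳ-≤ (inspectCost tree) (n≤1+n 3)) (frame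
        (9F ∷ 6F ∷ []) r r⨾ r-pop0 refl (r-pop0 refl r-skip)))
  ... | true  | true  = R' , (λ ()) , (λ _ → r-weak (+-monoʳ-≤ (inspectCost tree) (n≤1+n 3)) (frame
        (9F ∷ 6F ∷ []) r r⨾ r-pop1 refl (r-pop1 refl r-skip)))

  accept-run : ∀ N j b → tower j ≤ N → length (index j) ≤ N →
    Σ (List Bool) λ B → Σ (List Bool) λ c → Σ Conf λ s → Σ (List Bool) λ done →
    Run accept (coreStore [] (b ∷ []) (tower j) [] (index j) (0 , [] , []) N []) (acceptCost N) (coreStore [] B
          (tower j) c (index j) s N done)
    × Verdict N (candidate b (tower j)) B (tower j) done
  -- T(j) zero bits make the clock overflow at tick 2^T(j), the number of steps in `decision`; the
  -- fuel is N.
  accept-run N j b n≤ p≤ with runLoop-run N (index j) N 0 (start (tower j)) (replicate (tower j) false) p≤ z≤n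
                                (≤-trans (≤-reflexive (length-replicate (tower j))) n≤)
  ... | s , c , done , r , res = finish s done r res
    where
    n = tower j
    p = index j
    counter : Run (eachOne (push 2F false)) (ones n ∷ [] ∷ [] ∷ []) (n * 7 + 2) (ones n ∷ [] ∷ replicate n false ∷ [])
    counter = subst (λ z → Run (eachOne (push 2F false)) (ones n ∷ [] ∷ [] ∷ []) (n * 7 + 2) (ones n ∷ [] ∷ z ∷ []))
      (trans (iter-false n 0) (cong (λ z → replicate z false) (+-identityʳ n))) (eachOne-run (false ∷_)
            (r-push {s = 2F} refl) n [])
    refuel : Run pour (ones (N + 0) ∷ [] ∷ []) (N * 3 + 1) ([] ∷ ones N ∷ [])
    refuel = subst (λ z → Run pour (ones (N + 0) ∷ [] ∷ []) (N * 3 + 1) ([] ∷ z ∷ []))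
      (trans (ones-ʳ++ (N + 0) 0) (cong ones (trans (+-identityʳ _) (+-identityʳ _))))
      (r-weak (≤-reflexive (cong (λ z → z * 3 + 1) (trans (length-replicate (N + 0)) (+-identityʳ N))))
            (pour-run (ones (N + 0))))
    Goal : (B : List Bool) (c : List Bool) (s : Conf) (done : List Bool) → Set
    Goal B c s done = Run accept (coreStore [] (b ∷ []) n [] p (0 , [] , []) N []) (acceptCost N)
          (coreStore [] B n c p s N done)
      × Verdict N (candidate b n) B n done
    prefix : ∀ s done → Run runLoop (runStore p (start n) N 0 (replicate n false) []) (N * tickCost N + 1)
          (runStore p s 0 (N + 0) c done) →
      ∀ {σ} → Run (pop 14F skip matchBit matchBit) (coreStore [] (b ∷ []) n c p s N done) (1 + matchCost) σ →
      Run accept (coreStore [] (b ∷ []) n [] p (0 , [] , []) N []) (acceptCost N) σ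
    prefix s done r r' =
      frame (4F ∷ 0F ∷ 5F ∷ []) (r-weak (+-monoˡ-≤ 2 (*-monoˡ-≤ 7 n≤)) counter)
      r⨾ frame (4F ∷ 0F ∷ 9F ∷ []) (r-weak (+-monoˡ-≤ intercept (*-monoˡ-≤ slope n≤)) (generate-run n))
      r⨾ frame (7F ∷ 0F ∷ 8F ∷ 9F ∷ 10F ∷ 11F ∷ 6F ∷ 12F ∷ 13F ∷ 5F ∷ 14F ∷ []) r
      r⨾ frame (13F ∷ 12F ∷ []) refuel
      r⨾ r'
    finish : ∀ s done → Run runLoop (runStore p (start n) N 0 (replicate n false) []) (N * tickCost N + 1)
          (runStore p s 0 (N + 0) c done) →
      RunResult p (start n) (replicate n false) N s done → Σ (List Bool) λ B → Σ (List Bool) λ c → Σ Conf λ s →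
            Σ (List Bool) λ done → Goal B c s done
    finish s _ r (timeout le) = b ∷ [] , c , s , [] ,
      prefix s [] r (r-weak (s≤s (≤-trans (s≤s z≤n) (m≤n+m 4 (inspectCost tree)))) (r-pop∅ refl r-skip)) ,
      rejected λ j' eq → subst (λ z → N < 2 ^ z) (proj₂ (candidate-injective eq)) (≤-trans (s≤s le) (≤-reflexive
            (remaining-zeros n)))
    finish _ _ r finished with matchBit-run b {[]} {n} {c} {p} {proj₁ s₁} {proj₁ (proj₂ s₁)} {proj₂
          (proj₂ s₁)} {N} | b Bool.≟ judge s₁
      where s₁ = iter (ustep p) (suc (remaining (replicate n false))) (start n)
    ... | R' , yes-run , no-run | yes eq = b ∷ [] , c , _ , true ∷ [] , prefix _ _ r (r-pop1 refl (yes-run eq)) ,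
            subst (λ z → Verdict N (candidate z n) (z ∷ []) n (true ∷ [])) (sym b≡) (accepted j refl)
      where
      b≡ : b ≡ decision j
      b≡ = trans eq (cong (λ z → judge (iter (ustep p) z (start n))) (remaining-zeros n))
    ... | R' , yes-run , no-run | no ne = [] , c , _ , [] , prefix _ _ r (r-pop1 refl (no-run ne)) ,
            rejected λ j' eq → ⊥-elim (ne (trans (A-decision j (j' , eq))
                     (cong (λ z → judge (iter (ustep p) z (start n))) (sym (remaining-zeros n)))))

  core-run : ∀ N y → length y ≤ N → Σ (List Bool) λ bad → Σ (List Bool) λ B → Σ ℕ λ m → Σ (List Bool) λ c →
        Σ (List Bool) λ p → Σ Conf λ s → Σ (List Bool) λ done →
    Run core (y ∷ [] ∷ [] ∷ [] ∷ [] ∷ [] ∷ [] ∷ [] ∷ [] ∷ [] ∷ [] ∷ [] ∷ ones N ∷ [] ∷ [] ∷ []) (coreCost N)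
          (coreStore bad B m c p s N done)
    × Verdict N y B m done
  core-run N y y≤ with recognise-run N y y≤
  ... | x ∷ bad , B , m , ix , r , m≤ , ix≤ , nostage none = bad , B , m , [] , ix , (0 , [] , []) , [] ,
        (frame (0F ∷ 1F ∷ 2F ∷ 3F ∷ 4F ∷ 5F ∷ 6F ∷ 7F ∷ []) r
              r⨾ r-weak (s≤s (≤-trans (s≤s z≤n) (≤-trans (m≤n+m 2 (N * 7)) (m≤m+n _ _)))) (drop-error x)) ,
        rejected (λ j eq → ⊥-elim (none j _ eq))
    where
    drop-error : ∀ x → Run (pop 1F accept skip skip) (coreStore (x ∷ bad) B m [] ix (0 , [] , []) N []) 2
          (coreStore bad B m [] ix (0 , [] , []) N [])
    drop-error false = r-pop0 refl r-skip
    drop-error true = r-pop1 refl r-skip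
  ... | _ , _ , _ , _ , r , m≤ , ix≤ , stage j b refl with accept-run N j b m≤ ix≤
  ... | B , c , s , done , r' , v = [] , B , tower j , c , index j , s , done ,
        (frame (0F ∷ 1F ∷ 2F ∷ 3F ∷ 4F ∷ 5F ∷ 6F ∷ 7F ∷ []) r r⨾ r-pop∅ refl r') , v

-- The selector

linear : ∀ a b → Poly (λ n → n * a + b)
linear a b = poly-id ⊗ poly-const a ⊕ poly-const b

poly-recogniseCost : Poly recogniseCost
poly-recogniseCost = linear 5 4 ⊕ (poly-id ⊗ round ⊕ poly-const 1)
  where
  round : Poly roundCost
  round = poly-const 1 ⊕ poly-const 2 ⊕ (poly-id ⊗ linear 8 10 ⊕ poly-const 1) ⊕ linear 4 1 ⊕ linear 8 8

choose : {X : Set} → Bool → X → X → X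
choose b x y = if b then x else y

-- The stacks are: output, unary n, bit.
printOnes : Cmd 3
printOnes = while 1F (pop 1F skip (push 0F true ⨾ push 0F true) (push 0F true ⨾ push 0F true))

print : Bool → Cmd 3
print b = push 0F true ⨾ push 0F true ⨾ push 0F b ⨾ push 0F b ⨾ printOnes ⨾ push 0F false ⨾ push 0F true

emit : Cmd 3
emit = pop 2F skip (print false) (print true)

printOnes-run : ∀ m io {B} → Run printOnes (io ∷ ones m ∷ B ∷ []) (m * 4 + 1) ((dbl (ones m) ʳ++ io) ∷ [] ∷ B ∷ [])
printOnes-run zero io = r-stop refl
printOnes-run (suc m) io = r-loop refl (r-pop1 refl (r-push refl r⨾ r-push refl)) (printOnes-run m (true ∷ true ∷ io))

print-run : ∀ b m io → Run (print b) (io ∷ ones m ∷ [] ∷ []) (m * 4 + 7) ((enc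
      (candidate b m ∷ []) ʳ++ io) ∷ [] ∷ [] ∷ [])
print-run b m io = subst (λ z → Run (print b) (io ∷ ones m ∷ [] ∷ []) (m * 4 + 7) (z ∷ [] ∷ [] ∷ [])) (sym
      (++-ʳ++ (dbl (ones m))))
  (r-weak (≤-reflexive (cost m)) (r-push refl r⨾ r-push refl r⨾ r-push refl r⨾ r-push refl
        r⨾ printOnes-run m _ r⨾ r-push refl r⨾ r-push refl))
  where
  cost : ∀ m → 1 + (1 + (1 + (1 + ((m * 4 + 1) + 2)))) ≡ m * 4 + 7
  cost = solve-∀

emit-run : ∀ b m io → Run emit (io ∷ ones m ∷ (b ∷ []) ∷ []) (m * 4 + 8) ((enc
      (candidate b m ∷ []) ʳ++ io) ∷ [] ∷ [] ∷ [])
emit-run false m io = r-weak (≤-reflexive (sym (+-suc (m * 4) 7))) (r-pop0 refl (print-run false m io))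
emit-run true m io = r-weak (≤-reflexive (sym (+-suc (m * 4) 7))) (r-pop1 refl (print-run true m io))

-- `FP` asks for a value on every string, so text that is no encoding is treated as well: a pair 10
-- is skipped, a last odd bit and an unterminated word are dropped.
select : (Str → Bool) → Str → Str → Str
select d [] Y = []
select d (a ∷ []) Y = []
select d (false ∷ false ∷ X) Y = select d X (false ∷ Y)
select d (true ∷ true ∷ X) Y = select d X (true ∷ Y)
select d (true ∷ false ∷ X) Y = select d X Y
select d (false ∷ true ∷ X) Y = choose (d (reverse Y)) (enc (reverse Y ∷ [])) [] ++ select d X []

select-dbl : ∀ d y r Y → select d (dbl y ++ r) Y ≡ select d r (y ʳ++ Y)
select-dbl d [] r Y = refl
select-dbl d (false ∷ y) r Y = select-dbl d y r (false ∷ Y)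
select-dbl d (true ∷ y) r Y = select-dbl d y r (true ∷ Y)

select-enc : ∀ d ys → select d (enc ys) [] ≡ enc (filterᵇ d ys)
select-enc d [] = refl
select-enc d (y ∷ ys) rewrite select-dbl d y (false ∷ true ∷ enc ys) [] | reverse-involutive y | select-enc d ys
      with d y
... | true = ++-assoc (dbl y) (false ∷ true ∷ []) _
... | false = refl

dec-enc : ∀ ys → dec (enc ys) ≡ just ys
dec-enc [] = refl
dec-enc (y ∷ ys) = one y
  where
  one : ∀ y → dec (dbl y ++ false ∷ true ∷ enc ys) ≡ just (y ∷ ys)
  one [] rewrite dec-enc ys = refl
  one (false ∷ y) rewrite one y = refl
  one (true ∷ y) rewrite one y = refl

module Selector (Q : Query) where
  open Query Q
  open Diagonal Q

  tidy core+tidy : Cmd 15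
  tidy = rename (1F ∷ []) clear ⨾ rename (5F ∷ []) clear ⨾ rename (7F ∷ []) clear ⨾ rename (9F ∷ []) clear
         ⨾ rename (10F ∷ []) clear ⨾ rename (11F ∷ []) clear
  core+tidy = core ⨾ tidy

  -- Bounds the total length of the stacks after 'core'.
  bulk clearCost tidyCost : ℕ → ℕ
  bulk N = (N + (N + 0)) + coreCost N
  clearCost N = bulk N * 3 + 1
  tidyCost N = coreCost N + (clearCost N + (clearCost N + (clearCost N + (clearCost N +
        (clearCost N + clearCost N)))))

  candidateStore : Str → ℕ → Store 15
  candidateStore y N = y ∷ [] ∷ [] ∷ [] ∷ [] ∷ [] ∷ [] ∷ [] ∷ [] ∷ [] ∷ [] ∷ [] ∷ ones N ∷ [] ∷ [] ∷ []

  -- The stacks must be emptied before the next candidate. Their contents need no analysis, as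
  -- `total-run` bounds whatever `core` leaves behind.
  tidy-run : ∀ N y → length y ≤ N → Σ (List Bool) λ B → Σ ℕ λ m → Σ (List Bool) λ done →
    Run core+tidy (candidateStore y N) (tidyCost N) (coreStore [] B m [] [] (0 , [] , []) N done)
    × length B ≤ bulk N × m ≤ bulk N × Verdict N y B m done
  tidy-run N y y≤ = finish (core-run N y y≤)
    where
    clear≤ : ∀ xs → length xs ≤ bulk N → Run clear (xs ∷ []) (clearCost N) ([] ∷ [])
    clear≤ xs le = r-weak (+-monoˡ-≤ 1 (*-monoˡ-≤ 3 le)) (clear-run xs)
    finish : (Σ (List Bool) λ bad → Σ (List Bool) λ B → Σ ℕ λ m → Σ (List Bool) λ c → Σ (List Bool) λ p →
          Σ Conf λ s → Σ (List Bool) λ done →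
        Run core (candidateStore y N) (coreCost N) (coreStore bad B m c p s N done) × Verdict N y B m done) →
      Σ (List Bool) λ B → Σ ℕ λ m → Σ (List Bool) λ done →
        Run core+tidy (candidateStore y N) (tidyCost N) (coreStore [] B m [] [] (0 , [] , []) N done)
        × length B ≤ bulk N × m ≤ bulk N × Verdict N y B m done
    finish (bad , B , m , c , p , s@(q , L , R) , done , r , v) = B , m , done ,
        (r r⨾ frame (1F ∷ []) (clear≤ bad (fits 1F)) r⨾ frame (5F ∷ []) (clear≤ c (fits 5F))
              r⨾ frame (7F ∷ []) (clear≤ p (fits 7F))
           r⨾ frame (9F ∷ []) (clear≤ R (fits 9F)) r⨾ frame (10F ∷ []) (clear≤ L (fits 10F))
                 r⨾ frame (11F ∷ []) (clear≤ (ones q) (fits 11F))) ,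
        fits 2F , ≤-trans (≤-reflexive (sym (length-replicate m))) (fits 4F) , v
      where
      fits : ∀ i → length (lookup (coreStore bad B m c p s N done) i) ≤ bulk N
      fits i = ≤-trans (length-lookup≤ (coreStore bad B m c p s N done) i)
        (≤-trans (total-run r) (+-monoˡ-≤ (coreCost N) (+-mono-≤ y≤ (≤-reflexive (cong (_+ 0)
              (length-replicate N))))))

  decide : Cmd 16
  decide = rename (0F ∷ 1F ∷ 2F ∷ 3F ∷ 4F ∷ 5F ∷ 6F ∷ 7F ∷ 8F ∷ 9F ∷ 10F ∷ 11F ∷ 12F ∷ 13F ∷ 14F ∷ []) core+tidy
    ⨾ pop 14F (rename (4F ∷ []) clear ⨾ rename (2F ∷ []) clear) printed printed
    where
    printed : Cmd 16
    printed = rename (15F ∷ 4F ∷ 2F ∷ []) emit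

  decideStore : Str → ℕ → Str → Store 16
  decideStore y N io = y ∷ [] ∷ [] ∷ [] ∷ [] ∷ [] ∷ [] ∷ [] ∷ [] ∷ [] ∷ [] ∷ [] ∷ ones N ∷ [] ∷ [] ∷ io ∷ []

  decideCost : ℕ → ℕ
  decideCost N = tidyCost N + (1 + (bulk N * 6 + 8))

  -- The Boolean is fixed before `io`, so it depends on N and y alone, and `select` can use it as a
  -- predicate.
  Decided : ℕ → Str → Bool → Set
  Decided N y d =
    (∀ io → Run decide (decideStore y N io) (decideCost N) (decideStore [] N (choose d (enc (y ∷ [])) [] ʳ++ io)))
    × (d ≡ true → A y) × (∀ j → y ≡ candidate (decision j) (tower j) → 2 ^ tower j ≤ N → d ≡ true)

  conclude : ∀ {N y B m done} → Run core+tidy (candidateStore y N) (tidyCost N) (coreStore [] B m [] []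
        (0 , [] , []) N done) →
    length B ≤ bulk N → m ≤ bulk N → Verdict N y B m done → Σ Bool (Decided N y)
  conclude {N} r B≤ m≤ (accepted j refl) = true , run , (λ _ → j , refl) , (λ _ _ _ → refl)
    where
    run : ∀ io → Run decide (decideStore (candidate (decision j) (tower j)) N io) (decideCost N)
                   (decideStore [] N (enc (candidate (decision j) (tower j) ∷ []) ʳ++ io))
    run io = frame (0F ∷ 1F ∷ 2F ∷ 3F ∷ 4F ∷ 5F ∷ 6F ∷ 7F ∷ 8F ∷ 9F ∷ 10F ∷ 11F ∷ 12F ∷ 13F ∷ 14F ∷ []) r
      r⨾ r-pop1 refl (r-weak (+-monoˡ-≤ 8 (*-mono-≤ m≤ (≤-trans (n≤1+n 4) (n≤1+n 5))))
           (frame (15F ∷ 4F ∷ 2F ∷ []) (emit-run (decision j) (tower j) io)))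
  conclude {N} {y} {B} {m} r B≤ m≤ (rejected late) = false , run , (λ ()) , (λ j eq le → ⊥-elim (<⇒≱ (late j eq) le))
    where
    cost : ∀ k → ((k * 3 + 1) + (k * 3 + 1)) + 6 ≡ k * 6 + 8
    cost = solve-∀
    run : ∀ io → Run decide (decideStore y N io) (decideCost N) (decideStore [] N io)
    run io = frame (0F ∷ 1F ∷ 2F ∷ 3F ∷ 4F ∷ 5F ∷ 6F ∷ 7F ∷ 8F ∷ 9F ∷ 10F ∷ 11F ∷ 12F ∷ 13F ∷ 14F ∷ []) r
      r⨾ r-pop∅ refl (r-weak (≤-trans (+-mono-≤ (+-monoˡ-≤ 1 (*-monoˡ-≤ 3 (≤-trans (≤-reflexive
            (length-replicate m)) m≤))) (+-monoˡ-≤ 1 (*-monoˡ-≤ 3 B≤)))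
                                (≤-by 6 (cost (bulk N))))
           (frame (4F ∷ []) (clear-run (ones m)) r⨾ frame (2F ∷ []) (clear-run B)))

  decide-run : ∀ N y → length y ≤ N → Σ Bool (Decided N y)
  decide-run N y y≤ = let (_ , _ , _ , r , B≤ , m≤ , v) = tidy-run N y y≤ in conclude r B≤ m≤ v

  -- The default `false` is never consulted: a word parsed from an input of length N is no longer
  -- than N.
  confirmed : ℕ → Str → Bool
  confirmed N y with length y ≤? N
  ... | yes y≤ = proj₁ (decide-run N y y≤)
  ... | no _ = false

  confirmed-decided : ∀ N y → length y ≤ N → Decided N y (confirmed N y)
  confirmed-decided N y le with length y ≤? N
  ... | yes y≤ = proj₂ (decide-run N y y≤)
  ... | no y≰ = ⊥-elim (y≰ le)

  -- The stacks are: input and output, unread input, current string, then those of 'core'.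
  load process parse selector : Cmd 18
  load = while 0F (pop 0F skip (push 1F false ⨾ push 15F true) (push 1F true ⨾ push 15F true))
  process = rename (2F ∷ 3F ∷ []) pour ⨾
    rename (3F ∷ 4F ∷ 5F ∷ 6F ∷ 7F ∷ 8F ∷ 9F ∷ 10F ∷ 11F ∷ 12F ∷ 13F ∷ 14F ∷ 15F ∷ 16F ∷ 17F ∷ 0F ∷ []) decide
  parse = while 1F (pop 1F skip (pop 1F skip (push 2F false) process) (pop 1F skip skip (push 2F true)))
  selector = load ⨾ parse

  selectStore : Str → Str → Str → ℕ → Store 18
  selectStore io X Y N = io ∷ X ∷ Y ∷ candidateStore [] N

  -- Besides undoing the reversal of the initial stack, loading counts the input length in unary;
  -- this is the fuel of all simulations.
  load-run : ∀ xs {X N} → Run load (selectStore xs X [] N) (length xs * 4 + 1) (selectStore [] (xs ʳ++ X) []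
        (length xs + N))
  load-run [] = r-stop refl
  load-run (x ∷ xs) {X} {N} = subst (λ z → Run load (selectStore (x ∷ xs) X [] N) (suc (length xs) * 4 + 1)
        (selectStore [] (xs ʳ++ (x ∷ X)) [] z)) (+-suc (length xs) N)
    (r-loop refl (first x) (load-run xs))
    where
    first : ∀ x → Run (pop 0F skip (push 1F false ⨾ push 15F true) (push 1F true ⨾ push 15F true))
              (selectStore (x ∷ xs) X [] N) 3 (selectStore xs (x ∷ X) [] (suc N))
    first false = r-pop0 refl (r-push refl r⨾ r-push refl)
    first true = r-pop1 refl (r-push refl r⨾ r-push refl)

  processCost : ℕ → ℕ
  processCost N = (N * 3 + 1) + decideCost N

  process-run : ∀ N Y {io X} → length Y ≤ N →
    Run process (selectStore io X Y N) (processCost N) (selectStore (choose (confirmed N (reverse Y)) (enc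
          (reverse Y ∷ [])) [] ʳ++ io) X [] N)
  process-run N Y {io} {X} Y≤ = r-weak (+-monoˡ-≤ 1 (*-monoˡ-≤ 3 Y≤)) (frame (2F ∷ 3F ∷ []) (pour-run Y))
    r⨾ frame (3F ∷ 4F ∷ 5F ∷ 6F ∷ 7F ∷ 8F ∷ 9F ∷ 10F ∷ 11F ∷ 12F ∷ 13F ∷ 14F ∷ 15F ∷ 16F ∷ 17F ∷ 0F ∷ [])
         (proj₁ (confirmed-decided N (reverse Y) (≤-trans (≤-reflexive (length-reverse Y)) Y≤)) io)

  parseCost : ℕ → ℕ
  parseCost N = processCost N + 3

  parse-cost : ∀ p l {x} → x ≤ p → suc (suc (suc x) + (l * (p + 3) + 1)) ≤ suc (suc l) * (p + 3) + 1
  parse-cost p l {x} x≤ = ≤-trans (+-monoˡ-≤ (l * (p + 3) + 1) (s≤s (s≤s (s≤s x≤)))) (≤-by (p + 3) (cost p l))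
    where
    cost : ∀ p l → suc (suc (suc p)) + (l * (p + 3) + 1) + (p + 3) ≡ suc (suc l) * (p + 3) + 1
    cost = solve-∀

  1≤processCost : ∀ N → 1 ≤ processCost N
  1≤processCost N = ≤-trans (m≤n+m 1 (N * 3)) (m≤m+n _ _)

  odd-cost : ∀ N → 5 ≤ 1 * parseCost N + 1
  odd-cost N = ≤-trans (+-monoˡ-≤ 1 (+-monoˡ-≤ 3 (1≤processCost N))) (+-monoˡ-≤ 1 (≤-reflexive (sym (*-identityˡ
        (parseCost N)))))

  shift-length : ∀ {N m} (X : Str) → suc (suc (length X)) + m ≤ N → length X + suc m ≤ N
  shift-length {m = m} X le = ≤-trans (≤-reflexive (+-suc (length X) m)) (≤-trans (n≤1+n _) le)

  parse-run : ∀ N X Y io → length X + length Y ≤ N → Σ Str λ Y' →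
    Run parse (selectStore io X Y N) (length X * parseCost N + 1) (selectStore (select
          (confirmed N) X Y ʳ++ io) [] Y' N)
  parse-run N [] Y io le = Y , r-stop refl
  parse-run N (false ∷ []) Y io le = Y , r-weak (odd-cost N) (r-loop refl (r-pop0 refl (r-pop∅ refl r-skip))
        (r-stop refl))
  parse-run N (true ∷ []) Y io le = Y , r-weak (odd-cost N) (r-loop refl (r-pop1 refl (r-pop∅ refl r-skip))
        (r-stop refl))
  parse-run N (false ∷ false ∷ X) Y io le =
    let (Y' , r) = parse-run N X (false ∷ Y) io (shift-length X le)
    in Y' , r-weak (parse-cost (processCost N) (length X) (1≤processCost N)) (r-loop refl (r-pop0 refl
          (r-pop0 refl (r-push refl))) r)
  parse-run N (true ∷ true ∷ X) Y io le =
    let (Y' , r) = parse-run N X (true ∷ Y) io (shift-length X le)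
    in Y' , r-weak (parse-cost (processCost N) (length X) (1≤processCost N)) (r-loop refl (r-pop1 refl
          (r-pop1 refl (r-push refl))) r)
  parse-run N (true ∷ false ∷ X) Y io le =
    let (Y' , r) = parse-run N X Y io (≤-trans (≤-trans (n≤1+n _) (n≤1+n _)) le)
    in Y' , r-weak (parse-cost (processCost N) (length X) (1≤processCost N)) (r-loop refl (r-pop1 refl
          (r-pop0 refl r-skip)) r)
  parse-run N (false ∷ true ∷ X) Y io le =
    let out = choose (confirmed N (reverse Y)) (enc (reverse Y ∷ [])) []
        (Y' , r) = parse-run N X [] (out ʳ++ io) (≤-trans (+-monoʳ-≤ (length X) z≤n) (≤-trans (≤-trans (n≤1+n _)
              (n≤1+n _)) le))
    in Y' , subst (λ z → Run parse (selectStore io (false ∷ true ∷ X) Y N) (length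
          (false ∷ true ∷ X) * parseCost N + 1) (selectStore z [] Y' N))
              (sym (++-ʳ++ out))
              (r-weak (parse-cost (processCost N) (length X) ≤-refl)
                (r-loop refl (r-pop0 refl (r-pop1 refl (process-run N Y (≤-trans (m≤n+m _ _) le)))) r))

  selectorCost : ℕ → ℕ
  selectorCost N = (N * 4 + 1) + (N * parseCost N + 1)

  selected : Str → Str
  selected x = select (confirmed (length x)) x []

  selector-run : ∀ x → Σ (Store 18) λ σ → Run selector (Compile.initStore 16 x) (selectorCost (length x)) σ ×
        reverse (Vec.head σ) ≡ selected x
  selector-run x =
    let N = length x
        (Y' , r) = parse-run N x [] [] (≤-reflexive (+-identityʳ N))
    in selectStore (select (confirmed N) x [] ʳ++ []) [] Y' N ,
       (subst₂ (λ t X → Run load (selectStore (reverse x) [] [] 0) t (selectStore [] X [] N)) (cong (λ z →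
             z * 4 + 1) (length-reverse x)) (reverse-involutive x)
         (subst (λ n → Run load (selectStore (reverse x) [] [] 0) (length (reverse x) * 4 + 1) (selectStore []
               (reverse x ʳ++ []) [] n))
           (trans (+-identityʳ _) (length-reverse x)) (load-run (reverse x)))
        r⨾ r) ,
       reverse-involutive _

  poly-selectorCost : Poly selectorCost
  poly-selectorCost = linear 4 1 ⊕ (poly-id ⊗ (poly-process ⊕ poly-const 3) ⊕ poly-const 1)
    where
    poly-sim : Poly simCost
    poly-sim = linear 7 2 ⊕ poly-const 4 ⊕ ((poly-const 2 ⊕ poly-id) ⊗ linear 5 14 ⊕ poly-const 1) ⊕ poly-const 4
          ⊕ poly-const 6 ⊕ linear 5 6 ⊕ linear 3 1
    poly-tick : Poly tickCost
    poly-tick = poly-const 4 ⊕ poly-sim ⊕ linear 8 3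
    poly-core : Poly coreCost
    poly-core = poly-recogniseCost ⊕ poly-const 1 ⊕ linear 7 2 ⊕ linear slope intercept ⊕
          (poly-id ⊗ poly-tick ⊕ poly-const 1) ⊕ linear 3 1 ⊕ poly-const 1 ⊕ poly-const matchCost
    poly-bulk : Poly bulk
    poly-bulk = (poly-id ⊕ (poly-id ⊕ poly-const 0)) ⊕ poly-core
    poly-clear : Poly clearCost
    poly-clear = poly-bulk ⊗ poly-const 3 ⊕ poly-const 1
    poly-decide : Poly decideCost
    poly-decide = (poly-core ⊕ poly-clear ⊕ poly-clear ⊕ poly-clear ⊕ poly-clear ⊕ poly-clear ⊕ poly-clear) ⊕
          poly-const 1 ⊕ (poly-bulk ⊗ poly-const 6 ⊕ poly-const 8)
    poly-process : Poly processCost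
    poly-process = linear 3 1 ⊕ poly-decide

  FP-selected : FP selected
  FP-selected = Compile.FP-intro 16 selector selected selectorCost selector-run poly-selectorCost

-- Membership in S(k) and the reduction to the complement

<lex-trans : ∀ {x y z} → x <lex y → y <lex z → x <lex z
<lex-trans []<∷ here = []<∷
<lex-trans []<∷ (there _) = []<∷
<lex-trans here (there _) = here
<lex-trans (there _) here = here
<lex-trans (there p) (there q) = there (<lex-trans p q)

<lex-irrefl : ∀ {x} → ¬ x <lex x
<lex-irrefl (there p) = <lex-irrefl p

<std-trans : ∀ {x y z} → x <std y → y <std z → x <std z
<std-trans (inj₁ p) (inj₁ q) = inj₁ (<-trans p q)
<std-trans (inj₁ p) (inj₂ (e , _)) = inj₁ (≤-trans p (≤-reflexive e))
<std-trans (inj₂ (e , _)) (inj₁ q) = inj₁ (≤-trans (s≤s (≤-reflexive e)) q)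
<std-trans (inj₂ (e , p)) (inj₂ (e' , q)) = inj₂ (trans e e' , <lex-trans p q)

<std-irrefl : ∀ {x} → ¬ x <std x
<std-irrefl (inj₁ p) = <-irrefl refl p
<std-irrefl (inj₂ (_ , p)) = <lex-irrefl p

first-two-differ : ∀ {ys z z' zs} → Linked _<std_ ys → z ∷ z' ∷ zs ⊆ ys → z ≢ z'
first-two-differ link = differ (Linked⇒AllPairs <std-trans link)
  where
  differ : ∀ {ys z z' zs} → AllPairs _<std_ ys → z ∷ z' ∷ zs ⊆ ys → z ≢ z'
  differ (_ ∷ ps) (_ ∷ʳ sub) = differ ps sub
  differ (p ∷ ps) (refl ∷ sub) refl = <std-irrefl (All.lookup p (Any-resp-⊆ sub (here refl)))

length-enc : ∀ {y ys} → y ∈ ys → length y ≤ length (enc ys)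
length-enc {y} {_ ∷ ys} (here refl) = ≤-trans (length-dbl y) (≤-trans (m≤m+n _ _) (≤-reflexive (sym (length-++
      (dbl y)))))
  where
  length-dbl : ∀ y → length y ≤ length (dbl y)
  length-dbl [] = z≤n
  length-dbl (b ∷ y) = s≤s (m≤n⇒m≤1+n (length-dbl y))
length-enc {y} {y' ∷ ys} (there i) = ≤-trans (≤-trans (length-enc i) (≤-trans (n≤1+n _) (n≤1+n _)))
  (≤-trans (m≤n+m _ (length (dbl y'))) (≤-reflexive (sym (length-++ (dbl y')))))

filterᵇ-All : ∀ {P : Str → Set} d ys → (∀ {y} → y ∈ ys → d y ≡ true → P y) → All P (filterᵇ d ys)
filterᵇ-All d [] h = []
filterᵇ-All d (y ∷ ys) h with d y in eq
... | true = h (here refl) eq ∷ filterᵇ-All d ys (h ∘ there)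
... | false = filterᵇ-All d ys (h ∘ there)

filterᵇ-nonempty : ∀ (d : Str → Bool) {ys y} → y ∈ ys → d y ≡ true → 1 ≤ length (filterᵇ d ys)
filterᵇ-nonempty d {y ∷ ys} (here refl) eq rewrite eq = s≤s z≤n
filterᵇ-nonempty d {y ∷ ys} (there i) eq with d y
... | true = s≤s z≤n
... | false = filterᵇ-nonempty d i eq

module Diagonal-S (Q : Query) where
  open Diagonal Q
  open Selector Q

  length-stage : ∀ j → tower j ≤ length (candidate (decision j) (tower j))
  length-stage j = ≤-trans (≤-reflexive (sym (length-replicate (tower j)))) (m≤n+m _ 2)

  -- Of two members, the one at the smaller stage is confirmed within the length of the other.
  two-members : ∀ {ys z z'} → z ∈ ys → z' ∈ ys → z ≢ z' → A z → A z' →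
        1 ≤ length (filterᵇ (confirmed (length (enc ys))) ys)
  two-members {ys} z∈ z'∈ ne (i , refl) (j , refl) with <-cmp i j
  ... | tri≈ _ refl _ = ⊥-elim (ne refl)
  ... | tri< i<j _ _ = filterᵇ-nonempty _ z∈ (proj₂ (proj₂ (confirmed-decided (length (enc ys)) _
        (length-enc z∈))) i refl
          (≤-trans (tower-step i<j) (≤-trans (length-stage j) (length-enc z'∈))))
  ... | tri> _ _ j<i = filterᵇ-nonempty _ z'∈ (proj₂ (proj₂ (confirmed-decided (length (enc ys)) _
        (length-enc z'∈))) j refl
          (≤-trans (tower-step j<i) (≤-trans (length-stage i) (length-enc z∈))))

  -- Confirmed strings always lie in `A`, so filtering by `confirmed` is sound; two of the k members
  -- already make the result nonempty.
  S-A : ∀ k → 2 ≤ k → SClass k A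
  S-A k 2≤k = selected , FP-selected , lift select-ok
    where
    select-ok : ∀ ys → 1 ≤ length ys → Linked _<std_ ys → Σ (List Str) λ zs → SelOut selected ys zs × All (_∈ ys) zs ×
                  (AtLeastIn k A ys → All A zs × 1 ≤ length zs)
    select-ok ys _ link = filterᵇ d ys , trans (cong dec (select-enc d ys)) (dec-enc (filterᵇ d ys)) ,
        filterᵇ-All d ys (λ i _ → i) ,
        λ { (zs , sub , len , members) → filterᵇ-All d ys (λ i eq →
              proj₁ (proj₂ (confirmed-decided N _ (length-enc i))) eq) ,
                                         nonempty zs sub (≤-trans 2≤k (≤-reflexive (sym len))) members }
      where
      N = length (enc ys)
      d = confirmed N
      nonempty : ∀ zs → zs ⊆ ys → 2 ≤ length zs → All A zs → 1 ≤ length (filterᵇ d ys)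
      nonempty (z ∷ []) sub (s≤s ()) _
      nonempty (z ∷ z' ∷ zs) sub _ (p ∷ p' ∷ _) =
        two-members (Any-resp-⊆ sub (here refl)) (Any-resp-⊆ sub (there (here refl))) (first-two-differ link sub) p p'

  -- The stacks are: input and output, then those of 'recognise'.
  flip : Cmd 9
  flip = rename (0F ∷ 1F ∷ []) pour ⨾ rename (1F ∷ 2F ∷ 3F ∷ 4F ∷ 5F ∷ 6F ∷ 7F ∷ 8F ∷ []) recognise ⨾
    pop 2F (push 0F true ⨾ pop 3F skip (push 0F true) (push 0F false) ⨾ while 5F (pop 5F skip (push 0F true)
          (push 0F true)))
           (push 0F true ⨾ push 0F true) (push 0F true ⨾ push 0F true)

  flipCost : ℕ → ℕ
  flipCost N = (N * 3 + 1) + (recogniseCost N + (1 + (3 + (N * 3 + 1))))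

  data Flipped (x : Str) : Str → Set where
    flipped : ∀ j b → x ≡ candidate b (tower j) → Flipped x (candidate (not b) (tower j))
    invalid : (∀ j b → x ≢ candidate b (tower j)) → Flipped x (candidate true 0)

  flip-run : ∀ x → Σ Str λ y → Flipped x y × Σ (Store 9) λ σ → Run flip (Compile.initStore 7 x) (flipCost
        (length x)) σ × reverse (Vec.head σ) ≡ y
  flip-run x = finish (recognise-run N x ≤-refl)
    where
    N = length x
    σ₀ : (io T bad B M ix : List Bool) → Store 9
    σ₀ io T bad B M ix = io ∷ T ∷ bad ∷ B ∷ [] ∷ M ∷ [] ∷ [] ∷ ix ∷ []
    loaded : Run (rename (0F ∷ 1F ∷ []) pour) (Compile.initStore 7 x) (N * 3 + 1) (σ₀ [] x [] [] [] [])
    loaded = subst₂ (λ t X → Run (rename (0F ∷ 1F ∷ []) pour) (Compile.initStore 7 x) t (σ₀ [] X [] [] [] []))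
      (cong (λ z → z * 3 + 1) (length-reverse x)) (reverse-involutive x) (frame (0F ∷ 1F ∷ []) (pour-run (reverse x)))
    tail-run : ∀ m io {ix} → Run (while 5F (pop 5F skip (push 0F true) (push 0F true))) (σ₀ io [] [] []
          (ones m) ix) (m * 3 + 1) (σ₀ (ones m ʳ++ io) [] [] [] [] ix)
    tail-run zero io = r-stop refl
    tail-run (suc m) io = r-loop refl (r-pop1 refl (r-push refl)) (tail-run m (true ∷ io))
    bit-run : ∀ b {M ix} → Run (pop 3F skip (push 0F true) (push 0F false)) (σ₀ (true ∷ []) [] []
          (b ∷ []) M ix) 2 (σ₀ (not b ∷ true ∷ []) [] [] [] M ix)
    bit-run false = r-pop0 refl (r-push refl)
    bit-run true = r-pop1 refl (r-push refl)
    error-run : ∀ e {bad B M ix} → Run (pop 2F (push 0F true ⨾ pop 3F skip (push 0F true)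
          (push 0F false) ⨾ while 5F (pop 5F skip (push 0F true) (push 0F true)))
           (push 0F true ⨾ push 0F true) (push 0F true ⨾ push 0F true)) (σ₀ [] [] (e ∷ bad) B M ix) 3 (σ₀
                 (true ∷ true ∷ []) [] bad B M ix)
    error-run false = r-pop0 refl (r-push refl r⨾ r-push refl)
    error-run true = r-pop1 refl (r-push refl r⨾ r-push refl)
    finish : (Σ (List Bool) λ bad → Σ (List Bool) λ B → Σ ℕ λ m → Σ (List Bool) λ ix →
        Run recognise (x ∷ [] ∷ [] ∷ [] ∷ [] ∷ [] ∷ [] ∷ [] ∷ []) (recogniseCost N)
              ([] ∷ bad ∷ B ∷ [] ∷ ones m ∷ [] ∷ [] ∷ ix ∷ [])
        × m ≤ N × length ix ≤ N × Recognised x bad B m ix) →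
      Σ Str λ y → Flipped x y × Σ (Store 9) λ σ → Run flip (Compile.initStore 7 x) (flipCost N) σ ×
            reverse (Vec.head σ) ≡ y
    finish (_ , _ , _ , _ , r , m≤ , _ , stage j b eq) = candidate (not b) (tower j) , flipped j b eq , _ ,
      (loaded r⨾ frame (1F ∷ 2F ∷ 3F ∷ 4F ∷ 5F ∷ 6F ∷ 7F ∷ 8F ∷ []) r
        r⨾ r-pop∅ refl (r-push refl r⨾ bit-run b r⨾ r-weak (+-monoˡ-≤ 1 (*-monoˡ-≤ 3 m≤)) (tail-run (tower j)
              (not b ∷ true ∷ [])))) ,
      reverse-involutive (candidate (not b) (tower j))
    finish (e ∷ _ , _ , _ , _ , r , _ , _ , nostage none) = candidate true 0 , invalid none , _ ,
      (loaded r⨾ frame (1F ∷ 2F ∷ 3F ∷ 4F ∷ 5F ∷ 6F ∷ 7F ∷ 8F ∷ []) r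
            r⨾ r-weak (s≤s (≤-trans (n≤1+n 2) (m≤m+n 3 _))) (error-run e)) , refl

  flip-string : Str → Str
  flip-string x = proj₁ (flip-run x)

  FP-flip : FP flip-string
  FP-flip = Compile.FP-intro 7 flip flip-string flipCost (λ x → proj₂ (proj₂ (flip-run x)))
    (linear 3 1 ⊕ poly-recogniseCost ⊕ poly-const 1 ⊕ poly-const 3 ⊕ linear 3 1)

  -- Strings that are candidates of no stage lie outside `A`, so their images must lie inside it. A
  -- fixed member is needed for them, and `decision 0 ≡ true` provides `candidate true 0`. At a
  -- valid stage exactly one bit is right, so flipping exchanges membership.
  A≤coA : decision 0 ≡ true → A ≤pm co A
  A≤coA first = flip-string , FP-flip , λ x → forth (proj₁ (proj₂ (flip-run x))) , back (proj₁ (proj₂ (flip-run x)))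
    where
    not-fixed : ∀ b → not b ≢ b
    not-fixed false ()
    not-fixed true ()
    forth : ∀ {x y} → Flipped x y → A x → co A y
    forth (invalid none) (j , eq) _ = none j _ eq
    forth (flipped j b refl) p q = not-fixed b (trans (A-decision j q) (sym (A-decision j p)))
    back : ∀ {x y} → Flipped x y → co A y → A x
    back (invalid none) ¬A = ⊥-elim (¬A (0 , cong (λ z → candidate z 0) (sym first)))
    back (flipped j b refl) ¬A with b | decision j in eq
    ... | false | false = j , cong (λ z → candidate z (tower j)) (sym eq)
    ... | true | true = j , cong (λ z → candidate z (tower j)) (sym eq)
    ... | false | true = ⊥-elim (¬A (j , cong (λ z → candidate z (tower j)) (sym eq)))
    ... | true | false = ⊥-elim (¬A (j , cong (λ z → candidate z (tower j)) (sym eq)))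

-- Programs for arbitrary machines and the diagonal argument

topC-putC : ∀ a xs → topC (putC a ++ xs) ≡ a
topC-putC blank xs = refl
topC-putC b0 xs = refl
topC-putC b1 xs = refl

restC-putC : ∀ a xs → restC (putC a ++ xs) ≡ xs
restC-putC blank xs = refl
restC-putC b0 xs = refl
restC-putC b1 xs = refl

leading-ones : ∀ n xs → leading (ones n ++ false ∷ xs) ≡ n
leading-ones zero xs = refl
leading-ones (suc n) xs = cong suc (leading-ones n xs)

dropOnes-ones : ∀ n xs → dropOnes (ones n ++ false ∷ xs) ≡ xs
dropOnes-ones zero xs = refl
dropOnes-ones (suc n) xs = dropOnes-ones n xs

moveSym : Move → Sym
moveSym mS = blank
moveSym mL = b0
moveSym mR = b1

instruction : Sym → Move → ℕ → List Bool → List Bool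
instruction w m n rest = putC w ++ (putC (moveSym m) ++ (ones n ++ false ∷ rest))

skipE-instruction : ∀ w m n rest → skipE (instruction w m n rest) ≡ rest
skipE-instruction w m n rest rewrite restC-putC w (putC (moveSym m) ++ (ones n ++ false ∷ rest))
  | restC-putC (moveSym m) (ones n ++ false ∷ rest) = dropOnes-ones n rest

transition-instruction : ∀ w m n rest q L R → transition (instruction w m n rest) (q , L , R) ≡ (n , moveC
      (moveSym m) L (putC w ++ R))
transition-instruction w m n rest q L R rewrite restC-putC w (putC (moveSym m) ++ (ones n ++ false ∷ rest))
  | topC-putC w (putC (moveSym m) ++ (ones n ++ false ∷ rest)) | restC-putC (moveSym m) (ones n ++ false ∷ rest)
  | topC-putC (moveSym m) (ones n ++ false ∷ rest) | leading-ones n rest = refl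

length-++-≥ : ∀ (xs : List Bool) {ys : List Bool} {k} → k ≤ length ys → k ≤ length (xs ++ ys)
length-++-≥ xs {ys} le = ≤-trans le (≤-trans (m≤n+m (length ys) (length xs)) (≤-reflexive (sym (length-++ xs))))

length-instruction : ∀ w m n rest → length rest ≤ length (instruction w m n rest)
length-instruction w m n rest = length-++-≥ (putC w) (length-++-≥ (putC (moveSym m)) (length-++-≥ (ones n) (n≤1+n _)))

iter-+ : ∀ {A : Set} (f : A → A) m n x → iter f (m + n) x ≡ iter f n (iter f m x)
iter-+ f zero n x = refl
iter-+ f (suc m) n x = iter-+ f m n (f x)

layout : ∀ n → (Fin n → List Bool → List Bool) → List Bool → List Bool
layout zero f rest = rest
layout (suc n) f rest = f Fin.zero (layout n (f ∘ Fin.suc) rest)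

-- The text behind the block found is left unspecified, since an entry determines its transition
-- whatever follows it.
seek-layout : ∀ n f → (∀ q rest → iter skipE 3 (f q rest) ≡ rest) → ∀ q pad → Σ (List Bool) λ rest →
      iter skipE (toℕ q * 3) (layout n f pad) ≡ f q rest
seek-layout (suc n) f h Fin.zero pad = _ , refl
seek-layout (suc n) f h (Fin.suc q) pad with seek-layout n (f ∘ Fin.suc) (h ∘ Fin.suc) q pad
... | rest , eq = rest , trans (cong (iter skipE (toℕ q * 3)) (h Fin.zero _)) eq

length-layout : ∀ n f → (∀ q rest → length rest ≤ length (f q rest)) → ∀ pad → length pad ≤ length (layout n f pad)
length-layout zero f h pad = ≤-refl
length-layout (suc n) f h pad = ≤-trans (length-layout n (f ∘ Fin.suc) (h ∘ Fin.suc) pad) (h Fin.zero _)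

-- When the head first moves beyond the right end, its blank is not yet written and the right stack
-- is empty; a blank that was written is an explicit code. Both read alike.
data HeadOn : Sym → List Sym → List Bool → Set where
  written : ∀ {a s} → HeadOn a s (encC (a ∷ s))
  beyond  : HeadOn blank [] []

topC-HeadOn : ∀ {a s R} → HeadOn a s R → topC R ≡ a
topC-HeadOn (written {a}) = topC-putC a _
topC-HeadOn beyond = refl

restC-HeadOn : ∀ {a s R} → HeadOn a s R → restC R ≡ encC s
restC-HeadOn (written {a}) = restC-putC a _
restC-HeadOn beyond = refl

verdictOn : Tree → List Sym → Bool
verdictOn (leaf b) s = b
verdictOn (node k) [] = verdictOn (k blank) []
verdictOn (node k) (a ∷ s) = verdictOn (k a) s

verdict-encC : ∀ t s → verdict t (encC s) ≡ verdictOn t s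
verdict-encC (leaf b) s = refl
verdict-encC (node k) [] = verdict-encC (k blank) []
verdict-encC (node k) (a ∷ s) rewrite topC-putC a (encC s) | restC-putC a (encC s) = verdict-encC (k a) s

verdict-HeadOn : ∀ t {a s R} → HeadOn a s R → verdict t R ≡ verdictOn t (a ∷ s)
verdict-HeadOn t written = verdict-encC t _
verdict-HeadOn (leaf b) beyond = refl
verdict-HeadOn (node k) beyond = verdict-encC (k blank) []

module Code (M : TM) where

  Goto : Set
  Goto = Maybe (State M × Sym × Move)

  -- A halting pair of state and symbol is turned into a loop.
  encode : State M → Sym → Goto → List Bool → List Bool
  encode q a nothing = instruction a mS (toℕ q * 3)
  encode q a (just (q' , w , m)) = instruction w m (toℕ q' * 3)

  encode-entry : State M → Sym → List Bool → List Bool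
  encode-entry q a = encode q a (TM.δ M q a)

  encode-state : State M → List Bool → List Bool
  encode-state q = encode-entry q b0 ∘ encode-entry q b1 ∘ encode-entry q blank

  program : List Bool → List Bool
  program = layout (suc (TM.nstates M)) encode-state

  skipE-encode : ∀ q a g rest → skipE (encode q a g rest) ≡ rest
  skipE-encode q a nothing rest = skipE-instruction a mS _ rest
  skipE-encode q a (just (q' , w , m)) rest = skipE-instruction w m _ rest

  skipE-entry : ∀ q a rest → skipE (encode-entry q a rest) ≡ rest
  skipE-entry q a = skipE-encode q a (TM.δ M q a)

  skipE-state : ∀ q rest → iter skipE 3 (encode-state q rest) ≡ rest
  skipE-state q rest = trans (cong (skipE ∘ skipE) (skipE-entry q b0 _)) (trans (cong skipE
        (skipE-entry q b1 _)) (skipE-entry q blank rest))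

  length-program : ∀ pad → length pad ≤ length (program pad)
  length-program = length-layout _ encode-state (λ q rest → ≤-trans (entry≥ q blank rest)
      (≤-trans (entry≥ q b1 (encode-entry q blank rest)) (entry≥ q b0 (encode-entry q b1
            (encode-entry q blank rest)))))
    where
    encode≥ : ∀ q a g rest → length rest ≤ length (encode q a g rest)
    encode≥ q a nothing rest = length-instruction a mS _ rest
    encode≥ q a (just (q' , w , m)) rest = length-instruction w m _ rest
    entry≥ : ∀ q a rest → length rest ≤ length (encode-entry q a rest)
    entry≥ q a = encode≥ q a (TM.δ M q a)

  seek-entry : ∀ q a rest → Σ (List Bool) λ rest' → iter skipE (offset a)
        (encode-state q rest) ≡ encode-entry q a rest'
  seek-entry q b0 rest = _ , refl
  seek-entry q b1 rest = _ , skipE-entry q b0 _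
  seek-entry q blank rest = _ , trans (cong skipE (skipE-entry q b0 _)) (skipE-entry q b1 _)

  seek-program : ∀ q a pad → Σ (List Bool) λ rest → iter skipE (offset a + toℕ q * 3)
        (program pad) ≡ encode-entry q a rest
  seek-program q a pad with seek-layout _ encode-state skipE-state q pad
  ... | rest , eq with seek-entry q a rest
  ... | rest' , eq' = rest' , trans (cong (λ n → iter skipE n (program pad)) (+-comm (offset a) (toℕ q * 3)))
          (trans (iter-+ skipE (toℕ q * 3) (offset a) (program pad)) (trans (cong (iter skipE (offset a)) eq) eq'))

  data Simulates (q : State M) : Tape → Conf → Set where
    simulates : ∀ {l a r R} → HeadOn a r R → Simulates q (tape l a r) (toℕ q * 3 , encC l , R)

  simulates-move : ∀ q m l w r → Simulates q (moveTape m (tape l w r)) (toℕ q * 3 , moveC (moveSym m) (encC l)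
        (encC (w ∷ r)))
  simulates-move q mS l w r = simulates written
  simulates-move q mL [] w r = simulates written
  simulates-move q mL (x ∷ l) w r rewrite topC-putC x (encC l) | restC-putC x (encC l) = simulates written
  simulates-move q mR l w [] rewrite topC-putC w [] | restC-putC w [] = simulates beyond
  simulates-move q mR l w (x ∷ r) rewrite topC-putC w (encC (x ∷ r)) | restC-putC w (encC (x ∷ r)) = simulates written

  module _ (pad : List Bool) where

    ustep-entry : ∀ q {l a r R} → HeadOn a r R → Σ (List Bool) λ rest →
      ustep (program pad) (toℕ q * 3 , encC l , R) ≡ transition (encode-entry q a rest) (toℕ q * 3 , encC l , encC r)
    ustep-entry q {a = a} h rewrite topC-HeadOn h | restC-HeadOn h with seek-program q a pad
    ... | rest , eq rewrite eq = rest , refl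

    simulates-step : ∀ {q l a r s q' w m} → Simulates q (tape l a r) s → TM.δ M q a ≡ just (q' , w , m) →
                     Simulates q' (moveTape m (tape l w r)) (ustep (program pad) s)
    simulates-step {q} {l} {a} {r} {q' = q'} {w} {m} (simulates h) eq with ustep-entry q {l} h
    ... | rest , e rewrite e | eq | transition-instruction w m (toℕ q' * 3) rest (toℕ q * 3) (encC l)
          (encC r) = simulates-move q' m l w r

    simulates-halted : ∀ {q l a r s} → Simulates q (tape l a r) s → TM.δ M q a ≡ nothing →
          Simulates q (tape l a r) (ustep (program pad) s)
    simulates-halted {q} {l} {a} {r} (simulates h) eq with ustep-entry q {l} h
    ... | rest , e rewrite e | eq | transition-instruction a mS (toℕ q * 3) rest (toℕ q * 3) (encC l)
          (encC r) = simulates written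

    -- The clock runs for exactly m steps while the machine may halt at some t ≤ m. The loop encoded
    -- for halting pairs preserves the final tape for the remaining steps.
    simulates-exec : ∀ m {t q T U s} → exec M t q T ≡ just U → t ≤ m → Simulates q T s →
                     Σ (State M) λ q' → Simulates q' U (iter (ustep (program pad)) m s)
    simulates-exec zero {zero} {q} {tape l a r} eq z≤n sim with TM.δ M q a | eq
    ... | nothing | refl = q , sim
    ... | just _ | ()
    simulates-exec (suc m) {t} {q} {tape l a r} eq le sim with TM.δ M q a in e
    simulates-exec (suc m) {t} {q} {tape l a r} refl le sim | nothing =
      simulates-exec m {0} {q} {tape l a r} (exec-halt M {0} {q} {tape l a r} e) z≤n (simulates-halted sim e)
    simulates-exec (suc m) {suc t} {q} {tape l a r} eq (s≤s le) sim | just (q' , w , dir) =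
      simulates-exec m eq le (simulates-step sim e)

    simulates-HaltsWith : ∀ t m x {out} → HaltsWith M x t out → t ≤ m → Σ (List Sym) λ s → readBits s ≡ out ×
      (∀ tr → verdict tr (proj₂ (proj₂ (iter (ustep (program pad)) m (0 , [] , encC (symsOf x))))) ≡ verdictOn tr s)
    simulates-HaltsWith t m x (tape l a r , eq , refl) le with simulates-exec m eq le (initial x)
      where
      initial : ∀ x → Simulates Fin.zero (initTape x) (0 , [] , encC (symsOf x))
      initial [] = simulates beyond
      initial (b ∷ x) = simulates written
    ... | q' , sim = a ∷ r , refl , λ tr → final tr sim
      where
      final : ∀ tr {s} → Simulates q' (tape l a r) s → verdict tr (proj₂ (proj₂ s)) ≡ verdictOn tr (a ∷ r)
      final tr (simulates h) = verdict-HeadOn tr h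

-- Bijective numeration reaches every string, so each program is met at the stage given by its own
-- value.
index-bval : ∀ s → index (bval s) ≡ s
index-bval s = bval-injective _ s (trans (bval-iter (bval s) []) (+-identityʳ _))

j≤tower : ∀ j → j ≤ tower j
j≤tower zero = z≤n
j≤tower (suc j) = ≤-trans (s≤s (j≤tower j)) (m<2^m (tower j))

-- With r = 6 + s this is (2 + r)^2 ≤ 2^r; equality at r = 6 starts the induction.
square≤power : ∀ s → (8 + s) * (8 + s) ≤ 2 ^ (6 + s)
square≤power zero = ≤-refl
square≤power (suc s) = ≤-trans (≤-by (47 + 14 * s + s * s) (lemma s)) (*-monoʳ-≤ 2 (square≤power s))
  where
  lemma : ∀ s → (9 + s) * (9 + s) + (47 + 14 * s + s * s) ≡ 2 * ((8 + s) * (8 + s))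
  lemma = solve-∀

abstract
  -- At n = 2^r the exponents are compared: a polynomial in n is 2 to the power of a linear function of r.
  growth : ∀ c e → Σ ℕ λ p → ∀ j {ℓ} → p ≤ j → ℓ ≤ e * suc (tower j) → c * ℓ ^ c + c ≤ 2 ^ tower j
  growth c e = suc (h + 6) , bound
    where
    -- With T(j) = 2^r, the bound has exponent 2c + (e + 1 + r)c = h + cr. Since c ≤ h this is at
    -- most h(2 + r), and for r ≥ h + 6 at most (2 + r)^2 ≤ 2^r. The extra successor in the
    -- threshold makes j the successor of a stage i with r = T(i).
    h : ℕ
    h = 2 * c + suc e * c
    bound : ∀ j {ℓ} → suc (h + 6) ≤ j → ℓ ≤ e * suc (tower j) → c * ℓ ^ c + c ≤ 2 ^ tower j
    bound (suc i) {ℓ} (s≤s h≤i) ℓ≤ = ≤-trans (+-mono-≤ (*-monoʳ-≤ c ℓ^c≤) (≤-trans (≤-reflexive (sym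
          (*-identityʳ c))) (*-monoʳ-≤ c (m^n>0 2 (k * c)))))
        (≤-trans (≤-reflexive (collect c (2 ^ (k * c)))) (≤-trans (*-monoˡ-≤ (2 ^ (k * c)) (<⇒≤ (m<2^m (2 * c))))
        (≤-trans (≤-reflexive (sym (^-distribˡ-+-* 2 (2 * c) (k * c)))) (^-monoʳ-≤ 2 exponent))))
      where
      r k : ℕ
      r = tower i
      k = suc e + r
      collect : ∀ c x → c * x + c * x ≡ 2 * c * x
      collect = solve-∀
      h+6≤r : h + 6 ≤ r
      h+6≤r = ≤-trans h≤i (j≤tower i)
      ℓ≤2^k : ℓ ≤ 2 ^ k
      ℓ≤2^k = ≤-trans ℓ≤ (≤-trans (*-mono-≤ (<⇒≤ (m<2^m e)) (double (m^n>0 2 r)))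
        (≤-reflexive (trans (sym (^-distribˡ-+-* 2 e (suc r))) (cong (2 ^_) (+-suc e r)))))
        where
        double : ∀ {x} → 0 < x → suc x ≤ 2 * x
        double {x} pos = ≤-trans (+-monoˡ-≤ x pos) (≤-reflexive (cong (x +_) (sym (+-identityʳ x))))
      ℓ^c≤ : ℓ ^ c ≤ 2 ^ (k * c)
      ℓ^c≤ = ≤-trans (^-monoˡ-≤ c ℓ≤2^k) (≤-reflexive (^-*-assoc 2 k c))
      rearrange : ∀ c e r → 2 * c + (suc e + r) * c ≡ (2 * c + suc e * c) + c * r
      rearrange = solve-∀
      c≤h : c ≤ h
      c≤h = ≤-trans (m≤m+n c _) (m≤m+n (2 * c) _)
      factor : ∀ h r → h + h * r + h ≡ h * (2 + r)
      factor = solve-∀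
      square : (2 + r) * (2 + r) ≤ 2 ^ r
      square = subst (λ z → (2 + z) * (2 + z) ≤ 2 ^ z) (m+[n∸m]≡n (≤-trans (m≤n+m 6 h) h+6≤r)) (square≤power (r ∸ 6))
      exponent : 2 * c + k * c ≤ 2 ^ r
      exponent = ≤-trans (≤-reflexive (rearrange c e r)) (≤-trans (+-monoʳ-≤ h (*-monoˡ-≤ r c≤h))
        (≤-trans (≤-by h (factor h r)) (≤-trans (*-monoˡ-≤ (2 + r) (≤-trans (≤-trans (m≤m+n h 6) h+6≤r)
              (m≤n+m r 2))) square)))

module Diagonalise (Q : Query) where
  open Query Q
  open Diagonal Q

  -- The generator adds at most one bit per step, so its running time already bounds the length of
  -- the question.
  length-input : ∀ n → length (input n) ≤ (1 + slope + intercept) * suc n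
  length-input n = ≤-trans (length-cells (input n)) (≤-trans (≤-trans (m≤n+m _ (length (ones n))) (≤-trans
        (+-monoʳ-≤ (length (ones n)) (m≤m+n _ 0)) (total-run (generate-run n))))
      (≤-trans (≤-reflexive (cong (λ z → z + 0 + (n * slope + intercept)) (length-replicate n))) (≤-by
            (1 + slope + n * intercept) (slack n slope intercept))))
    where
    slack : ∀ n s i → n + 0 + (n * s + i) + (1 + s + n * i) ≡ (1 + s + i) * suc n
    slack = solve-∀
    length-cells : ∀ x → length x ≤ length (encC (symsOf x))
    length-cells [] = z≤n
    length-cells (false ∷ x) = s≤s (m≤n⇒m≤1+n (length-cells x))
    length-cells (true ∷ x) = s≤s (m≤n⇒m≤1+n (length-cells x))

  -- Padding the program of the machine pushes its stage up to where 2^n exceeds the time bound.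
  diagonalise : ∀ {f} → FP f → Σ ℕ λ j → Σ (List Sym) λ s → readBits s ≡ f (input (tower j)) ×
        decision j ≡ not (verdictOn tree s)
  diagonalise {f} (M , c , halts) with growth c (1 + slope + intercept)
  ... | p , bound = j , stage-run (halts (input (tower j)))
    where
    open Code M
    pad = replicate p false
    j = bval (program pad)
    -- A numeral is never longer than its value, so p trailing bits force the stage up to p; they
    -- stand behind the whole table and are never read as an entry.
    p≤j : p ≤ j
    p≤j = ≤-trans (≤-reflexive (sym (length-replicate p))) (≤-trans (length-program pad) (length≤bval (program pad)))
    stage-run : (Σ ℕ λ t → t ≤ c * length (input (tower j)) ^ c + c ×
          HaltsWith M (input (tower j)) t (f (input (tower j)))) →
      Σ (List Sym) λ s → readBits s ≡ f (input (tower j)) × decision j ≡ not (verdictOn tree s)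
    stage-run (t , t≤ , h) with simulates-HaltsWith pad t (2 ^ tower j) (input (tower j)) h (≤-trans t≤
          (bound j p≤j (length-input (tower j))))
    ... | s , eq , v = s , eq , cong not (trans (cong (λ z → verdict tree (proj₂ (proj₂ (iter (ustep z)
          (2 ^ tower j) (start (tower j)))))) (index-bval (program pad))) (v tree))

-- The two instances

cells : Str → List Bool
cells = encC ∘ symsOf

cells-++ : ∀ x y → cells (x ++ y) ≡ cells x ++ cells y
cells-++ [] y = refl
cells-++ (b ∷ x) y = trans (cong (putC (bitSym b) ++_) (cells-++ x y)) (sym (++-assoc (putC (bitSym b))
      (cells x) (cells y)))

iter-comm : ∀ {A : Set} (f : A → A) n x → iter f n (f x) ≡ f (iter f n x)
iter-comm f zero x = refl
iter-comm f (suc n) x = iter-comm f n (f x)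

prepend : List Bool → Cmd 3
prepend [] = skip
prepend (b ∷ s) = prepend s ⨾ push 2F b

prepend-run : ∀ s {u v R} → Run (prepend s) (u ∷ v ∷ R ∷ []) (suc (length s)) (u ∷ v ∷ (s ++ R) ∷ [])
prepend-run [] = r-skip
prepend-run (b ∷ s) = r-weak (≤-reflexive (+-comm (suc (length s)) 1)) (prepend-run s r⨾ r-push refl)

prependOnes : Str → Cmd 3
prependOnes w = eachOne (prepend (cells w))

-- The result is described by a recurrence for `z`, which fits plain ones as well as doubled ones in
-- front of an encoded list.
prependOnes-run : ∀ w n x → (z : ℕ → Str) → z 0 ≡ x → (∀ i → z (suc i) ≡ w ++ z i) →
  Run (prependOnes w) (ones n ∷ [] ∷ cells x ∷ []) (n * (suc (length (cells w)) + 6) + 2) (ones n ∷ [] ∷ cells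
        (z n) ∷ [])
prependOnes-run w n x z z0 zs = subst (λ R → Run (prependOnes w) (ones n ∷ [] ∷ cells x ∷ []) (n * (suc (length
      (cells w)) + 6) + 2) (ones n ∷ [] ∷ R ∷ []))
  (unfold n) (eachOne-run (cells w ++_) (prepend-run (cells w)) n (cells x))
  where
  unfold : ∀ n → iter (cells w ++_) n (cells x) ≡ cells (z n)
  unfold zero = cong cells (sym z0)
  unfold (suc n) = trans (iter-comm (cells w ++_) n (cells x)) (trans (cong (cells w ++_) (unfold n))
    (trans (sym (cells-++ w (z n))) (cong cells (sym (zs n)))))

readBits-∷ : ∀ s {b x} → readBits s ≡ b ∷ x → Σ (List Sym) λ s' → s ≡ bitSym b ∷ s' × readBits s' ≡ x
readBits-∷ (b0 ∷ s) refl = s , refl , refl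
readBits-∷ (b1 ∷ s) refl = s , refl , refl

-- The question of acceptance: a set outside P

acceptTree : Tree
acceptTree = node λ { b1 → node (λ { blank → leaf true ; _ → leaf false }) ; _ → leaf false }

acceptTree-sound : ∀ s → verdictOn acceptTree s ≡ true → readBits s ≡ true ∷ []
acceptTree-sound (b1 ∷ []) eq = refl
acceptTree-sound (b1 ∷ blank ∷ s) eq = refl

acceptTree-complete : ∀ s → readBits s ≡ true ∷ [] → verdictOn acceptTree s ≡ true
acceptTree-complete (b1 ∷ []) eq = refl
acceptTree-complete (b1 ∷ blank ∷ s) eq = refl

acceptance : Query
acceptance = record
  { input = candidate true
  ; tree = acceptTree
  ; generate = prependOnes (true ∷ []) ⨾ prepend (cells (true ∷ true ∷ []))
  ; slope = 9
  ; intercept = 7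
  ; generate-run = λ n → r-weak (≤-reflexive (+-assoc (n * 9) 2 5))
      (prependOnes-run (true ∷ []) n [] ones refl (λ _ → refl) r⨾ prepend-run (cells (true ∷ true ∷ []))) }

module Acceptance where
  open Diagonal acceptance public
  open Diagonalise acceptance

  -- A machine that accepts the candidate with bit 1 claims that the bit is 1, and one that does not
  -- accept claims that it is 0; the stage has chosen the other value.
  refute : ∀ {f : Str → Str} {j s} → (∀ x → (A x → f x ≡ true ∷ []) × (f x ≡ true ∷ [] → A x)) →
        readBits s ≡ f (candidate true (tower j)) →
           decision j ≡ not (verdictOn acceptTree s) → ∀ v → verdictOn acceptTree s ≡ v → ⊥
  refute {j = j} {s} decides out dj true v =
    case trans (A-decision j (proj₂ (decides _) (trans (sym out) (acceptTree-sound s v)))) (trans dj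
          (cong not v)) of λ ()
  refute {j = j} {s} decides out dj false v =
    case trans (sym v) (acceptTree-complete s (trans out (proj₁ (decides _) (j , cong (λ b →
          candidate b (tower j)) (sym (trans dj (cong not v))))))) of λ ()

  A∉P : ¬ InP A
  A∉P (f , fp , decides) = let (j , s , out , dj) = diagonalise fp in refute {f} {j} {s} decides out dj _ refl

-- The question of selection: a set outside S(k)

zeros : ℕ → Str
zeros i = replicate i false

strip : Str → Str
strip (false ∷ x) = strip x
strip x = x

padded : ℕ → Bool → ℕ → Str
padded i b n = zeros i ++ candidate b n

strip-padded : ∀ i b n → strip (padded i b n) ≡ candidate b n
strip-padded zero b n = refl
strip-padded (suc i) b n = strip-padded i b n

-- The leading zeros serve to make the pairs distinct and increasing; `strip` sends all of them to
-- the two candidates of one stage.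
question : ℕ → ℕ → ℕ → List Str
question i zero n = []
question i (suc m) n = padded i false n ∷ padded i true n ∷ question (suc i) m n

dbl-++ : ∀ x y → dbl (x ++ y) ≡ dbl x ++ dbl y
dbl-++ [] y = refl
dbl-++ (b ∷ x) y = cong (λ z → b ∷ b ∷ z) (dbl-++ x y)

prefix : ℕ → Bool → Str
prefix i b = dbl (zeros i ++ true ∷ b ∷ [])

prependPadded : ℕ → Bool → Cmd 3
prependPadded i b = prepend (cells (false ∷ true ∷ [])) ⨾ prependOnes (true ∷ true ∷ []) ⨾ prepend (cells
      (prefix i b))

paddedCost : ℕ → Bool → ℕ
paddedCost i b = 8 + length (cells (prefix i b))

prependPadded-run : ∀ i b n x → Run (prependPadded i b) (ones n ∷ [] ∷ cells x ∷ []) (n * 11 + paddedCost i b)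
  (ones n ∷ [] ∷ cells (dbl (padded i b n) ++ false ∷ true ∷ x) ∷ [])
prependPadded-run i b n x = subst (λ R → Run (prependPadded i b) (ones n ∷ [] ∷ cells x ∷ [])
      (n * 11 + paddedCost i b) (ones n ∷ [] ∷ R ∷ []))
  (trans (sym (cells-++ (prefix i b) (dbl (ones n) ++ false ∷ true ∷ x)))
    (cong cells (trans (sym (++-assoc (prefix i b) (dbl (ones n)) (false ∷ true ∷ x)))
      (cong (_++ false ∷ true ∷ x) (trans (sym (dbl-++ (zeros i ++ true ∷ b ∷ []) (ones n)))
        (cong dbl (++-assoc (zeros i) (true ∷ b ∷ []) (ones n))))))))
  (r-weak (≤-reflexive (cost n (length (cells (prefix i b)))))
    (prepend-run (cells (false ∷ true ∷ [])) r⨾ prependOnes-run (true ∷ true ∷ []) n (false ∷ true ∷ x) (λ m →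
          dbl (ones m) ++ false ∷ true ∷ x) refl (λ _ → refl)
     r⨾ prepend-run (cells (prefix i b))))
  where
  cost : ∀ n l → 5 + ((n * 11 + 2) + suc l) ≡ n * 11 + (8 + l)
  cost = solve-∀

askAll : ℕ → ℕ → Cmd 3
askAll i zero = skip
askAll i (suc m) = askAll (suc i) m ⨾ prependPadded i true ⨾ prependPadded i false

askSlope askIntercept : ℕ → ℕ → ℕ
askSlope i zero = 0
askSlope i (suc m) = askSlope (suc i) m + 22
askIntercept i zero = 1
askIntercept i (suc m) = askIntercept (suc i) m + (paddedCost i true + paddedCost i false)

askAll-run : ∀ i m n → Run (askAll i m) (ones n ∷ [] ∷ [] ∷ []) (n * askSlope i m + askIntercept i m)
      (ones n ∷ [] ∷ cells (enc (question i m n)) ∷ [])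
askAll-run i zero n = r-weak (m≤n+m 1 (n * 0)) r-skip
askAll-run i (suc m) n = r-weak (≤-reflexive (cost n (askSlope (suc i) m) (askIntercept (suc i) m)
      (paddedCost i true) (paddedCost i false)))
  (askAll-run (suc i) m n r⨾ prependPadded-run i true n (enc (question (suc i) m n)) r⨾ prependPadded-run i false n _)
  where
  cost : ∀ n s t p q → (n * s + t) + ((n * 11 + p) + (n * 11 + q)) ≡ n * (s + 22) + (t + (p + q))
  cost = solve-∀

-- Reads the bit b off an encoded list starting with a string 0^i 1 b ⋯.
bitTree : ℕ → Tree
bitTree zero = leaf false
bitTree (suc m) = node λ { b0 → bitTree m ; b1 → node (λ _ → node (λ { b1 → leaf true ; _ →
      leaf false })) ; blank → leaf false }

-- Doubling makes every leading zero cost two reads, so a budget of 2i + 1 reaches the first copy of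
-- the leading 1. The tree then skips its twin and reads b.
bitTree-padded : ∀ m i {b x} s → suc (i + i) ≤ m → readBits s ≡ dbl (zeros i ++ true ∷ b ∷ []) ++ x →
      verdictOn (bitTree m) s ≡ b
bitTree-padded (suc m) zero {false} s le eq with readBits-∷ s eq
... | s₁ , refl , eq₁ with readBits-∷ s₁ eq₁
... | s₂ , refl , eq₂ with readBits-∷ s₂ eq₂
... | s₃ , refl , eq₃ = refl
bitTree-padded (suc m) zero {true} s le eq with readBits-∷ s eq
... | s₁ , refl , eq₁ with readBits-∷ s₁ eq₁
... | s₂ , refl , eq₂ with readBits-∷ s₂ eq₂
... | s₃ , refl , eq₃ = refl
bitTree-padded (suc m) (suc i) s le eq with readBits-∷ s eq
... | s₁ , refl , eq₁ with readBits-∷ s₁ eq₁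
bitTree-padded (suc zero) (suc i) s (s≤s ()) eq | s₁ , refl , eq₁ | s₂ , refl , eq₂
bitTree-padded (suc (suc m)) (suc i) s (s≤s (s≤s le)) eq | s₁ , refl , eq₁ | s₂ , refl , eq₂ =
  bitTree-padded m i s₂ (≤-trans (≤-reflexive (sym (+-suc i i))) le) eq₂

selection : ℕ → Query
selection k = record
  { input = enc ∘ question 0 k
  ; tree = bitTree (k + k)
  ; generate = askAll 0 k
  ; slope = askSlope 0 k
  ; intercept = askIntercept 0 k
  ; generate-run = askAll-run 0 k }

-- `dec` succeeds on exact encodings only. The raw output of a selector therefore begins with the
-- code of its first selected string, which is where the tree looks.
enc-dec : ∀ x {ws} → dec x ≡ just ws → x ≡ enc ws
enc-dec [] refl = refl
enc-dec (false ∷ true ∷ x) eq with dec x in e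
enc-dec (false ∷ true ∷ x) refl | just ws = cong (λ z → false ∷ true ∷ z) (enc-dec x e)
enc-dec (false ∷ false ∷ x) eq with dec x in e
enc-dec (false ∷ false ∷ x) refl | just (w ∷ ws) = cong (λ z → false ∷ false ∷ z) (enc-dec x e)
enc-dec (true ∷ true ∷ x) eq with dec x in e
enc-dec (true ∷ true ∷ x) refl | just (w ∷ ws) = cong (λ z → true ∷ true ∷ z) (enc-dec x e)

question-∈ : ∀ i m n {z} → z ∈ question i m n → Σ ℕ λ i' → Σ Bool λ b → i' < i + m × z ≡ padded i' b n
question-∈ i (suc m) n (here refl) = i , false , m<m+n i z<s , refl
question-∈ i (suc m) n (there (here refl)) = i , true , m<m+n i z<s , refl
question-∈ i (suc m) n (there (there z∈)) with question-∈ (suc i) m n z∈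
... | i' , b , lt , eq = i' , b , ≤-trans lt (≤-reflexive (sym (+-suc i m))) , eq

padded-< : ∀ i n → padded i false n <std padded i true n
padded-< i n = inj₂ (same-length i , lex i)
  where
  same-length : ∀ i → length (padded i false n) ≡ length (padded i true n)
  same-length zero = refl
  same-length (suc i) = cong suc (same-length i)
  lex : ∀ i → padded i false n <lex padded i true n
  lex zero = there here
  lex (suc i) = there (lex i)

padded-suc-< : ∀ i n → padded i true n <std padded (suc i) false n
padded-suc-< i n = inj₁ (s≤s (longer i))
  where
  longer : ∀ i → length (padded i true n) ≤ length (padded i false n)
  longer zero = ≤-refl
  longer (suc i) = s≤s (longer i)

question-Linked : ∀ i m n → Linked _<std_ (question i m n)
question-Linked i zero n = []
question-Linked i (suc zero) n = padded-< i n ∷ [-]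
question-Linked i (suc (suc m)) n = padded-< i n ∷ padded-suc-< i n ∷ question-Linked (suc i) (suc m) n

module SelectionFails (k : ℕ) where
  open Diagonal (selection k) public
  open Diagonalise (selection k)

  L : Language
  L w = A (strip w)

  padded-L : ∀ i j {b} → b ≡ decision j → L (padded i b (tower j))
  padded-L i j {b} eq = j , trans (strip-padded i b (tower j)) (cong (λ b → candidate b (tower j)) eq)

  question-many : ∀ i m j {b} → b ≡ decision j → AtLeastIn m L (question i m (tower j))
  question-many i zero j eq = [] , [] , refl , []
  question-many i (suc m) j {b} eq = extend b eq (question-many (suc i) m j eq)
    where
    extend : ∀ b → b ≡ decision j → AtLeastIn m L (question (suc i) m (tower j)) →
          AtLeastIn (suc m) L (question i (suc m) (tower j))
    extend false eq (zs , sub , len , all) = padded i false (tower j) ∷ zs , refl ∷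
          (_ ∷ʳ sub) , cong suc len , padded-L i j eq ∷ all
    extend true eq (zs , sub , len , all) = padded i true (tower j) ∷ zs , _ ∷ʳ
          (refl ∷ sub) , cong suc len , padded-L i j eq ∷ all

  not-fixed : ∀ b → b ≢ not b
  not-fixed false ()
  not-fixed true ()

  readout : ∀ i b n zs → enc (padded i b n ∷ zs) ≡ dbl (zeros i ++ true ∷ b ∷ []) ++ (dbl
        (ones n) ++ false ∷ true ∷ enc zs)
  readout i b n zs = trans (cong (λ y → dbl y ++ false ∷ true ∷ enc zs) (sym (++-assoc (zeros i) (true ∷ b ∷ [])
        (ones n))))
    (trans (cong (_++ false ∷ true ∷ enc zs) (dbl-++ (zeros i ++ true ∷ b ∷ []) (ones n)))
           (++-assoc (dbl (zeros i ++ true ∷ b ∷ [])) (dbl (ones n)) _))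

  -- The first selected string shows a bit b. Membership in `L` forces b to be the bit of the stage,
  -- whereas the tree reads this same b and the stage takes its negation.
  refute : ∀ {f : Str → Str} {j s} → readBits s ≡ f (enc (question 0 k (tower j))) →
        decision j ≡ not (verdictOn (bitTree (k + k)) s) →
    ∀ zs → SelOut f (question 0 k (tower j)) zs → All (_∈ question 0 k (tower j)) zs → All L zs → 1 ≤ length zs → ⊥
  refute {j = j} {s} out dj (z ∷ zs) sel (z∈ ∷ _) (z∈L ∷ _) _ = clash (question-∈ 0 k (tower j) z∈)
    where
    clash : (Σ ℕ λ i → Σ Bool λ b → i < k × z ≡ padded i b (tower j)) → ⊥
    clash (i , b , i<k , z≡) = not-fixed b (trans (A-decision j (subst A (trans (cong strip z≡)
          (strip-padded i b (tower j))) z∈L)) (trans dj (cong not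
      (bitTree-padded (k + k) i s (+-mono-≤ i<k (<⇒≤ i<k))
        (trans out (trans (enc-dec _ sel) (trans (cong (λ z → enc (z ∷ zs)) z≡) (readout i b (tower j) zs))))))))

  L∉S : 1 ≤ k → ¬ SClass k L
  L∉S 1≤k (f , fp , lift selects) =
    let (j , s , out , dj) = diagonalise fp
        (zs , sel , zs∈ , good) = selects (question 0 k (tower j)) (nonempty k 1≤k (tower j))
              (question-Linked 0 k (tower j))
        (zs∈L , some) = good (question-many 0 k j refl)
    in refute {f} {j} {s} out dj zs sel zs∈ zs∈L some
    where
    nonempty : ∀ k → 1 ≤ k → ∀ n → 1 ≤ length (question 0 k n)
    nonempty (suc k) _ n = s≤s z≤n

idle : TM
idle = record { nstates = 0 ; δ = λ _ _ → nothing }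

readBits-symsOf : ∀ x → readBits (symsOf x) ≡ x
readBits-symsOf [] = refl
readBits-symsOf (false ∷ x) = cong (false ∷_) (readBits-symsOf x)
readBits-symsOf (true ∷ x) = cong (true ∷_) (readBits-symsOf x)

FP-id : FP id
FP-id = idle , 0 , λ x → 0 , z≤n , initTape x , refl , output-init x
  where
  output-init : ∀ x → output (initTape x) ≡ x
  output-init [] = refl
  output-init (b ∷ x) = readBits-symsOf (b ∷ x)

-- Output is read from the head rightwards, so walking past the zeros removes them without shifting
-- the word.
stripper : TM
stripper = record { nstates = 0 ; δ = λ { _ b0 → just (Fin.zero , blank , mR) ; _ _ → nothing } }

FP-strip : FP strip
FP-strip = stripper , 1 , λ x → length x , bound (length x) , halts x
  where
  bound : ∀ n → n ≤ 1 * n ^ 1 + 1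
  bound n = ≤-trans (≤-reflexive (sym (trans (*-identityˡ _) (^-identityʳ n)))) (m≤m+n _ 1)
  at : List Sym → Str → Tape
  at l [] = tape l blank []
  at l (b ∷ x) = tape l (bitSym b) (symsOf x)
  advance : ∀ l x → moveTape mR (tape l blank (symsOf x)) ≡ at (blank ∷ l) x
  advance l [] = refl
  advance l (b ∷ x) = refl
  run : ∀ l x → Σ Tape λ U → exec stripper (length x) Fin.zero (at l x) ≡ just U × output U ≡ strip x
  run l [] = _ , refl , refl
  run l (true ∷ x) = _ , refl , readBits-symsOf (true ∷ x)
  run l (false ∷ x) with run (blank ∷ l) x
  ... | U , eq , out = U , trans (cong (exec stripper (length x) Fin.zero) (advance l x)) eq , out
  halts : ∀ x → HaltsWith stripper x (length x) (strip x)
  halts [] = run [] []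
  halts (b ∷ x) = run [] (b ∷ x)

theorem3p6 : ((k : ℕ) → 2 ≤ k →
    ((L : Language) → SClass k L → Rpm (SClass k) L)
    × Σ Language (λ L → Rpm (SClass k) L × ¬ SClass k L))
    × Σ Language (λ A → SClass 2 A × A ≤pm co A × ¬ InP A)
theorem3p6 =
  (λ k 2≤k → (λ L s → L , s , id , FP-id , λ _ → id , id) ,
             SelectionFails.L k ,
             (SelectionFails.A k , Diagonal-S.S-A (selection k) k 2≤k , strip , FP-strip , λ _ → id , id) ,
             SelectionFails.L∉S k (≤-trans (n≤1+n 1) 2≤k)) ,
  -- `decision 0` evaluates to `true`: program 0 is empty, its single step blanks the first input
  -- cell, and `acceptTree` rejects a leading blank.
  (Acceptance.A , Diagonal-S.S-A acceptance 2 ≤-refl , Diagonal-S.A≤coA acceptance refl , Acceptance.A∉P)
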